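{- Let $\lambda$ be a partition, $n\ge1$, $x_1,\dots,x_n>0$, $t\ge0$. Consider the tableau Markov chain on $\operatorname{Tab}(\lambda,n)$: from state $\sigma$, for each cell $u\in\operatorname{dg}(\lambda)$ with $\sigma(\mathrm S(u))\ne\sigma(u)$, there is a transition to $R'_u(\sigma)$ at rate $x_{\sigma(u)}^{ -1}t^{\operatorname{down}(\sigma,u)}$ (with $0^0=1$), these rates adding when several cells lead to the same state. Then the probability measure on $\operatorname{Tab}(\lambda,n)$ proportional to $\operatorname{wt}(\sigma)=t^{\operatorname{quinv}(\sigma)}\prod_{u\in\operatorname{dg}(\lambda)}x_{\sigma(u)}$ is stationary for this chain.
   Context: Fillings: $\operatorname{dg}(\lambda)=\{(r,i):1\le i\le\ell(\lambda),\ 1\le r\le\lambda_i\}$ (row $r$ from the bottom, column $i$ from the left); $\operatorname{Tab}(\lambda,n)$ = set of maps $\sigma:\operatorname{dg}(\lambda)\to[n]$. $\mathcal Q$ = set of integer triples $(a,b,c)$ with $a<b<c$, or $b<c<a$, or $c<b<a$, or $a=b\ne c$. With $\sigma(\lambda_i+1,i):=0$, $\operatorname{quinv}(\sigma)$ = number of pairs of cells $(r,i),(r,j)$, $i<j$, with $(\sigma(r+1,i),\sigma(r,i),\sigma(r,j))\in\mathcal Q$. Statistics: for $u=(r,c)$, $\mathrm S(u)=(r-1,c)$, $\mathrm N(u)=(r+1,c)$, with $\sigma(\mathrm S(u))=\infty$ if $r=1$ and $\sigma(\mathrm N(u))=0$ if $r=\lambda_c$. $\operatorname{arm}(u)=\{(r,j)\in\operatorname{dg}(\lambda):j<c\}\cup\{(r-1,j)\in\operatorname{dg}(\lambda):j>c\}$.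 $\operatorname{down}(\sigma,u)=\#\{y\in\operatorname{arm}(u):\sigma(y)=\sigma(u)\}$ when $\sigma(\mathrm S(u))\ne\sigma(u)$. Ringing path map: $h_u(\sigma)$ is the largest $h$ with $r\le h\le\lambda_c$ such that $\sigma(i+1,c)-\sigma(i,c)\equiv1\pmod n$ for all $r\le i<h$. If $\sigma(\mathrm S(u))\neq\sigma(u)$, $R_u(\sigma)$ increments (cyclically, $n\mapsto1$) the entries of cells $(i,c)$, $r\le i\le h_u(\sigma)$, other entries unchanged. Operators $\tau_j$: if $\lambda_j=\lambda_{j+1}=h$, write $a_i=\sigma(i,j)$, $b_i=\sigma(i,j+1)$. Let $r_{\max}$ be the largest $r\in\{2,\dots,h\}$ such that $(a_r,a_{r-1},b_{r-1})\in\mathcal Q\iff(b_r,a_{r-1},b_{r-1})\in\mathcal Q$, or $r_{\max}=1$ if none. $\tau_j(\sigma)$ swaps the entries of $(i,j)$ and $(i,j+1)$ for all $r_{\max}\le i\le h$. Map $R'_u$: for $\xi$ and $u=(r',v)$ with $\xi(\mathrm S(u))\ne\xi(u)$, let $\sigma=R_u(\xi)$, $r=h_u(\xi)$, $y=(r,v)$. If $\xi(y)\ne n$ or $r<\lambda_v$, $R'_u(\xi)=\sigma$. Otherwise let $\{s,\dots,s+k\}$ be the set of all columns $j$ with $\lambda_j=\lambda_v$, $v'=2s+k-v$, and $R'_u(\xi)=\tau_{v'-1}\circ\cdots\circ\tau_{v}(\sigma)$ if $v<v'$, $=\sigma$ if $v=v'$, $=\tau_{v'}\circ\cdots\circ\tau_{v-1}(\sigma)$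 if $v>v'$ (rightmost operator applied first).
   Formalization: In the set 𝒬 the third alternative, printed as c<b<a, is corrected to c<a<b (the cyclic class of a<b<c); with the printed version the measure is not stationary, e.g. for λ=(2,1), n=3, t≠1. -}

module Defs where

open import Algebra.Apartness.Bundles using (HeytingField; HeytingCommutativeRing)
open import Algebra.Bundles using (CommutativeRing)
import Algebra.Properties.Semiring.Exp as Exp
open import Data.Fin as F using (Fin; toℕ; fromℕ<)
import Data.Fin.Properties as Fₚ
open import Data.List as L using
  (List; []; _∷_; filter; allFin; cartesianProduct; cartesianProductWith; applyUpTo)
open import Data.List.Extrema.Nat using (max; min)
import Data.List.Relation.Unary.All as ListAll
open import Data.Maybe.Properties using () renaming (≡-dec to Maybe-≡-dec)
open import Data.Nat using (ℕ; zero; suc; pred; _+_; _∸_; _≤_; _<_; _<?_; _≤?_; _≟_; _%_; NonZero)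
open import Data.Nat.DivMod using (_mod_)
open import Data.Nat.Properties using (<-trans; n<1+n; <-cmp)
open import Data.Product using (Σ; _×_; _,_; uncurry)
open import Data.Sum using (_⊎_)
open import Data.Vec as V using (Vec; []; _∷_)
open import Data.Vec.Properties using () renaming (≡-dec to Vec-≡-dec)
open import Data.Vec.Relation.Unary.All using (All; []; _∷_)
open import Data.Vec.Relation.Unary.All.Properties using (lookup⁺; lookup⁻)
open import Function using (_∘_)
open import Level using (Level; _⊔_) renaming (suc to lsuc)
open import Relation.Binary.Core using (Rel)
open import Relation.Binary.Definitions using (DecidableEquality; tri<; tri≈; tri>)
open import Relation.Binary.PropositionalEquality using (_≡_; _≢_; refl; sym; cong₂)
open import Relation.Binary.Structures using (IsStrictPartialOrder)
open import Relation.Nullary using (¬_; Dec; yes; no)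
open import Relation.Nullary.Construct.Add.Supremum using (_⁺; ⊤⁺; [_])
open import Relation.Nullary.Decidable using (map′; _×-dec_; _⊎-dec_; _→-dec_; ¬?)

------------------------------------------------------------------------
-- Ordered fields

-- Constructive: the order is not assumed decidable, so any construction
-- of the real numbers is an instance, and so is ℚ.
record OrderedField a ℓ₁ ℓ₂ : Set (lsuc (a ⊔ ℓ₁ ⊔ ℓ₂)) where
  infix 4 _<ᶠ_ _≤ᶠ_
  field
    heytingField : HeytingField a ℓ₁ ℓ₂

  open HeytingField heytingField public
    renaming (_+_ to _+ᶠ_; _*_ to _*ᶠ_; -_ to -ᶠ_; _-_ to _-ᶠ_)

  field
    _<ᶠ_                 : Rel Carrier ℓ₂
    isStrictPartialOrder : IsStrictPartialOrder _≈_ _<ᶠ_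
    #⇒<⊎>                : ∀ {x y} → x # y → x <ᶠ y ⊎ y <ᶠ x
    <⇒#                  : ∀ {x y} → x <ᶠ y → x # y
    +-monoˡ-<            : ∀ z {x y} → x <ᶠ y → x +ᶠ z <ᶠ y +ᶠ z
    *-positive           : ∀ {x y} → 0# <ᶠ x → 0# <ᶠ y → 0# <ᶠ x *ᶠ y

  commutativeRing : CommutativeRing a ℓ₁
  commutativeRing = HeytingCommutativeRing.commutativeRing heytingCommutativeRing

  open Exp (CommutativeRing.semiring commutativeRing) public
    using (_^_)

  _≤ᶠ_ : Rel Carrier ℓ₂
  x ≤ᶠ y = ¬ (y <ᶠ x)

  -- The library provides an inverse of x - 0#, which is x.
  inverse : ∀ {x} → 0# <ᶠ x → Carrier
  inverse 0<x = Σ.proj₁ (#⇒invertible (#-sym (<⇒# 0<x)))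

  ∑ ∏ : {A : Set} → List A → (A → Carrier) → Carrier
  ∑ xs f = L.foldr _+ᶠ_ 0# (L.map f xs)
  ∏ xs f = L.foldr _*ᶠ_ 1# (L.map f xs)

------------------------------------------------------------------------
-- Continuous-time Markov chains on a finite state space, given by the
-- list of states (each occurring once) and the transition rates.

module MarkovChain {a ℓ₁ ℓ₂} (F : OrderedField a ℓ₁ ℓ₂)
  {State : Set} (_≟ˢ_ : DecidableEquality State) (states : List State)
  (rate : State → State → OrderedField.Carrier F)
  where

  open OrderedField F

  -- A transition from a state to itself contributes to both terms and
  -- cancels, so such transitions have no effect.
  generator : State → State → Carrier
  generator σ τ with σ ≟ˢ τ
  ... | yes _ = rate σ τ -ᶠ ∑ states (rate σ)
  ... | no  _ = rate σ τ

  IsProbabilityMeasure : (State → Carrier) → Set (ℓ₁ ⊔ ℓ₂)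
  IsProbabilityMeasure π = (∀ σ → 0# ≤ᶠ π σ) × ∑ states π ≈ 1#

  -- πQ = 0, where Q is the generator.
  IsStationary : (State → Carrier) → Set ℓ₁
  IsStationary π = ∀ τ → ∑ states (λ σ → π σ *ᶠ generator σ τ) ≈ 0#

------------------------------------------------------------------------
-- Partitions and fillings

-- The half-open interval a, a + 1, …, b - 1.
interval : ℕ → ℕ → List ℕ
interval a b = applyUpTo (a +_) (b ∸ a)

record Partition : Set where
  field
    length     : ℕ
    parts      : Vec ℕ length
    positive   : ∀ i → 0 < V.lookup parts i
    decreasing : ∀ {i j} → i F.≤ j → V.lookup parts j ≤ V.lookup parts i

-- The alternatives a < b < c, b < c < a, c < a < b form one class under
-- cyclic rotation, so for b ≢ c exactly one of (a , b , c), (a , c , b)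
-- is in 𝒬.  Having c < b < a as the third alternative would destroy this
-- property and the stationarity of the measure below.
𝒬 : ℕ → ℕ → ℕ → Set
𝒬 a b c = (a < b × b < c) ⊎ (b < c × c < a) ⊎ (c < a × a < b) ⊎ (a ≡ b × a ≢ c)

𝒬? : ∀ a b c → Dec (𝒬 a b c)
𝒬? a b c = (a <? b ×-dec b <? c) ⊎-dec (b <? c ×-dec c <? a)
  ⊎-dec (c <? a ×-dec a <? b) ⊎-dec (a ≟ b ×-dec ¬? (a ≟ c))

-- Columns are indexed by Fin length (from 0), whereas rows and entries
-- are handled with their usual indices and values, starting from 1.
module Tableaux (Λ : Partition) (n : ℕ) .{{_ : NonZero n}} where

  open Partition Λ public

  Column : Set
  Column = Fin length

  height : Column → ℕ
  height = V.lookup parts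

  Cell : Set
  Cell = Σ Column (Fin ∘ height)

  col : Cell → Column
  col (c , _) = c

  row : Cell → ℕ
  row (_ , r) = suc (toℕ r)

  cells : List Cell
  cells = L.concatMap (λ c → L.map (c ,_) (allFin (height c))) (allFin length)

  -- Maps from cells to Fin n, stored as a table so that _≡_ is the
  -- pointwise equality; k : Fin n stands for the entry k + 1 of [n].
  Tab : Set
  Tab = All (Vec (Fin n)) parts

  infix 9 _!_
  _!_ : Tab → Cell → Fin n
  σ ! (c , r) = V.lookup (lookup⁺ σ c) r

  tabulate : (Cell → Fin n) → Tab
  tabulate f = lookup⁻ (λ c → V.tabulate (λ r → f (c , r)))

  infix 4 _≟ᵀ_
  _≟ᵀ_ : DecidableEquality Tab
  _≟ᵀ_ = go
    where
    go : ∀ {m} {hs : Vec ℕ m} → DecidableEquality (All (Vec (Fin n)) hs)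
    go []      []      = yes refl
    go (u ∷ σ) (v ∷ τ) = map′ (uncurry (cong₂ _∷_)) (λ { refl → refl , refl })
      (Vec-≡-dec Fₚ._≟_ u v ×-dec go σ τ)

  allTabs : List Tab
  allTabs = go parts
    where
    words : ∀ h → List (Vec (Fin n) h)
    words zero    = [] ∷ []
    words (suc h) = cartesianProductWith _∷_ (allFin n) (words h)

    go : ∀ {m} (hs : Vec ℕ m) → List (All (Vec (Fin n)) hs)
    go []       = [] ∷ []
    go (h ∷ hs) = cartesianProductWith _∷_ (words h) (go hs)

  -- The entry in row r of column c, a number in {1,…,n}, extended by 0
  -- above the column.  There is no row 0; its value is never used.
  entry : Tab → ℕ → Column → ℕ
  entry σ zero    c = 0
  entry σ (suc r) c with r <? height c
  ... | yes r<h = suc (toℕ (σ ! (c , fromℕ< r<h)))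
  ... | no  _   = 0

  value : Tab → Cell → ℕ
  value σ u = entry σ (row u) (col u)

  north : Tab → Cell → ℕ
  north σ u = entry σ (suc (row u)) (col u)

  -- ⊤⁺ is ∞.
  south : Tab → Cell → ℕ ⁺
  south σ (c , r) with toℕ r
  ... | zero  = ⊤⁺
  ... | suc k = [ entry σ (suc k) c ]

  ----------------------------------------------------------------------
  -- Statistics

  QuinvPair : Tab → Cell × Cell → Set
  QuinvPair σ (u , v) =
    row u ≡ row v × col u F.< col v × 𝒬 (north σ u) (value σ u) (value σ v)

  quinvPair? : ∀ σ p → Dec (QuinvPair σ p)
  quinvPair? σ (u , v) = row u ≟ row v ×-dec col u Fₚ.<? col v
    ×-dec 𝒬? (north σ u) (value σ u) (value σ v)

  quinv : Tab → ℕ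
  quinv σ = L.length (filter (quinvPair? σ) (cartesianProduct cells cells))

  InArm : Cell → Cell → Set
  InArm u y = (row y ≡ row u × col y F.< col u)
            ⊎ (suc (row y) ≡ row u × col u F.< col y)

  inArm? : ∀ u y → Dec (InArm u y)
  inArm? u y = (row y ≟ row u ×-dec col y Fₚ.<? col u)
    ⊎-dec (suc (row y) ≟ row u ×-dec col u Fₚ.<? col y)

  down : Tab → Cell → ℕ
  down σ u = L.length
    (filter (λ y → inArm? u y ×-dec (value σ y ≟ value σ u)) cells)

  -- The condition under which down, R and R′ are meaningful at u.
  Enabled : Tab → Cell → Set
  Enabled σ u = south σ u ≢ [ value σ u ]

  enabled? : ∀ σ u → Dec (Enabled σ u)
  enabled? σ u = ¬? (Maybe-≡-dec _≟_ (south σ u) [ value σ u ])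

  ----------------------------------------------------------------------
  -- The ringing path map

  -- σ(i+1,c) - σ(i,c) ≡ 1 (mod n)
  Successive : Tab → Column → ℕ → Set
  Successive σ c i = entry σ (suc i) c % n ≡ suc (entry σ i c) % n

  successive? : ∀ σ c i → Dec (Successive σ c i)
  successive? σ c i = entry σ (suc i) c % n ≟ suc (entry σ i c) % n

  -- The default value row u of max is itself an admissible h.
  ringTop : Tab → Cell → ℕ
  ringTop σ u = max (row u)
    (filter (λ h → ListAll.all? (successive? σ (col u)) (interval (row u) h))
            (interval (row u) (suc (height (col u)))))

  increment : Fin n → Fin n
  increment k = suc (toℕ k) mod n

  R : Tab → Cell → Tab
  R σ u = tabulate new
    where
    new : Cell → Fin n
    new v with col v Fₚ.≟ col u ×-dec row u ≤? row v ×-dec row v ≤? ringTop σ u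
    ... | yes _ = increment (σ ! v)
    ... | no  _ = σ ! v

  ----------------------------------------------------------------------
  -- The operators τ

  Balanced : Tab → Column → Column → ℕ → Set
  Balanced σ c c′ r = (A → B) × (B → A)
    where
    A = 𝒬 (entry σ r c)  (entry σ (pred r) c) (entry σ (pred r) c′)
    B = 𝒬 (entry σ r c′) (entry σ (pred r) c) (entry σ (pred r) c′)

  balanced? : ∀ σ c c′ r → Dec (Balanced σ c c′ r)
  balanced? σ c c′ r = (A? →-dec B?) ×-dec (B? →-dec A?)
    where
    A? = 𝒬? (entry σ r c)  (entry σ (pred r) c) (entry σ (pred r) c′)
    B? = 𝒬? (entry σ r c′) (entry σ (pred r) c) (entry σ (pred r) c′)

  rmax : Tab → Column → Column → ℕ
  rmax σ c c′ = max 1 (filter (balanced? σ c c′) (interval 2 (suc (height c))))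

  exchange : (c c′ : Column) → height c ≡ height c′ → ℕ → Cell → Cell
  exchange c c′ eq m (i , r) with m ≤? suc (toℕ r) | i Fₚ.≟ c | i Fₚ.≟ c′
  ... | yes _ | yes refl | _        = c′ , F.cast eq r
  ... | yes _ | no  _    | yes refl = c  , F.cast (sym eq) r
  ... | yes _ | no  _    | no  _    = i  , r
  ... | no  _ | _        | _        = i  , r

  swapColumns : Column → Column → Tab → Tab
  swapColumns c c′ σ with height c ≟ height c′
  ... | yes eq = tabulate (λ u → σ ! exchange c c′ eq (rmax σ c c′) u)
  ... | no  _  = σ

  -- Acts on columns j and j + 1, counted from 0; taken to be the identity
  -- when these do not both exist or have different heights.
  τ : ℕ → Tab → Tab
  τ j σ with suc j <? length
  ... | yes 1+j<ℓ = swapColumns (fromℕ< (<-trans (n<1+n j) 1+j<ℓ)) (fromℕ< 1+j<ℓ) σ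
  ... | no  _     = σ

  -- The operators are applied in the order of the list.
  applyτ : List ℕ → Tab → Tab
  applyτ js σ = L.foldl (λ ρ j → τ j ρ) σ js

  ----------------------------------------------------------------------
  -- The map R′

  block : Column → List ℕ
  block v = L.map toℕ (filter (λ j → height j ≟ height v) (allFin length))

  -- v ↦ 2s + k - v, where block v is s, …, s + k.
  reflect : Column → ℕ
  reflect v = min (toℕ v) (block v) + max (toℕ v) (block v) ∸ toℕ v

  R′ : Tab → Cell → Tab
  R′ ξ u with ¬? (entry ξ (ringTop ξ u) (col u) ≟ n) ⊎-dec ringTop ξ u <? height (col u)
  ... | yes _ = R ξ u
  ... | no  _ with <-cmp (toℕ (col u)) (reflect (col u))
  ...   | tri< _ _ _ = applyτ (interval (toℕ (col u)) (reflect (col u))) (R ξ u)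
  ...   | tri≈ _ _ _ = R ξ u
  ...   | tri> _ _ _ = applyτ (L.reverse (interval (reflect (col u)) (toℕ (col u)))) (R ξ u)

------------------------------------------------------------------------
-- The tableau Markov chain

module TableauChain {a ℓ₁ ℓ₂} (F : OrderedField a ℓ₁ ℓ₂)
  (Λ : Partition) (n : ℕ) .{{_ : NonZero n}}
  (x : Fin n → OrderedField.Carrier F)
  (x>0 : ∀ i → OrderedField._<ᶠ_ F (OrderedField.0# F) (x i))
  (t : OrderedField.Carrier F)
  where

  open OrderedField F
  open Tableaux Λ n public

  rate : Tab → Tab → Carrier
  rate σ τ′ = ∑ (filter (λ u → enabled? σ u ×-dec (R′ σ u ≟ᵀ τ′)) cells)
                (λ u → inverse (x>0 (σ ! u)) *ᶠ t ^ down σ u)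

  open MarkovChain F _≟ᵀ_ allTabs rate public

  wt : Tab → Carrier
  wt σ = t ^ quinv σ *ᶠ ∏ cells (λ u → x (σ ! u))

  totalWeight : Carrier
  totalWeight = ∑ allTabs wt

  normalisedWt : 0# <ᶠ totalWeight → Tab → Carrier
  normalisedWt Z>0 σ = wt σ *ᶠ inverse Z>0

{-# OPTIONS --safe #-}
module Submission where

-- With [𝒬 (x , a , c)] + [a < x] = [a < c] + [c < x], both the ringing path
-- map and the operators τ change quinv by telescoping sums. Write up(ρ , y)
-- for the analogue of down(ρ , y) that uses row r + 1 to the left of y and
-- row r to its right. If R′_u(σ) = ρ, let y be the cell of ρ in which the
-- rung path ends (moved along with it by the τ's). Then
--     wt(σ) x_{σ(u)}⁻¹ t^{down(σ , u)} = wt(ρ) x_{ρ(y)}⁻¹ t^{up(ρ , y)}.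
-- When a top entry n becomes 1, quinv is off by the difference between the
-- numbers of columns of the same height to the right and to the left; each
-- τ corrects this by one, whence the reflection of the block. For fixed ρ,
-- (σ , u) ↦ y is a bijection onto the cells y whose entry differs from the
-- one above, so the inflow into ρ is wt(ρ) Σ_y x_{ρ(y)}⁻¹ t^{up(ρ , y)}. That
-- this equals the outflow wt(ρ) Σ_u x_{ρ(u)}⁻¹ t^{down(ρ , u)} is again a
-- telescoping identity, row by row and for each value separately.

open import Defs
open import Data.Fin using (Fin)
open import Data.Nat using (ℕ; NonZero)
open import Data.Product using (Σ-syntax; _×_; _,_)

-- The chain is in general not reversible (a single cell with n = 3 turns in one direction only), so
-- inflow and outflow have to be compared as whole sums. The main obstacle is the value 0 read above
-- a column. The cyclic order behind `𝒬` is invariant under turning [n], but 0 fixes a starting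
-- point between n and 1. The defect `κ` survives only where a path ends at the top of its column
-- with an entry n, and only against columns of the same height. The balance for one value rests on
-- a coincidence: `down` of a cell in row r + 1 and `up` of the cell below it read the same two
-- half-rows. Let m be the number of cells of the given value in row r + 1 left of a moving column
-- and in row r from it on. This number changes by at most one per step, and 1 + t + ... + t^(m-1)
-- is a potential whose increments are the required powers of t. There is no subtraction in ℕ, and t
-- may be 0, so that powers of t cannot be cancelled. Hence differences appear as correction terms
-- added on both sides of an equation.

module Summation where
  open import Algebra.Bundles using (CommutativeMonoid)
  open import Data.Fin as F using (toℕ)
  import Data.Fin.Properties as Fₚ
  open import Data.List as L using (List; []; _∷_; _++_; allFin; filter; concatMap; cartesianProduct)
  open import Data.List.Properties using (map-tabulate; map-∘)
  open import Data.List.Membership.Propositional using (_∈_)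
  open import Data.List.Membership.Propositional.Properties
  open import Data.List.Membership.Propositional.Properties.WithK using (unique∧set⇒bag)
  open import Data.List.Relation.Binary.BagAndSetEquality using (∼bag⇒↭)
  open import Data.List.Relation.Binary.Permutation.Propositional
    using (_↭_) renaming (refl to ↭refl; prep to ↭prep; swap to ↭swap; trans to ↭trans)
  open import Data.List.Relation.Unary.All as ListAll using ([]; _∷_)
  open import Data.List.Relation.Unary.AllPairs using ([]; _∷_)
  open import Data.List.Relation.Unary.Any using (here; there)
  open import Data.List.Relation.Unary.Unique.Propositional using (Unique)
  open import Data.List.Relation.Unary.Unique.Propositional.Properties using (filter⁺; allFin⁺)
  open import Data.Nat using (zero; suc; _≤_; _<_; z≤n; s≤s)
  open import Data.Product using (proj₁; proj₂)
  open import Function using (_∘_; mk⇔; id)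
  open import Relation.Binary.Definitions using (DecidableEquality)
  open import Relation.Binary.PropositionalEquality as ≡ using (_≡_; _≢_)
  open import Relation.Nullary using (¬_; Dec; yes; no; contradiction)
  open import Relation.Nullary.Decidable using (does; ¬?)
  open import Relation.Unary using (Decidable)
  open import Data.Bool using (if_then_else_)

  -- Duplicate-free lists, and sums over a commutative monoid.

  unique⇒↭ : ∀ {A : Set} {xs ys : List A} → Unique xs → Unique ys →
    (∀ {z} → z ∈ xs → z ∈ ys) → (∀ {z} → z ∈ ys → z ∈ xs) → xs ↭ ys
  unique⇒↭ uxs uys to from = ∼bag⇒↭ (unique∧set⇒bag uxs uys (mk⇔ to from))

  map-unique : ∀ {A B : Set} {f : A → B} {xs : List A} →
    (∀ {x y} → x ∈ xs → y ∈ xs → f x ≡ f y → x ≡ y) → Unique xs → Unique (L.map f xs)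
  map-unique {xs = []} inj [] = []
  map-unique {f = f} {xs = x ∷ xs} inj (x∉ ∷ u) = go x∉ (λ y∈ → inj (here ≡.refl) (there y∈))
    ∷ map-unique (λ p q → inj (there p) (there q)) u
    where
    go : ∀ {ys} → ListAll.All (x ≢_) ys → (∀ {y} → y ∈ ys → f x ≡ f y → x ≡ y) →
      ListAll.All (f x ≢_) (L.map f ys)
    go []        inj′ = []
    go (x≢ ∷ ps) inj′ = (λ eq → x≢ (inj′ (here ≡.refl) eq)) ∷ go ps (inj′ ∘ there)

  others : ∀ {A : Set} → DecidableEquality A → A → List A → List A
  others _≟_ v = filter (λ x → ¬? (x ≟ v))

  remove-↭ : ∀ {A : Set} (_≟_ : DecidableEquality A) {v : A} {xs} → Unique xs → v ∈ xs →
    xs ↭ v ∷ others _≟_ v xs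
  remove-↭ _≟_ {v} {xs} uxs v∈ = unique⇒↭ uxs (fresh ∷ filter⁺ (λ x → ¬? (x ≟ v)) uxs) to from
    where
    fresh : ListAll.All (v ≢_) (others _≟_ v xs)
    fresh = ListAll.tabulate (λ x∈ eq → proj₂ (∈-filter⁻ (λ x → ¬? (x ≟ v)) {xs = xs} x∈) (≡.sym eq))
    to : ∀ {z} → z ∈ xs → z ∈ v ∷ others _≟_ v xs
    to {z} z∈ with z ≟ v
    ... | yes eq = here eq
    ... | no  ne = there (∈-filter⁺ (λ x → ¬? (x ≟ v)) z∈ ne)
    from : ∀ {z} → z ∈ v ∷ others _≟_ v xs → z ∈ xs
    from (here ≡.refl) = v∈
    from (there z∈)    = proj₁ (∈-filter⁻ (λ x → ¬? (x ≟ v)) z∈)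

  ∈-others⁻ : ∀ {A : Set} (_≟_ : DecidableEquality A) {v x : A} xs → x ∈ others _≟_ v xs → x ≢ v
  ∈-others⁻ _≟_ {v} xs x∈ = proj₂ (∈-filter⁻ (λ x → ¬? (x ≟ v)) {xs = xs} x∈)

  module Sums {c ℓ} (M : CommutativeMonoid c ℓ) where
    open CommutativeMonoid M
    open import Algebra.Properties.CommutativeSemigroup commutativeSemigroup using (interchange; x∙yz≈y∙xz)
    open import Relation.Binary.Reasoning.Setoid setoid

    sum : {A : Set} → List A → (A → Carrier) → Carrier
    sum xs f = L.foldr _∙_ ε (L.map f xs)

    infix 5 _when_
    _when_ : ∀ {p} {P : Set p} → Carrier → Dec P → Carrier
    x when d = if does d then x else ε

    when-yes : ∀ {p} {P : Set p} (d : Dec P) {x} → P → x when d ≡ x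
    when-yes (yes _) _ = ≡.refl
    when-yes (no ¬p) p = contradiction p ¬p

    when-no : ∀ {p} {P : Set p} (d : Dec P) {x} → ¬ P → x when d ≡ ε
    when-no (yes p) ¬p = contradiction p ¬p
    when-no (no _)  _  = ≡.refl

    when-cong : ∀ {p q} {P : Set p} {Q : Set q} (d : Dec P) (e : Dec Q) {x y} →
      (P → Q) → (Q → P) → (P → x ≈ y) → x when d ≈ y when e
    when-cong (yes p) (yes q) to from eq = eq p
    when-cong (yes p) (no ¬q) to from eq = contradiction (to p) ¬q
    when-cong (no ¬p) (yes q) to from eq = contradiction (from q) ¬p
    when-cong (no ¬p) (no ¬q) to from eq = refl

    module _ {A : Set} where

      sum-cong-∈ : ∀ (xs : List A) {f g : A → Carrier} → (∀ {x} → x ∈ xs → f x ≈ g x) → sum xs f ≈ sum xs g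
      sum-cong-∈ []       eq = refl
      sum-cong-∈ (x ∷ xs) eq = ∙-cong (eq (here ≡.refl)) (sum-cong-∈ xs (eq ∘ there))

      sum-cong : ∀ (xs : List A) {f g : A → Carrier} → (∀ x → f x ≈ g x) → sum xs f ≈ sum xs g
      sum-cong xs eq = sum-cong-∈ xs (λ {x} _ → eq x)

      sum-ε : ∀ (xs : List A) {f : A → Carrier} → (∀ {x} → x ∈ xs → f x ≈ ε) → sum xs f ≈ ε
      sum-ε []       eq = refl
      sum-ε (x ∷ xs) eq = trans (∙-cong (eq (here ≡.refl)) (sum-ε xs (eq ∘ there))) (identityˡ ε)

      sum-∙ : ∀ (xs : List A) (f g : A → Carrier) → sum xs (λ x → f x ∙ g x) ≈ sum xs f ∙ sum xs g
      sum-∙ []       f g = sym (identityˡ ε)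
      sum-∙ (x ∷ xs) f g = trans (∙-congˡ (sum-∙ xs f g)) (interchange (f x) (g x) _ _)

      sum-++ : ∀ (xs ys : List A) (f : A → Carrier) → sum (xs ++ ys) f ≈ sum xs f ∙ sum ys f
      sum-++ []       ys f = sym (identityˡ _)
      sum-++ (x ∷ xs) ys f = trans (∙-congˡ (sum-++ xs ys f)) (sym (assoc _ _ _))

      sum-↭ : ∀ {xs ys : List A} (f : A → Carrier) → xs ↭ ys → sum xs f ≈ sum ys f
      sum-↭ f ↭refl          = refl
      sum-↭ f (↭prep x p)    = ∙-congˡ (sum-↭ f p)
      sum-↭ f (↭swap x y p)  = trans (∙-congˡ (∙-congˡ (sum-↭ f p))) (x∙yz≈y∙xz _ _ _)
      sum-↭ f (↭trans p q)   = trans (sum-↭ f p) (sum-↭ f q)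

      sum-filter : ∀ {p} {P : A → Set p} (P? : Decidable P) (xs : List A) (f : A → Carrier) →
        sum (filter P? xs) f ≈ sum xs (λ x → f x when P? x)
      sum-filter P? []       f = refl
      sum-filter P? (x ∷ xs) f with P? x
      ... | yes _ = ∙-congˡ (sum-filter P? xs f)
      ... | no  _ = trans (sum-filter P? xs f) (sym (identityˡ _))

      sum-remove : ∀ (_≟_ : DecidableEquality A) {v : A} {xs} (f : A → Carrier) → Unique xs → v ∈ xs →
        sum xs f ≈ f v ∙ sum (others _≟_ v xs) f
      sum-remove _≟_ f uxs v∈ = sum-↭ f (remove-↭ _≟_ uxs v∈)

      sum-delta : ∀ (_≟_ : DecidableEquality A) {v : A} {xs} (f : A → Carrier) → Unique xs → v ∈ xs →
        (∀ x → x ≢ v → f x ≈ ε) → sum xs f ≈ f v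
      sum-delta _≟_ {v} {xs} f uxs v∈ f≈ε = begin
        sum xs f                       ≈⟨ sum-remove _≟_ f uxs v∈ ⟩
        f v ∙ sum (others _≟_ v xs) f  ≈⟨ ∙-congˡ (sum-ε (others _≟_ v xs) (f≈ε _ ∘ ∈-others⁻ _≟_ xs)) ⟩
        f v ∙ ε                        ≈⟨ identityʳ _ ⟩
        f v                            ∎

    sum-map : ∀ {A B : Set} (g : A → B) (xs : List A) (f : B → Carrier) → sum (L.map g xs) f ≡ sum xs (f ∘ g)
    sum-map g xs f = ≡.cong (L.foldr _∙_ ε) (≡.sym (map-∘ xs))

    sum-comm : ∀ {A B : Set} (xs : List A) (ys : List B) (f : A → B → Carrier) →
      sum xs (λ x → sum ys (f x)) ≈ sum ys (λ y → sum xs (λ x → f x y))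
    sum-comm []       ys f = sym (sum-ε ys (λ _ → refl))
    sum-comm (x ∷ xs) ys f = trans (∙-congˡ (sum-comm xs ys f)) (sym (sum-∙ ys (f x) _))

    sum-concatMap : ∀ {A B : Set} (g : A → List B) (xs : List A) (f : B → Carrier) →
      sum (concatMap g xs) f ≈ sum xs (λ x → sum (g x) f)
    sum-concatMap g []       f = refl
    sum-concatMap g (x ∷ xs) f = trans (sum-++ (g x) (concatMap g xs) f) (∙-congˡ (sum-concatMap g xs f))

    sum-cartesianProduct : ∀ {A B : Set} (xs : List A) (ys : List B) (f : A × B → Carrier) →
      sum (cartesianProduct xs ys) f ≈ sum xs (λ x → sum ys (λ y → f (x , y)))
    sum-cartesianProduct []       ys f = refl
    sum-cartesianProduct (x ∷ xs) ys f = trans (sum-++ (L.map (x ,_) ys) _ f)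
      (∙-cong (reflexive (sum-map (x ,_) ys f)) (sum-cartesianProduct xs ys f))

    sum-allFin : ∀ m (f : Fin (suc m) → Carrier) → sum (allFin (suc m)) f ≡ f F.zero ∙ sum (allFin m) (f ∘ F.suc)
    sum-allFin m f = ≡.cong (λ fs → f F.zero ∙ L.foldr _∙_ ε fs)
      (≡.trans (map-tabulate F.suc f) (≡.sym (map-tabulate id (f ∘ F.suc))))

    sumFin : ℕ → (ℕ → Carrier) → Carrier
    sumFin m f = sum (allFin m) (f ∘ toℕ)

    -- Without inverses a difference cannot be written, so the potential `φ` stands on both sides.
    -- The monoid is general because the same argument serves `quinv` in ℕ, monomials under
    -- multiplication and the geometric sums of `Balance` under addition.
    telescope : ∀ m (f g : Fin m → Carrier) (φ : ℕ → Carrier) → (∀ i → f i ∙ φ (toℕ i) ≈ g i ∙ φ (suc (toℕ i))) →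
      sum (allFin m) f ∙ φ 0 ≈ sum (allFin m) g ∙ φ m
    telescope zero    f g φ step = refl
    telescope (suc m) f g φ step = begin
      sum (allFin (suc m)) f ∙ φ 0                     ≡⟨ ≡.cong (_∙ φ 0) (sum-allFin m f) ⟩
      (f F.zero ∙ sum (allFin m) (f ∘ F.suc)) ∙ φ 0    ≈⟨ xy∙z≈xz∙y _ _ _ ⟩
      (f F.zero ∙ φ 0) ∙ sum (allFin m) (f ∘ F.suc)    ≈⟨ ∙-congʳ (step F.zero) ⟩
      (g F.zero ∙ φ 1) ∙ sum (allFin m) (f ∘ F.suc)    ≈⟨ xy∙z≈x∙zy _ _ _ ⟩
      g F.zero ∙ (sum (allFin m) (f ∘ F.suc) ∙ φ 1)    ≈⟨ ∙-congˡ (telescope m (f ∘ F.suc) (g ∘ F.suc) (φ ∘ suc) (step ∘ F.suc)) ⟩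
      g F.zero ∙ (sum (allFin m) (g ∘ F.suc) ∙ φ (suc m))  ≈⟨ assoc _ _ _ ⟨
      (g F.zero ∙ sum (allFin m) (g ∘ F.suc)) ∙ φ (suc m)  ≡⟨ ≡.cong (_∙ φ (suc m)) (sum-allFin m g) ⟨
      sum (allFin (suc m)) g ∙ φ (suc m)               ∎
      where open import Algebra.Properties.CommutativeSemigroup commutativeSemigroup using (xy∙z≈xz∙y; xy∙z≈x∙zy)

    telescopeFin : ∀ m (f g φ : ℕ → Carrier) → (∀ {i} → i < m → f i ∙ φ i ≈ g i ∙ φ (suc i)) →
      sumFin m f ∙ φ 0 ≈ sumFin m g ∙ φ m
    telescopeFin m f g φ step = telescope m (f ∘ toℕ) (g ∘ toℕ) φ (λ i → step (Fₚ.toℕ<n i))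

    sumFin-extend : ∀ {m k} {f : ℕ → Carrier} → m ≤ k → (∀ {i} → m ≤ i → f i ≈ ε) → sumFin m f ≈ sumFin k f
    sumFin-extend {k = k} z≤n f≈ε = sym (sum-ε (allFin k) (λ _ → f≈ε z≤n))
    sumFin-extend {suc m} {suc k} {f} (s≤s m≤k) f≈ε = trans (reflexive (sum-allFin m (f ∘ toℕ)))
      (trans (∙-congˡ (sumFin-extend {f = f ∘ suc} m≤k (f≈ε ∘ s≤s))) (sym (reflexive (sum-allFin k (f ∘ toℕ)))))

    sumFin-cong : ∀ m {f g : ℕ → Carrier} → (∀ i → i < m → f i ≈ g i) → sumFin m f ≈ sumFin m g
    sumFin-cong m eq = sum-cong (allFin m) (λ i → eq (toℕ i) (Fₚ.toℕ<n i))

    sumFin-∙ : ∀ m (f g : ℕ → Carrier) → sumFin m (λ i → f i ∙ g i) ≈ sumFin m f ∙ sumFin m g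
    sumFin-∙ m f g = sum-∙ (allFin m) (f ∘ toℕ) (g ∘ toℕ)

    module _ {ℓ : ℕ} where

      -- `δ` and `δ′` encode the difference of the two sums, which comes from `p` and `q` alone.
      sum-two : ∀ {p q : Fin ℓ} → p ≢ q → ∀ (f g : Fin ℓ → Carrier) {δ δ′} →
        (∀ {c} → c ≢ p → c ≢ q → f c ≈ g c) →
        f p ∙ f q ∙ δ ≈ g p ∙ g q ∙ δ′ → sum (allFin ℓ) f ∙ δ ≈ sum (allFin ℓ) g ∙ δ′
      sum-two {p} {q} p≢q f g {δ} {δ′} off on = begin
        sum (allFin ℓ) f ∙ δ       ≈⟨ split f δ ⟩
        f p ∙ f q ∙ δ ∙ sum rr f   ≈⟨ ∙-cong on same ⟩
        g p ∙ g q ∙ δ′ ∙ sum rr g  ≈⟨ split g δ′ ⟨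
        sum (allFin ℓ) g ∙ δ′      ∎
        where
        open import Algebra.Properties.CommutativeSemigroup commutativeSemigroup using (xy∙z≈xz∙y)
        withoutP rr : List (Fin ℓ)
        withoutP = others Fₚ._≟_ p (allFin ℓ)
        rr = others Fₚ._≟_ q withoutP
        split : ∀ h ε′ → sum (allFin ℓ) h ∙ ε′ ≈ h p ∙ h q ∙ ε′ ∙ sum rr h
        split h ε′ = begin
          sum (allFin ℓ) h ∙ ε′           ≈⟨ ∙-congʳ (sum-remove Fₚ._≟_ h (allFin⁺ ℓ) (∈-allFin p)) ⟩
          h p ∙ sum withoutP h ∙ ε′       ≈⟨ ∙-congʳ (∙-congˡ (sum-remove Fₚ._≟_ h (filter⁺ _ (allFin⁺ ℓ)) (∈-filter⁺ (λ x → ¬? (x Fₚ.≟ p)) (∈-allFin q) (p≢q ∘ ≡.sym)))) ⟩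
          h p ∙ (h q ∙ sum rr h) ∙ ε′     ≈⟨ ∙-congʳ (assoc _ _ _) ⟨
          h p ∙ h q ∙ sum rr h ∙ ε′       ≈⟨ xy∙z≈xz∙y _ _ _ ⟩
          h p ∙ h q ∙ ε′ ∙ sum rr h       ∎
        same : sum rr f ≈ sum rr g
        same = sum-cong-∈ rr (λ c∈ → off
          (∈-others⁻ Fₚ._≟_ (allFin ℓ) (proj₁ (∈-filter⁻ (λ x → ¬? (x Fₚ.≟ q)) {xs = withoutP} c∈)))
          (∈-others⁻ Fₚ._≟_ withoutP c∈))

      sum-one : ∀ {p : Fin ℓ} (f g : Fin ℓ → Carrier) {δ δ′} → (∀ {c} → c ≢ p → f c ≈ g c) →
        f p ∙ δ ≈ g p ∙ δ′ → sum (allFin ℓ) f ∙ δ ≈ sum (allFin ℓ) g ∙ δ′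
      sum-one {p} f g {δ} {δ′} off on = begin
        sum (allFin ℓ) f ∙ δ      ≈⟨ split f δ ⟩
        f p ∙ δ ∙ sum rr f        ≈⟨ ∙-cong on (sum-cong-∈ rr (λ c∈ → off (∈-others⁻ Fₚ._≟_ (allFin ℓ) c∈))) ⟩
        g p ∙ δ′ ∙ sum rr g       ≈⟨ split g δ′ ⟨
        sum (allFin ℓ) g ∙ δ′     ∎
        where
        open import Algebra.Properties.CommutativeSemigroup commutativeSemigroup using (xy∙z≈xz∙y)
        rr : List (Fin ℓ)
        rr = others Fₚ._≟_ p (allFin ℓ)
        split : ∀ h ε′ → sum (allFin ℓ) h ∙ ε′ ≈ h p ∙ ε′ ∙ sum rr h
        split h ε′ = trans (∙-congʳ (sum-remove Fₚ._≟_ h (allFin⁺ ℓ) (∈-allFin p))) (xy∙z≈xz∙y _ _ _)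

module Combinatorics where
  open Summation
  open import Data.Fin as F using (toℕ; fromℕ<)
  import Data.Fin.Properties as Fₚ
  open import Data.List as L
    using (List; []; _∷_; allFin; filter; cartesianProduct; applyUpTo; cartesianProductWith)
  open import Data.List.Membership.Propositional using (_∈_; lose)
  open import Data.List.Membership.Propositional.Properties
  open import Data.List.Relation.Unary.Unique.Propositional using (Unique)
  open import Data.List.Relation.Unary.Unique.Propositional.Properties
    using (allFin⁺; concat⁺; cartesianProductWith⁺)
  open import Data.Nat
    using (zero; suc; _+_; _≤_; _<_; _≟_; _<?_; _≤?_; s≤s; z≤n; pred; _⊔_; _∸_; _%_; _⊓_)
  open import Data.Nat.Properties
  open import Data.Nat.Tactic.RingSolver using (solve-∀)
  open import Data.Product using (∃; proj₁; proj₂; ∃₂)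
  open import Data.Sum using (_⊎_; inj₁; inj₂)
  open import Function using (_∘_; id)
  open import Relation.Binary.Definitions using (tri<; tri≈; tri>)
  open import Relation.Binary.PropositionalEquality
  open import Relation.Nullary using (¬_; Dec; yes; no; contradiction)
  open import Relation.Nullary.Decidable using (¬?; _×-dec_; _⊎-dec_)
  open import Algebra.Bundles using (CommutativeMonoid; CommutativeRing)
  open import Data.List.Extrema.Nat using (max; min; xs≤max; ⊥≤max; argmax-sel; argmin-sel; min≤xs)
  import Data.List.Relation.Unary.All as ListAll
  open import Data.Nat.DivMod using (m<n⇒m%n≡m; n%n≡0; m%n<n; [m+n]%n≡m%n; %-congˡ)
  open import Data.Vec as V using (Vec; []; _∷_)
  open import Data.Vec.Properties using (lookup∘tabulate; tabulate∘lookup; tabulate-cong)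
  open import Data.Vec.Relation.Unary.All using (All; []; _∷_)
  open import Data.Vec.Relation.Unary.All.Properties using (lookup⁺; lookup⁻)
  open import Relation.Nullary.Construct.Add.Supremum using ([_])
  open import Relation.Unary using (Decidable)
  open import Data.Maybe.Properties using (just-injective)
  open import Data.List.Properties using (foldl-++; unfold-reverse; reverse-involutive)
  import Algebra.Properties.Semiring.Exp as Exp
  open import Data.List.Relation.Binary.Disjoint.Propositional using (Disjoint)
  import Data.List.Relation.Unary.All.Properties as ListAllₚ
  import Data.List.Relation.Unary.AllPairs as AllPairs
  import Data.List.Relation.Unary.AllPairs.Properties as AllPairsₚ
  open import Data.List.Relation.Unary.Any using (here)

  module ℕΣ = Sums +-0-commutativeMonoid
  open ℕΣ

  -- Indicators in ℕ, and double sums over pairs of columns.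

  ⟦_⟧ : ∀ {p} {P : Set p} → Dec P → ℕ
  ⟦ d ⟧ = 1 when d

  ⟦⟧-yes : ∀ {p} {P : Set p} (d : Dec P) → P → ⟦ d ⟧ ≡ 1
  ⟦⟧-yes d = when-yes d

  ⟦⟧-no : ∀ {p} {P : Set p} (d : Dec P) → ¬ P → ⟦ d ⟧ ≡ 0
  ⟦⟧-no d = when-no d

  ⟦⟧-cong : ∀ {p q} {P : Set p} {Q : Set q} (d : Dec P) (e : Dec Q) → (P → Q) → (Q → P) → ⟦ d ⟧ ≡ ⟦ e ⟧
  ⟦⟧-cong d e to from = when-cong d e to from (λ _ → refl)

  -- Linear arithmetic: the second hypothesis is a semiring identity.
  linear : ∀ {L R A B} → A ≡ B → L + B ≡ R + A → L ≡ R
  linear {L} {R} {A} refl eq = +-cancelʳ-≡ A L R eq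

  module _ {ℓ : ℕ} where

    Σᶜ : (Fin ℓ → ℕ) → ℕ
    Σᶜ = sum (allFin ℓ)

    module _ (v : Fin ℓ) where

      remaining : List (Fin ℓ)
      remaining = others Fₚ._≟_ v (allFin ℓ)

      Σ-remove : ∀ f → Σᶜ f ≡ f v + sum remaining f
      Σ-remove f = sum-remove Fₚ._≟_ f (allFin⁺ ℓ) (∈-allFin v)

      sum-remaining-cong : ∀ {f g : Fin ℓ → ℕ} → (∀ {c} → c ≢ v → f c ≡ g c) → sum remaining f ≡ sum remaining g
      sum-remaining-cong eq = sum-cong-∈ remaining (λ c∈ → eq (∈-others⁻ Fₚ._≟_ (allFin ℓ) c∈))

      -- A change of column `v` touches only row `v` and column `v` of the double sum. `G c v` and
      -- `G v c` are compared together since for `columnPair` at most one of them is nonzero,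
      -- depending on the side of `v` on which `c` lies.
      sum-cross : ∀ (G G′ : Fin ℓ → Fin ℓ → ℕ) (α β : Fin ℓ → ℕ) →
        (∀ {c c′} → c ≢ v → c′ ≢ v → G c c′ ≡ G′ c c′) →
        (∀ {c} → c ≢ v → G c v + G v c + α c ≡ G′ c v + G′ v c + β c) →
        G v v + α v ≡ G′ v v + β v →
        Σᶜ (λ c → Σᶜ (G c)) + Σᶜ α ≡ Σᶜ (λ c → Σᶜ (G′ c)) + Σᶜ β
      sum-cross G G′ α β off cross diag = begin
        Σᶜ (λ c → Σᶜ (G c)) + Σᶜ α
          ≡⟨ expand G α ⟩
        (G v v + α v) + (sum remaining (λ c → G c v + G v c + α c) + sum remaining (λ c → sum remaining (G c)))
          ≡⟨ cong₂ _+_ diag (cong₂ _+_ (sum-remaining-cong cross) (sum-remaining-cong (λ c≢ → sum-remaining-cong (off c≢)))) ⟩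
        (G′ v v + β v) + (sum remaining (λ c → G′ c v + G′ v c + β c) + sum remaining (λ c → sum remaining (G′ c)))
          ≡⟨ expand G′ β ⟨
        Σᶜ (λ c → Σᶜ (G′ c)) + Σᶜ β ∎
        where
        open ≡-Reasoning
        regroup : ∀ a b c d e f → (a + b + (c + d)) + (e + f) ≡ (a + e) + (c + b + f + d)
        regroup = solve-∀
        expand : ∀ (H : Fin ℓ → Fin ℓ → ℕ) γ → Σᶜ (λ c → Σᶜ (H c)) + Σᶜ γ
          ≡ (H v v + γ v) + (sum remaining (λ c → H c v + H v c + γ c) + sum remaining (λ c → sum remaining (H c)))
        expand H γ = begin
          Σᶜ (λ c → Σᶜ (H c)) + Σᶜ γ
            ≡⟨ cong₂ _+_ (trans (Σ-remove _) (cong₂ _+_ (Σ-remove (H v))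
                 (trans (sum-cong remaining (λ c → Σ-remove (H c))) (sum-∙ remaining _ _)))) (Σ-remove γ) ⟩
          (H v v + sum remaining (H v)) + (sum remaining (λ c → H c v) + sum remaining (λ c → sum remaining (H c))) + (γ v + sum remaining γ)
            ≡⟨ regroup (H v v) (sum remaining (H v)) (sum remaining (λ c → H c v)) (sum remaining (λ c → sum remaining (H c))) (γ v) (sum remaining γ) ⟩
          (H v v + γ v) + (sum remaining (λ c → H c v) + sum remaining (H v) + sum remaining γ + sum remaining (λ c → sum remaining (H c)))
            ≡⟨ cong (λ s → (H v v + γ v) + (s + sum remaining (λ c → sum remaining (H c))))
                 (trans (cong (_+ sum remaining γ) (sym (sum-∙ remaining _ _))) (sym (sum-∙ remaining _ _))) ⟩
          (H v v + γ v) + (sum remaining (λ c → H c v + H v c + γ c) + sum remaining (λ c → sum remaining (H c))) ∎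

    module _ {p q : Fin ℓ} (p≢q : p ≢ q) where

      -- When two columns exchange entries, a third one sees only the sum of its terms with `p` and
      -- `q`. The net change is confined to the four terms between `p` and `q`, and it is measured
      -- by `δ` and `δ′`.
      sum-two-cross : ∀ (G G′ : Fin ℓ → Fin ℓ → ℕ) {δ δ′} →
        (∀ {c c′} → c ≢ p → c ≢ q → c′ ≢ p → c′ ≢ q → G c c′ ≡ G′ c c′) →
        (∀ {c} → c ≢ p → c ≢ q → G c p + G c q ≡ G′ c p + G′ c q) →
        (∀ {c} → c ≢ p → c ≢ q → G p c + G q c ≡ G′ p c + G′ q c) →
        (G p p + G q p) + (G p q + G q q) + δ ≡ (G′ p p + G′ q p) + (G′ p q + G′ q q) + δ′ →
        Σᶜ (λ c → Σᶜ (G c)) + δ ≡ Σᶜ (λ c → Σᶜ (G′ c)) + δ′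
      sum-two-cross G G′ {δ} {δ′} off col row on = sum-two p≢q (λ c → Σᶜ (G c)) (λ c → Σᶜ (G′ c))
        (λ c≢p c≢q → +-cancelʳ-≡ 0 _ _ (sum-two p≢q (G _) (G′ _) (off c≢p c≢q) (cong (_+ 0) (col c≢p c≢q))))
        (begin
          Σᶜ (G p) + Σᶜ (G q) + δ            ≡⟨ cong (_+ δ) (sum-∙ (allFin ℓ) (G p) (G q)) ⟨
          Σᶜ (λ c → G p c + G q c) + δ       ≡⟨ sum-two p≢q _ _ row on ⟩
          Σᶜ (λ c → G′ p c + G′ q c) + δ′    ≡⟨ cong (_+ δ′) (sum-∙ (allFin ℓ) (G′ p) (G′ q)) ⟩
          Σᶜ (G′ p) + Σᶜ (G′ q) + δ′         ∎)
        where open ≡-Reasoning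

  -- The indicator of `𝒬` as a cyclic order.

  opaque
    -- Sealed, so that `𝒬?` is never unfolded in the arithmetic and unification can read off the
    -- arguments of `q`; `q-def` is the way in.
    q : ℕ → ℕ → ℕ → ℕ
    q x a c = ⟦ 𝒬? x a c ⟧

    q-def : ∀ x a c → q x a c ≡ ⟦ 𝒬? x a c ⟧
    q-def x a c = refl

  q-cong : ∀ {x x′ y y′ z z′} → x ≡ x′ → y ≡ y′ → z ≡ z′ → q x y z ≡ q x′ y′ z′
  q-cong refl refl refl = refl

  -- 𝒬 (x , a , c) says that a precedes c strictly in the cyclic order read
  -- from x on; this makes its indicator a coboundary.
  q-coboundary : ∀ x a c → q x a c + ⟦ a <? x ⟧ ≡ ⟦ a <? c ⟧ + ⟦ c <? x ⟧
  q-coboundary x a c = go (a <? x) (c <? x)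
    where
    open ≡-Reasoning
    direct : (¬ (a < x) → ¬ (c < x)) → (a < x → c < x) → q x a c ≡ ⟦ a <? c ⟧
    direct f g = trans (q-def x a c) (⟦⟧-cong (𝒬? x a c) (a <? c) to from)
      where
      to : 𝒬 x a c → a < c
      to (inj₁ (x<a , a<c)) = a<c
      to (inj₂ (inj₁ (a<c , c<x))) = a<c
      to (inj₂ (inj₂ (inj₁ (c<x , x<a)))) = contradiction c<x (f (<-asym x<a))
      to (inj₂ (inj₂ (inj₂ (refl , x≢c)))) = ≤∧≢⇒< (≮⇒≥ (f (n≮n x))) x≢c
      from : a < c → 𝒬 x a c
      from a<c with <-cmp x a
      ... | tri< x<a _ _ = inj₁ (x<a , a<c)
      ... | tri≈ _ refl _ = inj₂ (inj₂ (inj₂ (refl , <⇒≢ a<c)))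
      ... | tri> _ _ a<x = inj₂ (inj₁ (a<c , g a<x))
    go : (d : Dec (a < x)) (e : Dec (c < x)) → q x a c + ⟦ d ⟧ ≡ ⟦ a <? c ⟧ + ⟦ e ⟧
    go (yes a<x) (yes c<x) = cong (_+ 1) (direct (λ p → contradiction a<x p) (λ _ → c<x))
    go (no a≮x)  (no c≮x)  = cong (_+ 0) (direct (λ _ → c≮x) (λ p → contradiction p a≮x))
    go (no a≮x)  (yes c<x) = begin
      q x a c + 0        ≡⟨ cong (_+ 0) (trans (q-def x a c) (⟦⟧-yes (𝒬? x a c) holds)) ⟩
      1                  ≡⟨ cong (_+ 1) (⟦⟧-no (a <? c) (λ a<c → a≮x (<-trans a<c c<x))) ⟨
      ⟦ a <? c ⟧ + 1     ∎
      where
      holds : 𝒬 x a c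
      holds with x ≟ a
      ... | yes x≡a = inj₂ (inj₂ (inj₂ (x≡a , ≢-sym (<⇒≢ c<x))))
      ... | no  x≢a = inj₂ (inj₂ (inj₁ (c<x , ≤∧≢⇒< (≮⇒≥ a≮x) x≢a)))
    go (yes a<x) (no c≮x)  = begin
      q x a c + 1        ≡⟨ cong (_+ 1) (trans (q-def x a c) (⟦⟧-no (𝒬? x a c) fails)) ⟩
      1                  ≡⟨ cong (_+ 0) (⟦⟧-yes (a <? c) (<-≤-trans a<x (≮⇒≥ c≮x))) ⟨
      ⟦ a <? c ⟧ + 0     ∎
      where
      fails : ¬ 𝒬 x a c
      fails (inj₁ (x<a , _)) = <-asym x<a a<x
      fails (inj₂ (inj₁ (_ , c<x))) = c≮x c<x
      fails (inj₂ (inj₂ (inj₁ (c<x , _)))) = c≮x c<x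
      fails (inj₂ (inj₂ (inj₂ (refl , _)))) = n≮n x a<x

  <-trichotomy : ∀ a c → ⟦ a <? c ⟧ + ⟦ c <? a ⟧ + ⟦ c ≟ a ⟧ ≡ 1
  <-trichotomy a c with <-cmp a c
  ... | tri< a<c a≢c c≮a = cong₂ _+_ (cong₂ _+_ (⟦⟧-yes (a <? c) a<c) (⟦⟧-no (c <? a) c≮a)) (⟦⟧-no (c ≟ a) (a≢c ∘ sym))
  ... | tri≈ a≮c a≡c c≮a = cong₂ _+_ (cong₂ _+_ (⟦⟧-no (a <? c) a≮c) (⟦⟧-no (c <? a) c≮a)) (⟦⟧-yes (c ≟ a) (sym a≡c))
  ... | tri> a≮c a≢c c<a = cong₂ _+_ (cong₂ _+_ (⟦⟧-no (a <? c) a≮c) (⟦⟧-yes (c <? a) c<a)) (⟦⟧-no (c ≟ a) (a≢c ∘ sym))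

  -- In the sum of the two coboundary identities all comparisons with `x` cancel, and trichotomy for
  -- `a` and `c` remains.
  q-antisym : ∀ x {a c} → a ≢ c → q x a c + q x c a ≡ 1
  q-antisym x {a} {c} a≢c = linear
    (cong₂ _+_ (cong₂ _+_ (q-coboundary x a c) (q-coboundary x c a)) a<c∨c<a)
    (regroup (q x a c) (q x c a) ⟦ a <? c ⟧ ⟦ c <? x ⟧ ⟦ c <? a ⟧ ⟦ a <? x ⟧)
    where
    a<c∨c<a : ⟦ a <? c ⟧ + ⟦ c <? a ⟧ ≡ 1
    a<c∨c<a = trans (sym (+-identityʳ _))
      (trans (cong (⟦ a <? c ⟧ + ⟦ c <? a ⟧ +_) (sym (⟦⟧-no (c ≟ a) (a≢c ∘ sym)))) (<-trichotomy a c))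
    regroup : ∀ a b c d e f → a + b + (c + d + (e + f) + 1) ≡ 1 + (a + f + (b + d) + (c + e))
    regroup = solve-∀

  q-refl : ∀ x a → q x a a ≡ 0
  q-refl x a = linear (q-coboundary x a a)
    (trans (cong (λ e → q x a a + (e + ⟦ a <? x ⟧)) (⟦⟧-no (a <? a) (n≮n a))) refl)

  -- Nothing is smaller than 0, so both comparisons with the starting point vanish and the cyclic
  -- order becomes the usual one. This is the form of `𝒬` in the top row of a column.
  q-zero : ∀ a c → q 0 a c ≡ ⟦ a <? c ⟧
  q-zero a c = +-cancelʳ-≡ 0 _ _ (begin
    q 0 a c + 0              ≡⟨ cong (q 0 a c +_) (⟦⟧-no (a <? 0) n≮0) ⟨
    q 0 a c + ⟦ a <? 0 ⟧     ≡⟨ q-coboundary 0 a c ⟩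
    ⟦ a <? c ⟧ + ⟦ c <? 0 ⟧  ≡⟨ cong (⟦ a <? c ⟧ +_) (⟦⟧-no (c <? 0) n≮0) ⟩
    ⟦ a <? c ⟧ + 0           ∎)
    where open ≡-Reasoning

  -- Turning one entry by the cyclic successor on [n].

  module Next (n : ℕ) where

    nxt : ℕ → ℕ
    nxt a with a ≟ n
    ... | yes _ = 1
    ... | no  _ = suc a

    wrap : ℕ → ℕ
    wrap a = ⟦ a ≟ n ⟧

    nxt-n : nxt n ≡ 1
    nxt-n with n ≟ n
    ... | yes _  = refl
    ... | no n≢n = contradiction refl n≢n

    nxt-suc : ∀ {a} → a ≢ n → nxt a ≡ suc a
    nxt-suc {a} a≢n with a ≟ n
    ... | yes a≡n = contradiction a≡n a≢n
    ... | no  _   = refl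

    1≤nxt : ∀ a → 1 ≤ nxt a
    1≤nxt a with a ≟ n
    ... | yes _ = s≤s z≤n
    ... | no  _ = s≤s z≤n

    nxt≤n : ∀ {a} → 1 ≤ a → a ≤ n → nxt a ≤ n
    nxt≤n {a} 1≤a a≤n with a ≟ n
    ... | yes refl = 1≤a
    ... | no  a≢n  = ≤∧≢⇒< a≤n a≢n

    nxt-injective : ∀ {a b} → 1 ≤ a → 1 ≤ b → nxt a ≡ nxt b → a ≡ b
    nxt-injective {a} {b} 1≤a 1≤b eq with a ≟ n | b ≟ n
    ... | yes refl | yes refl = refl
    ... | no  _    | no  _    = suc-injective eq
    ... | yes _    | no  _    = contradiction (suc-injective eq) (<⇒≢ 1≤b)
    ... | no  _    | yes _    = contradiction (sym (suc-injective eq)) (<⇒≢ 1≤a)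

    -- Both sides are the indicator of `nxt a ≤ c`. This means `a < c` unless `a` is n; then it
    -- holds for every entry `c`.
    nxt-< : ∀ {a c} → 1 ≤ c → c ≤ n → ⟦ nxt a <? c ⟧ + ⟦ c ≟ nxt a ⟧ ≡ ⟦ a <? c ⟧ + wrap a
    nxt-< {a} {c} 1≤c c≤n with a ≟ n
    ... | yes refl = trans lhs (sym (cong₂ _+_ (⟦⟧-no (a <? c) (≤⇒≯ c≤n)) (⟦⟧-yes (n ≟ n) refl)))
      where
      lhs : ⟦ 1 <? c ⟧ + ⟦ c ≟ 1 ⟧ ≡ 1
      lhs with m≤n⇒m<n∨m≡n 1≤c
      ... | inj₁ 1<c  = cong₂ _+_ (⟦⟧-yes (1 <? c) 1<c) (⟦⟧-no (c ≟ 1) (≢-sym (<⇒≢ 1<c)))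
      ... | inj₂ refl = refl
    ... | no a≢n rewrite ⟦⟧-no (a ≟ n) a≢n with <-cmp (suc a) c
    ...   | tri< lt ne _ = cong₂ _+_ (trans (⟦⟧-yes (suc a <? c) lt) (sym (⟦⟧-yes (a <? c) (<⇒≤ lt)))) (⟦⟧-no (c ≟ suc a) (ne ∘ sym))
    ...   | tri≈ _ refl _ = trans (cong₂ _+_ (⟦⟧-no (suc a <? suc a) (n≮n _)) (⟦⟧-yes (suc a ≟ suc a) refl)) (cong (_+ 0) (sym (⟦⟧-yes (a <? suc a) ≤-refl)))
    ...   | tri> nl ne gt = cong₂ _+_ (trans (⟦⟧-no (suc a <? c) nl) (sym (⟦⟧-no (a <? c) (≤⇒≯ (≤-pred gt))))) (⟦⟧-no (c ≟ suc a) (ne ∘ sym))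

    -- Both sides are the indicator of `c ≤ a`. If `a` is n, this holds for every entry `c`, and the
    -- left side is `wrap a` alone.
    <-nxt : ∀ {a c} → 1 ≤ c → c ≤ n → ⟦ c <? nxt a ⟧ + wrap a ≡ ⟦ c <? a ⟧ + ⟦ c ≟ a ⟧
    <-nxt {a} {c} 1≤c c≤n with a ≟ n
    ... | yes refl = trans (cong₂ _+_ (⟦⟧-no (c <? 1) (≤⇒≯ 1≤c)) (⟦⟧-yes (n ≟ n) refl)) rhs
      where
      rhs : 1 ≡ ⟦ c <? n ⟧ + ⟦ c ≟ n ⟧
      rhs with m≤n⇒m<n∨m≡n c≤n
      ... | inj₁ c<n  = sym (cong₂ _+_ (⟦⟧-yes (c <? n) c<n) (⟦⟧-no (c ≟ n) (<⇒≢ c<n)))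
      ... | inj₂ refl = sym (cong₂ _+_ (⟦⟧-no (n <? n) (n≮n n)) (⟦⟧-yes (n ≟ n) refl))
    ... | no a≢n rewrite ⟦⟧-no (a ≟ n) a≢n with <-cmp c a
    ...   | tri< lt ne _ = cong₂ _+_ (trans (⟦⟧-yes (c <? suc a) (<⇒≤ (s≤s lt))) (sym (⟦⟧-yes (c <? a) lt))) (sym (⟦⟧-no (c ≟ a) ne))
    ...   | tri≈ _ refl _ = trans (cong (_+ 0) (⟦⟧-yes (c <? suc c) ≤-refl)) (sym (cong₂ _+_ (⟦⟧-no (c <? c) (n≮n c)) (⟦⟧-yes (c ≟ c) refl)))
    ...   | tri> nl ne gt = cong₂ _+_ (trans (⟦⟧-no (c <? suc a) (≤⇒≯ gt)) (sym (⟦⟧-no (c <? a) nl))) (sym (⟦⟧-no (c ≟ a) ne))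

    -- The value x = 0 (read above the top of a column) is the only one at
    -- which 𝒬 fails to be invariant under cyclic shifts of [n].
    κ : ℕ → ℕ → ℕ
    κ zero    a = wrap a
    κ (suc _) a = 0

    κ-positive : ∀ {x a} → 1 ≤ x → κ x a ≡ 0
    κ-positive (s≤s _) = refl

    -- In the cyclic order read from `x`, the last argument comes to lie behind `b` when it leaves
    -- `b`, and drops back to the beginning when it reaches `x`. For `x` = 0 the drop occurs on the
    -- way from n to 1, which is the term `κ`.
    q-left : ∀ {x b a} → x ≤ n → 1 ≤ b → b ≤ n →
      q x b (nxt a) + (⟦ x ≟ nxt a ⟧ + κ x a) ≡ q x b a + ⟦ b ≟ a ⟧
    q-left {zero} {b} {a} _ 1≤b b≤n = begin
      q 0 b (nxt a) + (⟦ 0 ≟ nxt a ⟧ + wrap a)  ≡⟨ cong₂ (λ u w → u + (w + wrap a)) (q-zero b (nxt a)) (⟦⟧-no (0 ≟ nxt a) (<⇒≢ (1≤nxt a))) ⟩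
      ⟦ b <? nxt a ⟧ + wrap a                   ≡⟨ <-nxt 1≤b b≤n ⟩
      ⟦ b <? a ⟧ + ⟦ b ≟ a ⟧                    ≡⟨ cong (_+ ⟦ b ≟ a ⟧) (q-zero b a) ⟨
      q 0 b a + ⟦ b ≟ a ⟧                       ∎
      where open ≡-Reasoning
    q-left {x@(suc _)} {b} {a} x≤n 1≤b b≤n = linear
      (cong₂ _+_ (cong₂ _+_ (q-coboundary x b (nxt a)) (sym (q-coboundary x b a)))
        (cong₂ _+_ (nxt-< {a} (s≤s z≤n) x≤n) (<-nxt {a} 1≤b b≤n)))
      (regroup (q x b (nxt a)) (⟦ x ≟ nxt a ⟧) (q x b a) (⟦ b ≟ a ⟧) ⟦ b <? nxt a ⟧ ⟦ nxt a <? x ⟧ ⟦ b <? x ⟧ ⟦ b <? a ⟧ ⟦ a <? x ⟧ (wrap a))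
      where
      regroup : ∀ q′ e q d bn nx bx ba ax w →
        q′ + (e + 0) + (bn + nx + (q + bx) + (ax + w + (ba + d))) ≡ q + d + (q′ + bx + (ba + ax) + (nx + e + (bn + w)))
      regroup = solve-∀

    -- By `x ≢ nxt a` the middle argument does not pass the starting point, so it stops preceding
    -- `c` only when it reaches `c`. For `x` = 0 the passage from n to 1 makes it the first of all,
    -- whence `κ`.
    q-right : ∀ {x a c} → x ≤ n → 1 ≤ c → c ≤ n → x ≢ nxt a →
      q x a c + κ x a ≡ q x (nxt a) c + ⟦ c ≟ nxt a ⟧
    q-right {zero} {a} {c} _ 1≤c c≤n _ = trans (cong (_+ wrap a) (q-zero a c))
      (trans (sym (nxt-< 1≤c c≤n)) (cong (_+ ⟦ c ≟ nxt a ⟧) (sym (q-zero (nxt a) c))))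
    q-right {x@(suc _)} {a} {c} x≤n 1≤c c≤n x≢ = linear
      (cong₂ _+_ (cong₂ _+_ (q-coboundary x a c) (sym (q-coboundary x (nxt a) c)))
        (cong₂ _+_ (sym (nxt-< {a} 1≤c c≤n)) (trans (cong (⟦ nxt a <? x ⟧ +_) (sym (⟦⟧-no (x ≟ nxt a) x≢))) (nxt-< {a} (s≤s z≤n) x≤n))))
      (regroup (q x a c) (q x (nxt a) c) ⟦ c ≟ nxt a ⟧ ⟦ a <? c ⟧ ⟦ c <? x ⟧ ⟦ nxt a <? x ⟧ (wrap a) ⟦ nxt a <? c ⟧ ⟦ a <? x ⟧)
      where
      regroup : ∀ q q′ e ac cx nx w nc ax →
        q + 0 + (ac + cx + (q′ + nx) + (nc + e + (ax + w))) ≡ q′ + e + (q + ax + (nc + cx) + (ac + w + (nx + 0)))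
      regroup = solve-∀

    -- Moving the starting point from `a` to `nxt a` turns `a` from the first element of the cyclic
    -- order into the last. Since `b` is not `a`, this matters only if `c` is `a`.
    q-below : ∀ {a b c} → 1 ≤ b → b ≤ n → 1 ≤ c → c ≤ n → b ≢ a →
      q a b c + ⟦ c ≟ a ⟧ ≡ q (nxt a) b c
    q-below {a} {b} {c} 1≤b b≤n 1≤c c≤n b≢a = linear
      (cong₂ _+_ (cong₂ _+_ (q-coboundary a b c) (sym (q-coboundary (nxt a) b c)))
        (cong₂ _+_ (sym (<-nxt {a} 1≤c c≤n)) (trans (<-nxt {a} 1≤b b≤n) (cong (⟦ b <? a ⟧ +_) (⟦⟧-no (b ≟ a) b≢a)))))
      (regroup (q a b c) (q (nxt a) b c) ⟦ c ≟ a ⟧ ⟦ b <? c ⟧ ⟦ c <? a ⟧ ⟦ b <? nxt a ⟧ (wrap a) ⟦ c <? nxt a ⟧ ⟦ b <? a ⟧)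
      where
      regroup : ∀ q q′ e bc ca bn w cn ba →
        q + e + (bc + ca + (q′ + bn) + (cn + w + (ba + 0))) ≡ q′ + (q + ba + (bc + cn) + (ca + e + (bn + w)))
      regroup = solve-∀

    -- Read from `nxt a` on, `a` comes last and precedes nothing.
    q-nxt : ∀ {a c} → 1 ≤ a → a ≤ n → 1 ≤ c → c ≤ n → q (nxt a) a c ≡ 0
    q-nxt {a} {c} 1≤a a≤n 1≤c c≤n = linear
      (cong₂ _+_ (cong₂ _+_ (q-coboundary (nxt a) a c) (<-trichotomy a c))
        (cong₂ _+_ (<-nxt {a} 1≤c c≤n) (trans (sym (cong₂ _+_ (⟦⟧-no (a <? a) (n≮n a)) (⟦⟧-yes (a ≟ a) refl))) (sym (<-nxt {a} 1≤a a≤n)))))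
      (regroup (q (nxt a) a c) ⟦ a <? nxt a ⟧ ⟦ a <? c ⟧ ⟦ c <? nxt a ⟧ (wrap a) ⟦ c <? a ⟧ ⟦ c ≟ a ⟧)
      where
      regroup : ∀ q an ac cn w ca e →
        q + (ac + cn + 1 + (ca + e + (an + w))) ≡ 0 + (q + an + (ac + ca + e) + (cn + w + 1))
      regroup = solve-∀

  -- Let φ(z) be the difference of the indicators of z < x and z < y. By the coboundary identity,
  -- `q x a c` minus `q y a c` is φ(c) - φ(a), and the hypothesis says that φ(a) = φ(b).
  q-exchange : ∀ x y a b c → q x a b ≡ q y a b → q x a c + q y b c ≡ q y a c + q x b c
  q-exchange x y a b c same = linear
    (cong₂ _+_
      (cong₂ _+_ (cong₂ _+_ (q-coboundary x a c) (q-coboundary y b c))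
                 (cong₂ _+_ (sym (q-coboundary y a c)) (sym (q-coboundary x b c))))
      (cong₂ _+_ (cong₂ _+_ (sym (q-coboundary x a b)) (q-coboundary y a b)) same))
    (regroup (q x a c) (q y b c) (q y a c) (q x b c) (q x a b) (q y a b) ⟦ a <? x ⟧ ⟦ b <? x ⟧ ⟦ c <? x ⟧
      ⟦ a <? y ⟧ ⟦ b <? y ⟧ ⟦ c <? y ⟧ ⟦ a <? b ⟧ ⟦ a <? c ⟧ ⟦ b <? c ⟧)
    where
    regroup : ∀ xac ybc yac xbc xab yab ax bx cx ay by cy ab ac bc →
      xac + ybc + (ac + cx + (bc + cy) + (yac + ay + (xbc + bx)) + (xab + ax + (ab + by) + yab))
      ≡ yac + xbc + (xac + ax + (ybc + by) + (ac + cy + (bc + cx)) + (ab + bx + (yab + ay) + xab))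
    regroup = solve-∀

  -- The contribution of row i + 1 of two columns to quinv.
  pair : (e f : ℕ → ℕ) → ℕ → ℕ
  pair e f i = q (e (2 + i)) (e (1 + i)) (f (1 + i))

  pairs : (e f : ℕ → ℕ) → ℕ → ℕ
  pairs e f m = sumFin m (pair e f)

  pairs-cong : ∀ (e e′ f f′ : ℕ → ℕ) m → (∀ i → e i ≡ e′ i) → (∀ i → f i ≡ f′ i) → pairs e f m ≡ pairs e′ f′ m
  pairs-cong e e′ f f′ m eq eq′ = sumFin-cong m (λ i _ → q-cong (eq (2 + i)) (eq (1 + i)) (eq′ (1 + i)))

  -- The effect of a ringing path on one pair of columns.

  module _ {a} {A : Set a} (r : ℕ) (f : ℕ → A) (z : A) where

    -- The shape of the telescoping potentials below: they follow the path up to its top row `r` and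
    -- stay constant above it.
    constantAfter : ℕ → A
    constantAfter i with i ≤? r
    ... | yes _ = f i
    ... | no  _ = z

    constantAfter-≤ : ∀ {i} → i ≤ r → constantAfter i ≡ f i
    constantAfter-≤ {i} i≤r with i ≤? r
    ... | yes _  = refl
    ... | no i≰r = contradiction i≤r i≰r

    constantAfter-> : ∀ {i} → r < i → constantAfter i ≡ z
    constantAfter-> {i} r<i with i ≤? r
    ... | yes i≤r = contradiction i≤r (<⇒≱ r<i)
    ... | no _    = refl

  module Columns (n : ℕ) where
    open Next n

    record Filled (h : ℕ) (f : ℕ → ℕ) : Set where
      field
        base  : f 0 ≡ 0
        1≤    : ∀ {i} → 1 ≤ i → i ≤ h → 1 ≤ f i
        ≤n    : ∀ i → f i ≤ n
        above : ∀ {i} → h < i → f i ≡ 0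

    -- A relation between the columns before and after, so that it can be established from either
    -- end: by `R-ring` from the source, by `ring-exists` from the result. `top` expresses that the
    -- path is maximal, `bottom` that its first cell may ring.
    record Rings (f f′ : ℕ → ℕ) (r′ r : ℕ) : Set where
      field
        1≤r′   : 1 ≤ r′
        r′≤r   : r′ ≤ r
        ring   : ∀ {i} → r′ ≤ i → i ≤ r → f′ i ≡ nxt (f i)
        below  : ∀ {i} → i < r′ → f′ i ≡ f i
        beyond : ∀ {i} → r < i → f′ i ≡ f i
        linked : ∀ {i} → r′ ≤ i → i < r → f (suc i) ≡ nxt (f i)
        top    : f (suc r) ≢ nxt (f r)
        bottom : f (pred r′) ≢ f r′

      1≤r : 1 ≤ r
      1≤r = ≤-trans 1≤r′ r′≤r

    module _ {f f′ r′ r} (R : Rings f f′ r′ r) where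
      open Rings R

      -- By `linked`, `f′ i` equals `f (suc i)` below the top of the path: ringing shifts the
      -- entries of the path down by one place. So `f r′` is lost and `f′ r` is gained.
      ring-product : ∀ {c ℓ} (M : CommutativeMonoid c ℓ) (let open CommutativeMonoid M) {h} → r ≤ h →
        (X : ℕ → Carrier) →
        Sums.sumFin M h (X ∘ f′ ∘ suc) ∙ X (f r′) ≈ Sums.sumFin M h (X ∘ f ∘ suc) ∙ X (f′ r)
      ring-product M {h} r≤h X = M.trans (M.∙-congˡ (M.reflexive (sym start)))
        (M.trans (Sums.telescopeFin M h _ _ (φ ∘ suc) (λ {i} _ → step i)) (M.∙-congˡ (M.reflexive end)))
        where
        module M = CommutativeMonoid M
        φ : ℕ → M.Carrier
        -- The factor of `f` still without a partner; `r′ ⊔ ρ` keeps it at `X (f r′)` until the path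
        -- begins.
        φ = constantAfter r (λ ρ → X (f (r′ ⊔ ρ))) (X (f′ r))
        φ-low : ∀ {ρ} → ρ ≤ r → φ ρ ≡ X (f (r′ ⊔ ρ))
        φ-low = constantAfter-≤ r (λ ρ → X (f (r′ ⊔ ρ))) (X (f′ r))
        φ-high : ∀ {ρ} → r < ρ → φ ρ ≡ X (f′ r)
        φ-high = constantAfter-> r (λ ρ → X (f (r′ ⊔ ρ))) (X (f′ r))
        start : φ 1 ≡ X (f r′)
        start = trans (φ-low 1≤r) (cong (X ∘ f) (m≥n⇒m⊔n≡m 1≤r′))
        end : φ (suc h) ≡ X (f′ r)
        end = φ-high (s≤s r≤h)
        step : ∀ i → X (f′ (suc i)) M.∙ φ (suc i) M.≈ X (f (suc i)) M.∙ φ (suc (suc i))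
        step i with suc i <? r′
        ... | yes ρ<r′ = M.reflexive (cong₂ M._∙_ (cong X (below ρ<r′))
                (trans (φ-low (≤-trans (<⇒≤ ρ<r′) r′≤r)) (trans (cong (X ∘ f) (trans (m≥n⇒m⊔n≡m (<⇒≤ ρ<r′)) (sym (m≥n⇒m⊔n≡m ρ<r′)))) (sym (φ-low (≤-trans ρ<r′ r′≤r))))))
        ... | no ρ≮r′ with <-cmp (suc i) r
        ...   | tri< ρ<r _ _ = M.trans (M.comm _ _) (M.reflexive (cong₂ M._∙_
                  (trans (φ-low (<⇒≤ ρ<r)) (cong (X ∘ f) (m≤n⇒m⊔n≡n (≮⇒≥ ρ≮r′))))
                  (sym (trans (φ-low ρ<r) (cong X (trans (cong f (m≤n⇒m⊔n≡n (m≤n⇒m≤1+n (≮⇒≥ ρ≮r′)))) (trans (linked (≮⇒≥ ρ≮r′) ρ<r) (sym (ring (≮⇒≥ ρ≮r′) (<⇒≤ ρ<r))))))))))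
        ...   | tri≈ _ refl _ = M.trans (M.comm _ _) (M.reflexive (cong₂ M._∙_
                  (trans (φ-low ≤-refl) (cong (X ∘ f) (m≤n⇒m⊔n≡n r′≤r))) (sym (φ-high ≤-refl))))
        ...   | tri> _ _ r<ρ = M.reflexive (cong₂ M._∙_ (cong X (beyond r<ρ)) (trans (φ-high r<ρ) (sym (φ-high (m≤n⇒m≤1+n r<ρ)))))

      module _ {hₑ h : ℕ} {e : ℕ → ℕ} (E : Filled hₑ e) (Ff : Filled h f) (r≤h : r ≤ h) where
        module E = Filled E
        module Fl = Filled Ff

        -- Each row of the path changes by `q-left`. Its upper correction compares `e (suc i)` with
        -- `nxt (f i)`, which is `f (suc i)` by `linked`, hence equals the lower correction of the
        -- next row. Only the two ends survive, and they are the contributions of column `e` to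
        -- `down` and `up`. Below the top of the path `κ` vanishes because `e` has a positive entry
        -- there.
        ring-left : h ≤ hₑ →
          pairs e f h + ⟦ e r′ ≟ f r′ ⟧ ≡ pairs e f′ h + (⟦ e (suc r) ≟ f′ r ⟧ + κ (e (suc r)) (f r))
        ring-left h≤hₑ = trans (cong (pairs e f h +_) (sym start))
          (trans (telescopeFin h (pair e f) (pair e f′) (φ ∘ suc) (λ {i} → step i)) (cong (pairs e f′ h +_) end))
          where
          D : ℕ
          D = ⟦ e (suc r) ≟ f′ r ⟧ + κ (e (suc r)) (f r)
          G φ : ℕ → ℕ
          G ρ = ⟦ e (r′ ⊔ ρ) ≟ f (r′ ⊔ ρ) ⟧
          φ = constantAfter r G D
          φ-low : ∀ {ρ} → ρ ≤ r → φ ρ ≡ G ρ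
          φ-low = constantAfter-≤ r G D
          φ-high : ∀ {ρ} → r < ρ → φ ρ ≡ D
          φ-high = constantAfter-> r G D
          φ-const : ∀ {ρ} → ρ ≤ r′ → φ ρ ≡ ⟦ e r′ ≟ f r′ ⟧
          φ-const ρ≤r′ = trans (φ-low (≤-trans ρ≤r′ r′≤r)) (cong (λ k → ⟦ e k ≟ f k ⟧) (m≥n⇒m⊔n≡m ρ≤r′))
          φ-mid : ∀ {ρ} → r′ ≤ ρ → ρ ≤ r → φ ρ ≡ ⟦ e ρ ≟ f ρ ⟧
          φ-mid r′≤ρ ρ≤r = trans (φ-low ρ≤r) (cong (λ k → ⟦ e k ≟ f k ⟧) (m≤n⇒m⊔n≡n r′≤ρ))
          start : φ 1 ≡ ⟦ e r′ ≟ f r′ ⟧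
          start = φ-const 1≤r′
          end : φ (suc h) ≡ D
          end = φ-high (s≤s r≤h)
          step : ∀ i → i < h →
            q (e (2 + i)) (e (1 + i)) (f (1 + i)) + φ (1 + i) ≡ q (e (2 + i)) (e (1 + i)) (f′ (1 + i)) + φ (2 + i)
          step i i<h with suc i <? r′
          ... | yes ρ<r′ = cong₂ _+_ (cong (q _ _) (sym (below ρ<r′))) (trans (φ-const (<⇒≤ ρ<r′)) (sym (φ-const ρ<r′)))
          ... | no ρ≮r′ with <-cmp (suc i) r
          ...   | tri> _ _ r<ρ = cong₂ _+_ (cong (q _ _) (sym (beyond r<ρ))) (trans (φ-high r<ρ) (sym (φ-high (m≤n⇒m≤1+n r<ρ))))
          ...   | tri≈ _ refl _ = trans (cong (q _ _ _ +_) (φ-mid r′≤r ≤-refl))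
                    (trans (sym (q-left {a = f r} (E.≤n (suc r)) (E.1≤ 1≤r (≤-trans i<h h≤hₑ)) (E.≤n r)))
                      (cong₂ _+_ (cong (q _ _) (sym (ring r′≤r ≤-refl)))
                        (trans (cong (λ k → ⟦ e (suc r) ≟ k ⟧ + κ (e (suc r)) (f r)) (sym (ring r′≤r ≤-refl))) (sym (φ-high ≤-refl)))))
          ...   | tri< ρ<r _ _ = trans (cong (q _ _ _ +_) (φ-mid r′≤ρ (<⇒≤ ρ<r)))
                    (trans (sym (q-left {a = f (suc i)} (E.≤n _) (E.1≤ (s≤s z≤n) (≤-trans i<h h≤hₑ)) (E.≤n _)))
                      (cong₂ _+_ (cong (q _ _) (sym (ring r′≤ρ (<⇒≤ ρ<r))))
                        (trans (cong₂ (λ k z → ⟦ e (2 + i) ≟ k ⟧ + z) (sym (linked r′≤ρ ρ<r)) (κ-positive (E.1≤ (s≤s z≤n) (≤-trans ρ<r (≤-trans r≤h h≤hₑ)))))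
                          (trans (+-identityʳ _) (sym (φ-mid (m≤n⇒m≤1+n r′≤ρ) ρ<r))))))
              where
              r′≤ρ : r′ ≤ suc i
              r′≤ρ = ≮⇒≥ ρ≮r′

        -- Inside the path nothing counts, before or after, by `q-nxt`. Only two rows change: the
        -- one below the path, where the first argument of `q` turns (`q-below`), and the top row
        -- `r` of the path, where the middle argument turns under a fixed first one (`q-right`).
        ring-right : hₑ ≤ h →
          pairs f e hₑ + (⟦ e (pred r′) ≟ f r′ ⟧ + (κ (f (suc r)) (f r) when (r ≤? hₑ))) ≡ pairs f′ e hₑ + ⟦ e r ≟ f′ r ⟧
        ring-right hₑ≤h = trans (cong (pairs f e hₑ +_) (sym start))
          (trans (telescopeFin hₑ (pair f e) (pair f′ e) (φ ∘ suc) (λ {i} → step i)) (cong (pairs f′ e hₑ +_) end))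
          where
          K C T : ℕ
          K = κ (f (suc r)) (f r) when (r ≤? hₑ)
          C = ⟦ e (pred r′) ≟ f r′ ⟧
          T = ⟦ e r ≟ f′ r ⟧
          1≤fr′ : 1 ≤ f r′
          1≤fr′ = Fl.1≤ 1≤r′ (≤-trans r′≤r r≤h)
          1≤f′r : 1 ≤ f′ r
          1≤f′r = subst (1 ≤_) (sym (ring r′≤r ≤-refl)) (1≤nxt (f r))
          G φ : ℕ → ℕ
          G ρ = (C when (ρ <? r′)) + K
          φ = constantAfter r G T
          φ-high : ∀ {ρ} → r < ρ → φ ρ ≡ T
          φ-high = constantAfter-> r G T
          φ-mid : ∀ {ρ} → r′ ≤ ρ → ρ ≤ r → φ ρ ≡ K
          φ-mid {ρ} r′≤ρ ρ≤r = trans (constantAfter-≤ r G T ρ≤r) (cong (_+ K) (when-no (ρ <? r′) (≤⇒≯ r′≤ρ)))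
          φ-low : ∀ {ρ} → ρ < r′ → φ ρ ≡ C + K
          φ-low {ρ} ρ<r′ = trans (constantAfter-≤ r G T (≤-trans (<⇒≤ ρ<r′) r′≤r)) (cong (_+ K) (when-yes (ρ <? r′) ρ<r′))
          start : φ 1 ≡ C + K
          start with m≤n⇒m<n∨m≡n 1≤r′
          ... | inj₁ 1<r′ = φ-low 1<r′
          -- A path starting in row 1 has no row below it. `C` then compares an entry with the value
          -- 0 of row 0 and vanishes.
          ... | inj₂ refl = trans (φ-mid ≤-refl r′≤r)
            (cong (_+ K) (sym (⟦⟧-no (e 0 ≟ f 1) (λ eq → <⇒≢ 1≤fr′ (trans (sym E.base) eq)))))
          absent : ∀ {i a} → hₑ < i → 1 ≤ a → ⟦ e i ≟ a ⟧ ≡ 0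
          absent {i} {a} hₑ<i 1≤a = ⟦⟧-no (e i ≟ a) (λ eq → <⇒≢ 1≤a (trans (sym (E.above hₑ<i)) eq))
          -- If `e` ends below row `r`, the pending terms compare an entry with the value 0 above
          -- `e`, or are cut off by the test `r ≤? hₑ`.
          end : φ (suc hₑ) ≡ T
          end = by (suc hₑ ≤? r) (suc hₑ <? r′)
            where
            by : Dec (suc hₑ ≤ r) → Dec (suc hₑ < r′) → φ (suc hₑ) ≡ T
            by (no hₑ≮r)  _ = φ-high (≰⇒> hₑ≮r)
            by (yes hₑ<r) d = trans (low d) (sym (absent hₑ<r 1≤f′r))
              where
              K≡0 : K ≡ 0
              K≡0 = when-no (r ≤? hₑ) (<⇒≱ hₑ<r)
              low : Dec (suc hₑ < r′) → φ (suc hₑ) ≡ 0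
              low (yes hₑ+1<r′) = trans (φ-low hₑ+1<r′) (cong₂ _+_ (absent (<⇒≤pred hₑ+1<r′) 1≤fr′) K≡0)
              low (no  hₑ+1≮r′) = trans (φ-mid (≮⇒≥ hₑ+1≮r′) hₑ<r) K≡0
          step : ∀ i → i < hₑ →
            q (f (2 + i)) (f (1 + i)) (e (1 + i)) + φ (1 + i) ≡ q (f′ (2 + i)) (f′ (1 + i)) (e (1 + i)) + φ (2 + i)
          step i i<hₑ with <-cmp (2 + i) r′
          ... | tri< ρ+1<r′ _ _ = cong₂ _+_
                  (cong₂ (λ x a → q x a (e (1 + i))) (sym (below ρ+1<r′)) (sym (below (<⇒≤ ρ+1<r′))))
                  (trans (φ-low (<⇒≤ ρ+1<r′)) (sym (φ-low ρ+1<r′)))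
          ... | tri≈ _ refl _ = trans (cong (q (f r′) (f (1 + i)) (e (1 + i)) +_) (φ-low ≤-refl)) (trans (sym (+-assoc _ C K))
                  (cong₂ _+_ (trans (q-below {f r′} {f (1 + i)} {e (1 + i)} (Fl.1≤ (s≤s z≤n) (≤-trans i<hₑ hₑ≤h)) (Fl.≤n _) (E.1≤ (s≤s z≤n) i<hₑ) (E.≤n _) bottom)
                    (cong₂ (λ x a → q x a (e (1 + i))) (sym (ring ≤-refl r′≤r)) (sym (below ≤-refl))))
                  (sym (φ-mid ≤-refl r′≤r))))
          ... | tri> _ _ r′<ρ+1 with <-cmp (1 + i) r
          ...   | tri> _ _ r<ρ = cong₂ _+_
                  (cong₂ (λ x a → q x a (e (1 + i))) (sym (beyond (m≤n⇒m≤1+n r<ρ))) (sym (beyond r<ρ)))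
                  (trans (φ-high r<ρ) (sym (φ-high (m≤n⇒m≤1+n r<ρ))))
          ...   | tri≈ _ refl _ = trans (cong (q _ _ _ +_) (trans (φ-mid r′≤r ≤-refl) (when-yes (r ≤? hₑ) i<hₑ)))
                  (trans (q-right {f (suc r)} {f r} {e r} (Fl.≤n _) (E.1≤ 1≤r i<hₑ) (E.≤n _) top)
                    (cong₂ _+_ (cong₂ (λ x a → q x a (e r)) (sym (beyond ≤-refl)) (sym (ring r′≤r ≤-refl)))
                      (trans (cong (λ k → ⟦ e r ≟ k ⟧) (sym (ring r′≤r ≤-refl))) (sym (φ-high ≤-refl)))))
          ...   | tri< ρ<r _ _ = cong₂ _+_ (trans (trans (cong (λ x → q x (f (1 + i)) (e (1 + i))) (linked r′≤ρ ρ<r)) (q≡0 (1 + i) (s≤s z≤n) (≤-trans i<hₑ hₑ≤h)))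
                    (sym (trans (cong₂ (λ x a → q x a (e (1 + i))) (ring (m≤n⇒m≤1+n r′≤ρ) ρ<r) (trans (ring r′≤ρ (<⇒≤ ρ<r)) (sym (linked r′≤ρ ρ<r))))
                      (q≡0 (2 + i) (s≤s z≤n) (≤-trans ρ<r r≤h)))))
                  (trans (φ-mid r′≤ρ (<⇒≤ ρ<r)) (sym (φ-mid (m≤n⇒m≤1+n r′≤ρ) ρ<r)))
              where
              r′≤ρ : r′ ≤ 1 + i
              r′≤ρ = ≤-pred r′<ρ+1
              q≡0 : ∀ k → 1 ≤ k → k ≤ h → q (nxt (f k)) (f k) (e (1 + i)) ≡ 0
              q≡0 k 1≤k k≤h = q-nxt {f k} (Fl.1≤ 1≤k k≤h) (Fl.≤n k) (E.1≤ (s≤s z≤n) i<hₑ) (E.≤n _)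

  -- Exchanging the upper parts of two columns.

  record Swapped (h : ℕ) (f g f′ g′ : ℕ → ℕ) (m : ℕ) : Set where
    field
      m≤h        : m ≤ h
      swap-f     : ∀ {i} → m ≤ i → f′ i ≡ g i
      swap-g     : ∀ {i} → m ≤ i → g′ i ≡ f i
      keep-f     : ∀ {i} → i < m → f′ i ≡ f i
      keep-g     : ∀ {i} → i < m → g′ i ≡ g i
      -- Here `m` plays the role of r_max. For `m` = 1 there is no row below and hence no condition.
      -- That two indicators differ is written as their sum being 1.
      balanced   : ∀ {i} → m ≡ 2 + i → q (f (2 + i)) (f (1 + i)) (g (1 + i)) ≡ q (g (2 + i)) (f (1 + i)) (g (1 + i))
      unbalanced : ∀ {i} → m ≤ i → i < h → q (f (suc i)) (f i) (g i) + q (g (suc i)) (f i) (g i) ≡ 1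

  module _ {h f g f′ g′ m} (S : Swapped h f g f′ g′ m) where
    open Swapped S

    unbalanced-≢ : ∀ {i} → m ≤ i → i < h → f i ≢ g i
    unbalanced-≢ {i} m≤i i<h eq = contradiction (trans (sym both) (unbalanced m≤i i<h)) λ ()
      where
      both : q (f (suc i)) (f i) (g i) + q (g (suc i)) (f i) (g i) ≡ 0
      both = cong₂ _+_ (trans (cong (q _ _) (sym eq)) (q-refl _ (f i))) (trans (cong (q _ _) (sym eq)) (q-refl _ (f i)))

    swap-left : ∀ (e : ℕ → ℕ) k → pairs e f k + pairs e g k ≡ pairs e f′ k + pairs e g′ k
    swap-left e k = trans (sym (sumFin-∙ k (pair e f) (pair e g)))
      (trans (sumFin-cong k (λ i _ → step i)) (sumFin-∙ k (pair e f′) (pair e g′)))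
      where
      step : ∀ i → q (e (2 + i)) (e (1 + i)) (f (1 + i)) + q (e (2 + i)) (e (1 + i)) (g (1 + i))
        ≡ q (e (2 + i)) (e (1 + i)) (f′ (1 + i)) + q (e (2 + i)) (e (1 + i)) (g′ (1 + i))
      step i with m ≤? 1 + i
      ... | yes m≤ρ = trans (+-comm _ (q _ _ (g (1 + i)))) (cong₂ (λ a b → q _ _ a + q _ _ b) (sym (swap-f m≤ρ)) (sym (swap-g m≤ρ)))
      ... | no  m≰ρ = cong₂ (λ a b → q _ _ a + q _ _ b) (sym (keep-f (≰⇒> m≰ρ))) (sym (keep-g (≰⇒> m≰ρ)))

    -- From row `m` on the two summands are merely interchanged. Only in row `m - 1` do the old
    -- entries meet new ones above them; there the balance at `m` is precisely the hypothesis of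
    -- `q-exchange`.
    swap-right : ∀ (e : ℕ → ℕ) k → pairs f e k + pairs g e k ≡ pairs f′ e k + pairs g′ e k
    swap-right e k = trans (sym (sumFin-∙ k (pair f e) (pair g e)))
      (trans (sumFin-cong k (λ i _ → step i)) (sumFin-∙ k (pair f′ e) (pair g′ e)))
      where
      step : ∀ i → q (f (2 + i)) (f (1 + i)) (e (1 + i)) + q (g (2 + i)) (g (1 + i)) (e (1 + i))
        ≡ q (f′ (2 + i)) (f′ (1 + i)) (e (1 + i)) + q (g′ (2 + i)) (g′ (1 + i)) (e (1 + i))
      step i with <-cmp m (2 + i)
      ... | tri< m<2+i _ _ = trans (+-comm _ (q (g (2 + i)) (g (1 + i)) (e (1 + i)))) (cong₂ _+_
              (cong₂ (λ x a → q x a _) (sym (swap-f (<⇒≤ m<2+i))) (sym (swap-f (≤-pred m<2+i))))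
              (cong₂ (λ x a → q x a _) (sym (swap-g (<⇒≤ m<2+i))) (sym (swap-g (≤-pred m<2+i)))))
      ... | tri≈ _ refl _ = trans (q-exchange (f (2 + i)) (g (2 + i)) (f (1 + i)) (g (1 + i)) (e (1 + i)) (balanced refl)) (cong₂ _+_
              (cong₂ (λ x a → q x a _) (sym (swap-f ≤-refl)) (sym (keep-f ≤-refl)))
              (cong₂ (λ x a → q x a _) (sym (swap-g ≤-refl)) (sym (keep-g ≤-refl))))
      ... | tri> _ _ 2+i<m = cong₂ _+_
              (cong₂ (λ x a → q x a _) (sym (keep-f 2+i<m)) (sym (keep-f (<⇒≤ 2+i<m))))
              (cong₂ (λ x a → q x a _) (sym (keep-g 2+i<m)) (sym (keep-g (<⇒≤ 2+i<m))))

    -- Above `m`, exchanging the upper entries flips the indicator because the rows are unbalanced,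
    -- and exchanging the lower ones flips it back by antisymmetry. In the top row both upper
    -- entries are 0, so only the second flip takes place.
    swap-within : f (suc h) ≡ 0 → g (suc h) ≡ 0 → 1 ≤ h →
      pairs f g h + ⟦ g h <? f h ⟧ ≡ pairs f′ g′ h + ⟦ f h <? g h ⟧
    swap-within f≡0 g≡0 1≤h = trans (cong (pairs f g h +_) (sym (φ-low 1≤h)))
      (trans (telescopeFin h (pair f g) (pair f′ g′) (φ ∘ suc) (λ {i} → step i)) (cong (pairs f′ g′ h +_) φ-high))
      where
      φ : ℕ → ℕ
      φ = constantAfter h (λ _ → ⟦ g h <? f h ⟧) ⟦ f h <? g h ⟧
      φ-low : ∀ {ρ} → ρ ≤ h → φ ρ ≡ ⟦ g h <? f h ⟧
      φ-low = constantAfter-≤ h (λ _ → ⟦ g h <? f h ⟧) ⟦ f h <? g h ⟧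
      φ-high : φ (suc h) ≡ ⟦ f h <? g h ⟧
      φ-high = constantAfter-> h (λ _ → ⟦ g h <? f h ⟧) ⟦ f h <? g h ⟧ ≤-refl
      inner : ∀ i → 1 + i < h → q (f (2 + i)) (f (1 + i)) (g (1 + i)) ≡ q (f′ (2 + i)) (f′ (1 + i)) (g′ (1 + i))
      inner i ρ<h with <-cmp m (2 + i)
      ... | tri> _ _ 2+i<m = sym (trans (cong₂ (λ x a → q x a _) (keep-f 2+i<m) (keep-f (<⇒≤ 2+i<m))) (cong (q _ _) (keep-g (<⇒≤ 2+i<m))))
      ... | tri≈ _ refl _ = trans (balanced refl) (sym (trans (cong₂ (λ x a → q x a _) (swap-f ≤-refl) (keep-f ≤-refl)) (cong (q _ _) (keep-g ≤-refl))))
      ... | tri< m<2+i _ _ = trans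
              (+-cancelʳ-≡ (q (g (2 + i)) (f (1 + i)) (g (1 + i))) _ _
                (trans (unbalanced (≤-pred m<2+i) ρ<h) (sym (q-antisym (g (2 + i)) (≢-sym (unbalanced-≢ (≤-pred m<2+i) ρ<h))))))
              (sym (trans (cong₂ (λ x a → q x a _) (swap-f (<⇒≤ m<2+i)) (swap-f (≤-pred m<2+i))) (cong (q _ _) (swap-g (≤-pred m<2+i)))))
      step : ∀ i → i < h → q (f (2 + i)) (f (1 + i)) (g (1 + i)) + φ (1 + i) ≡ q (f′ (2 + i)) (f′ (1 + i)) (g′ (1 + i)) + φ (2 + i)
      step i i<h with m≤n⇒m<n∨m≡n i<h
      ... | inj₁ ρ<h = cong₂ _+_ (inner i ρ<h) (trans (φ-low i<h) (sym (φ-low ρ<h)))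
      ... | inj₂ refl = begin
        q (f (suc h)) (f h) (g h) + φ h                ≡⟨ cong₂ _+_ (trans (cong (λ x → q x (f h) (g h)) f≡0) (q-zero (f h) (g h))) (φ-low ≤-refl) ⟩
        ⟦ f h <? g h ⟧ + ⟦ g h <? f h ⟧                ≡⟨ +-comm ⟦ f h <? g h ⟧ _ ⟩
        ⟦ g h <? f h ⟧ + ⟦ f h <? g h ⟧                ≡⟨ cong₂ _+_ (trans (cong₂ (λ x a → q x a (g′ h)) (trans (swap-f (m≤n⇒m≤1+n m≤h)) g≡0) (swap-f m≤h))
                                                            (trans (cong (q 0 (g h)) (swap-g m≤h)) (q-zero (g h) (f h)))) φ-high ⟨
        q (f′ (suc h)) (f′ h) (g′ h) + φ (suc h)       ∎
        where open ≡-Reasoning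

  lookup⁺∘lookup⁻ : ∀ {A : Set} (P : A → Set) {m} (xs : Vec A m) (f : ∀ i → P (V.lookup xs i)) i →
    lookup⁺ (lookup⁻ {P = P} {xs = xs} f) i ≡ f i
  lookup⁺∘lookup⁻ P (x ∷ xs) f F.zero    = refl
  lookup⁺∘lookup⁻ P (x ∷ xs) f (F.suc i) = lookup⁺∘lookup⁻ P xs (f ∘ F.suc) i

  lookup⁺-injective : ∀ {A : Set} {P : A → Set} {m} {xs : Vec A m} (ps qs : All P xs) →
    (∀ i → lookup⁺ ps i ≡ lookup⁺ qs i) → ps ≡ qs
  lookup⁺-injective []       []       eq = refl
  lookup⁺-injective (p ∷ ps) (q ∷ qs) eq = cong₂ _∷_ (eq F.zero) (lookup⁺-injective ps qs (eq ∘ F.suc))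

  lookup-injective : ∀ {A : Set} {m} (xs ys : Vec A m) → (∀ i → V.lookup xs i ≡ V.lookup ys i) → xs ≡ ys
  lookup-injective xs ys eq = trans (sym (tabulate∘lookup xs)) (trans (tabulate-cong eq) (tabulate∘lookup ys))

  ∈-interval⁺ : ∀ {a b i} → a ≤ i → i < b → i ∈ interval a b
  ∈-interval⁺ {a} {b} {i} a≤i i<b = subst (_∈ interval a b) (m+[n∸m]≡n a≤i)
    (∈-applyUpTo⁺ (a +_) (∸-monoˡ-< i<b a≤i))

  ∈-interval⁻ : ∀ {a b i} → i ∈ interval a b → a ≤ i × i < b
  ∈-interval⁻ {a} {b} i∈ with k , k<b∸a , refl ← ∈-applyUpTo⁻ (a +_) i∈ =
    m≤m+n a k , subst (a + k <_) (m+[n∸m]≡n a≤b) (+-monoʳ-< a k<b∸a)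
    where
    a≤b : a ≤ b
    a≤b = <⇒≤ (m∸n≢0⇒n<m (λ eq → n≮0 (subst (k <_) eq k<b∸a)))

  module _ {p} {P : ℕ → Set p} (P? : Decidable P) (d lo hi : ℕ) where

    -- The common shape of `ringTop` and `rmax`.
    maxFiltered : ℕ
    maxFiltered = max d (filter P? (interval lo hi))

    maxFiltered-sel : maxFiltered ≡ d ⊎ (lo ≤ maxFiltered × maxFiltered < hi × P maxFiltered)
    maxFiltered-sel with argmax-sel id d (filter P? (interval lo hi))
    ... | inj₁ eq = inj₁ eq
    ... | inj₂ m∈ with m∈i , Pm ← ∈-filter⁻ P? {xs = interval lo hi} m∈
                  with lo≤ , <hi ← ∈-interval⁻ {lo} m∈i = inj₂ (lo≤ , <hi , Pm)

    default≤maxFiltered : d ≤ maxFiltered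
    default≤maxFiltered = ⊥≤max d (filter P? (interval lo hi))

    ≤maxFiltered : ∀ {i} → lo ≤ i → i < hi → P i → i ≤ maxFiltered
    ≤maxFiltered lo≤i i<hi Pi = ListAll.lookup (xs≤max d (filter P? (interval lo hi)))
      (∈-filter⁺ P? (∈-interval⁺ lo≤i i<hi) Pi)

  -- Fillings and the ringing path map.

  module Fillings (Λ : Partition) (n : ℕ) .{{_ : NonZero n}} where
    open Tableaux Λ n
    open Next n
    open Columns n

    tabulate-! : ∀ (f : Cell → Fin n) u → tabulate f ! u ≡ f u
    tabulate-! f (c , r) = trans
      (cong (λ w → V.lookup w r) (lookup⁺∘lookup⁻ (Vec (Fin n)) parts (λ c → V.tabulate (λ r → f (c , r))) c))
      (lookup∘tabulate (λ r → f (c , r)) r)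

    !-injective : ∀ σ ρ → (∀ u → σ ! u ≡ ρ ! u) → σ ≡ ρ
    !-injective σ ρ eq = lookup⁺-injective σ ρ (λ c → lookup-injective (lookup⁺ σ c) (lookup⁺ ρ c) (λ r → eq (c , r)))

    cell : ∀ c {i} → i < height c → Cell
    cell c i<h = c , fromℕ< i<h

    entry-inside : ∀ σ c {i} (i<h : i < height c) → entry σ (suc i) c ≡ suc (toℕ (σ ! cell c i<h))
    entry-inside σ c {i} i<h with i <? height c
    ... | yes i<h′ = cong (λ r → suc (toℕ (σ ! (c , r)))) (Fₚ.fromℕ<-cong i i refl i<h′ i<h)
    ... | no  i≮h  = contradiction i<h i≮h

    entry-above : ∀ σ c {i} → height c < i → entry σ i c ≡ 0
    entry-above σ c {suc i} (s≤s h≤i) with i <? height c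
    ... | yes i<h = contradiction h≤i (<⇒≱ i<h)
    ... | no  _   = refl

    row≤height : ∀ u → row u ≤ height (col u)
    row≤height (c , r) = Fₚ.toℕ<n r

    value-≡ : ∀ σ u → value σ u ≡ suc (toℕ (σ ! u))
    value-≡ σ (c , r) = trans (entry-inside σ c (Fₚ.toℕ<n r))
      (cong (λ r → suc (toℕ (σ ! (c , r)))) (Fₚ.fromℕ<-toℕ r (Fₚ.toℕ<n r)))

    entry-cell : ∀ c {i} → 1 ≤ i → i ≤ height c → ∃ λ u → col u ≡ c × row u ≡ i × (∀ σ → entry σ i c ≡ suc (toℕ (σ ! u)))
    entry-cell c {suc i} _ i<h = cell c i<h , refl , cong suc (Fₚ.toℕ-fromℕ< i<h) , λ σ → entry-inside σ c i<h

    column : Tab → Column → ℕ → ℕ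
    column σ c i = entry σ i c

    filled : ∀ σ c → Filled (height c) (column σ c)
    filled σ c = record { base = refl ; 1≤ = 1≤ ; ≤n = ≤n ; above = entry-above σ c }
      where
      1≤ : ∀ {i} → 1 ≤ i → i ≤ height c → 1 ≤ entry σ i c
      1≤ {suc i} _ i<h = subst (1 ≤_) (sym (entry-inside σ c i<h)) (s≤s z≤n)
      ≤n : ∀ i → entry σ i c ≤ n
      ≤n zero = z≤n
      ≤n (suc i) with i <? height c
      ... | yes i<h = Fₚ.toℕ<n _
      ... | no  _   = z≤n

    1≤entry : ∀ σ c {i} → 1 ≤ i → i ≤ height c → 1 ≤ entry σ i c
    1≤entry σ c = Filled.1≤ (filled σ c)

    entry≤n : ∀ σ i c → entry σ i c ≤ n
    entry≤n σ i c = Filled.≤n (filled σ c) i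

    1≤row : ∀ u → 1 ≤ row u
    1≤row u = s≤s z≤n

    value-injective : ∀ σ ρ u v → value σ u ≡ value ρ v → σ ! u ≡ ρ ! v
    value-injective σ ρ u v eq = Fₚ.toℕ-injective (suc-injective (trans (sym (value-≡ σ u)) (trans eq (value-≡ ρ v))))

    ext : ∀ σ ρ → (∀ c {i} → 1 ≤ i → i ≤ height c → entry σ i c ≡ entry ρ i c) → σ ≡ ρ
    ext σ ρ eq = !-injective σ ρ (λ u → value-injective σ ρ u u (eq (col u) (1≤row u) (row≤height u)))

    south⇒entry : ∀ σ u {v} → south σ u ≡ [ v ] → entry σ (pred (row u)) (col u) ≡ v
    south⇒entry σ (c , r) eq with toℕ r
    ... | zero  = contradiction eq λ ()
    ... | suc k = just-injective eq

    entry⇒south : ∀ σ u {v} → 1 ≤ v → entry σ (pred (row u)) (col u) ≡ v → south σ u ≡ [ v ]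
    entry⇒south σ (c , r) 1≤v eq with toℕ r
    ... | zero  = contradiction eq (<⇒≢ 1≤v)
    ... | suc k = cong [_] eq

    enabled⇒ : ∀ σ u → Enabled σ u → entry σ (pred (row u)) (col u) ≢ value σ u
    enabled⇒ σ u en eq = en (entry⇒south σ u (1≤entry σ (col u) (1≤row u) (row≤height u)) eq)

    ⇒enabled : ∀ σ u → entry σ (pred (row u)) (col u) ≢ value σ u → Enabled σ u
    ⇒enabled σ u ne eq = ne (south⇒entry σ u eq)

    -- The ringing path map

    suc-toℕ-increment : ∀ k → suc (toℕ (increment k)) ≡ nxt (suc (toℕ k))
    suc-toℕ-increment k = trans (cong suc (Fₚ.toℕ-fromℕ< (m%n<n (suc (toℕ k)) n))) go
      where
      go : suc (suc (toℕ k) % n) ≡ nxt (suc (toℕ k))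
      go with suc (toℕ k) ≟ n
      ... | yes eq = cong suc (trans (%-congˡ {o = n} eq) (n%n≡0 n))
      ... | no  ne = cong suc (m<n⇒m%n≡m (≤∧≢⇒< (Fₚ.toℕ<n k) ne))

    nxt-% : ∀ {a} → a ≤ n → suc a % n ≡ nxt a % n
    nxt-% {a} a≤n with a ≟ n
    ... | yes refl = [m+n]%n≡m%n 1 a
    ... | no  _    = refl

    %-injective : ∀ {a b} → 1 ≤ a → a ≤ n → 1 ≤ b → b ≤ n → a % n ≡ b % n → a ≡ b
    %-injective 1≤a a≤n 1≤b b≤n eq with m≤n⇒m<n∨m≡n a≤n | m≤n⇒m<n∨m≡n b≤n
    ... | inj₁ a<n  | inj₁ b<n  = trans (sym (m<n⇒m%n≡m a<n)) (trans eq (m<n⇒m%n≡m b<n))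
    ... | inj₂ refl | inj₂ refl = refl
    ... | inj₁ a<n  | inj₂ refl = contradiction (trans (sym (n%n≡0 n)) (trans (sym eq) (m<n⇒m%n≡m a<n))) (<⇒≢ 1≤a)
    ... | inj₂ refl | inj₁ b<n  = contradiction (trans (sym (n%n≡0 n)) (trans eq (m<n⇒m%n≡m b<n))) (<⇒≢ 1≤b)

    module _ (σ : Tab) (c : Column) {i : ℕ} (1≤i : 1 ≤ i) (i<h : i < height c) where

      -- The bound `i < height c` matters: the value 0 above a column is congruent to n, so at the
      -- top the congruence may hold although 0 is no cyclic successor.
      successive⇒ : Successive σ c i → entry σ (suc i) c ≡ nxt (entry σ i c)
      successive⇒ eq = %-injective (1≤entry σ c (s≤s z≤n) i<h) (entry≤n σ (suc i) c)
        (1≤nxt _) (nxt≤n (1≤entry σ c 1≤i (<⇒≤ i<h)) (entry≤n σ i c))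
        (trans eq (nxt-% (entry≤n σ i c)))

      ⇒successive : entry σ (suc i) c ≡ nxt (entry σ i c) → Successive σ c i
      ⇒successive eq = trans (%-congˡ {o = n} eq) (sym (nxt-% (entry≤n σ i c)))

    module _ (σ : Tab) (u : Cell) where

      private
        Linked? : Decidable (λ h → ListAll.All (Successive σ (col u)) (interval (row u) h))
        Linked? h = ListAll.all? (successive? σ (col u)) (interval (row u) h)

        sel = maxFiltered-sel Linked? (row u) (row u) (suc (height (col u)))

      row≤ringTop : row u ≤ ringTop σ u
      row≤ringTop = default≤maxFiltered Linked? (row u) (row u) (suc (height (col u)))

      ringTop≤height : ringTop σ u ≤ height (col u)
      ringTop≤height with sel
      ... | inj₁ eq            = subst (_≤ height (col u)) (sym eq) (row≤height u)
      ... | inj₂ (_ , ≤h , _)  = ≤-pred ≤h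

      ringTop-successive : ∀ {i} → row u ≤ i → i < ringTop σ u → Successive σ (col u) i
      ringTop-successive r≤i i<t with sel
      ... | inj₁ eq            = contradiction (subst (_ <_) eq i<t) (≤⇒≯ r≤i)
      ... | inj₂ (_ , _ , all) = ListAll.lookup all (∈-interval⁺ r≤i i<t)

      ringTop-maximal : ∀ {h} → row u ≤ h → h ≤ height (col u) →
        (∀ {i} → row u ≤ i → i < h → Successive σ (col u) i) → h ≤ ringTop σ u
      ringTop-maximal r≤h h≤ suc-all = ≤maxFiltered Linked? (row u) (row u) (suc (height (col u))) r≤h (s≤s h≤)
        (ListAll.tabulate (λ i∈ → let (r≤i , i<h) = ∈-interval⁻ {row u} i∈ in suc-all r≤i i<h))

    mutual
      -- The local function tabulated by R, recovered by unification.
      R-new : Tab → Cell → Cell → Fin n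
      R-new = _

      R-! : ∀ σ u v → R σ u ! v ≡ R-new σ u v
      R-! σ u v = tabulate-! (R-new σ u) v

    OnPath : Tab → Cell → Cell → Set
    OnPath σ u v = col v ≡ col u × row u ≤ row v × row v ≤ ringTop σ u

    R-on : ∀ σ u v → OnPath σ u v → R σ u ! v ≡ increment (σ ! v)
    R-on σ u v p = trans (R-! σ u v) go
      where
      go : R-new σ u v ≡ increment (σ ! v)
      go with col v Fₚ.≟ col u ×-dec row u ≤? row v ×-dec row v ≤? ringTop σ u
      ... | yes _ = refl
      ... | no ¬p = contradiction p ¬p

    R-off : ∀ σ u v → ¬ OnPath σ u v → R σ u ! v ≡ σ ! v
    R-off σ u v ¬p = trans (R-! σ u v) go
      where
      go : R-new σ u v ≡ σ ! v
      go with col v Fₚ.≟ col u ×-dec row u ≤? row v ×-dec row v ≤? ringTop σ u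
      ... | yes p = contradiction p ¬p
      ... | no _  = refl

    record Ring (σ ρ : Tab) (c : Column) (r′ r : ℕ) : Set where
      field
        rings : Rings (column σ c) (column ρ c) r′ r
        fits  : r ≤ height c
        rest  : ∀ {c′} i → c′ ≢ c → entry ρ i c′ ≡ entry σ i c′
      open Rings rings public

    entry-≡ : ∀ σ ρ c i → (∀ u → col u ≡ c → row u ≡ i → σ ! u ≡ ρ ! u) → entry σ i c ≡ entry ρ i c
    entry-≡ σ ρ c zero    eq = refl
    entry-≡ σ ρ c i@(suc _) eq = go (i ≤? height c)
      where
      go : Dec (i ≤ height c) → entry σ i c ≡ entry ρ i c
      go (yes i≤h) with u , colu , rowu , at ← entry-cell c (s≤s z≤n) i≤h =
        trans (at σ) (trans (cong (suc ∘ toℕ) (eq u colu rowu)) (sym (at ρ)))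
      go (no i≰h) = trans (entry-above σ c (≰⇒> i≰h)) (sym (entry-above ρ c (≰⇒> i≰h)))

    R-ring : ∀ σ u → Enabled σ u → Ring σ (R σ u) (col u) (row u) (ringTop σ u)
    R-ring σ u en = record
      { fits = top≤h
      ; rest = λ i c′≢c → entry-≡ (R σ u) σ _ i (λ v colv _ → R-off σ u v (λ (eq , _) → c′≢c (trans (sym colv) eq)))
      ; rings = record
        { 1≤r′ = 1≤row u
        ; r′≤r = row≤ringTop σ u
        ; ring = ring
        ; below = λ {i} i<r′ → entry-≡ (R σ u) σ _ i (λ v _ rowv → R-off σ u v (λ (_ , le , _) → <⇒≱ i<r′ (subst (row u ≤_) rowv le)))
        ; beyond = λ {i} r<i → entry-≡ (R σ u) σ _ i (λ v _ rowv → R-off σ u v (λ (_ , _ , le) → <⇒≱ r<i (subst (_≤ ringTop σ u) rowv le)))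
        ; linked = λ r′≤i i<r → successive⇒ σ (col u) (≤-trans (1≤row u) r′≤i) (<-≤-trans i<r top≤h) (ringTop-successive σ u r′≤i i<r)
        ; top = top
        ; bottom = enabled⇒ σ u en
        }
      }
      where
      top≤h = ringTop≤height σ u
      ring : ∀ {i} → row u ≤ i → i ≤ ringTop σ u → entry (R σ u) i (col u) ≡ nxt (entry σ i (col u))
      ring {i} r′≤i i≤r with v , colv , rowv , at ← entry-cell (col u) (≤-trans (1≤row u) r′≤i) (≤-trans i≤r top≤h) = begin
        entry (R σ u) i (col u)          ≡⟨ at (R σ u) ⟩
        suc (toℕ (R σ u ! v))            ≡⟨ cong (suc ∘ toℕ) (R-on σ u v (colv , subst (row u ≤_) (sym rowv) r′≤i , subst (_≤ ringTop σ u) (sym rowv) i≤r)) ⟩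
        suc (toℕ (increment (σ ! v)))    ≡⟨ suc-toℕ-increment (σ ! v) ⟩
        nxt (suc (toℕ (σ ! v)))          ≡⟨ cong nxt (at σ) ⟨
        nxt (entry σ i (col u))          ∎
        where open ≡-Reasoning
      top : entry σ (suc (ringTop σ u)) (col u) ≢ nxt (entry σ (ringTop σ u) (col u))
      top eq with m≤n⇒m<n∨m≡n top≤h
      ... | inj₁ t<h = n≮n _ (ringTop-maximal σ u (m≤n⇒m≤1+n (row≤ringTop σ u)) t<h all)
        where
        all : ∀ {i} → row u ≤ i → i < suc (ringTop σ u) → Successive σ (col u) i
        all r≤i (s≤s i≤t) with m≤n⇒m<n∨m≡n i≤t
        ... | inj₁ i<t  = ringTop-successive σ u r≤i i<t
        ... | inj₂ refl = ⇒successive σ (col u) (≤-trans (1≤row u) r≤i) t<h eq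
      -- Above the column the entry is 0, whereas `nxt` is at least 1.
      ... | inj₂ t≡h = <⇒≢ (1≤nxt (entry σ (ringTop σ u) (col u)))
        (trans (sym (entry-above σ (col u) (s≤s (≤-reflexive (sym t≡h))))) eq)

    module _ {σ ρ u r} (Rg : Ring σ ρ (col u) (row u) r) where
      open Ring Rg

      ring⇒enabled : Enabled σ u
      ring⇒enabled = ⇒enabled σ u bottom

      -- `linked` makes `r` an admissible height, and a longer path would contradict `top`. With
      -- this, any `Ring` starting at `u` comes from `R`.
      ring⇒ringTop : ringTop σ u ≡ r
      ring⇒ringTop = ≤-antisym upper (ringTop-maximal σ u r′≤r fits
        (λ r′≤i i<r → ⇒successive σ (col u) (≤-trans 1≤r′ r′≤i) (<-≤-trans i<r fits) (linked r′≤i i<r)))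
        where
        upper : ringTop σ u ≤ r
        upper = ≮⇒≥ (λ r<t → top (successive⇒ σ (col u) 1≤r (<-≤-trans r<t (ringTop≤height σ u)) (ringTop-successive σ u r′≤r r<t)))

      ring⇒R : R σ u ≡ ρ
      ring⇒R = ext (R σ u) ρ (λ c {i} _ _ → agree c i)
        where
        open Ring (subst (Ring σ (R σ u) (col u) (row u)) ring⇒ringTop (R-ring σ u ring⇒enabled))
          using () renaming (ring to ringᴿ; below to belowᴿ; beyond to beyondᴿ; rest to restᴿ)
        agree : ∀ c i → entry (R σ u) i c ≡ entry ρ i c
        agree c i with c Fₚ.≟ col u
        ... | no c≢ = trans (restᴿ i c≢) (sym (rest i c≢))
        ... | yes refl with i <? row u
        ...   | yes i<r′ = trans (belowᴿ i<r′) (sym (below i<r′))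
        ...   | no  i≮r′ with r <? i
        ...     | yes r<i = trans (beyondᴿ r<i) (sym (beyond r<i))
        ...     | no  r≮i = trans (ringᴿ (≮⇒≥ i≮r′) (≮⇒≥ r≮i)) (sym (ring (≮⇒≥ i≮r′) (≮⇒≥ r≮i)))

    -- After ringing, the path still consists of consecutive entries and
    -- cannot be prolonged downwards, so its lower end can be recovered.
    ring-start-≮ : ∀ {σ₁ σ₂ ρ c r₁ r₂ r} → Ring σ₁ ρ c r₁ r → Ring σ₂ ρ c r₂ r → ¬ (r₁ < r₂)
    ring-start-≮ {σ₁} {σ₂} {ρ} {c} {r₁} {suc i} {r} Rg₁ Rg₂ r₁<r₂@(s≤s r₁≤i) =
      R₂.bottom (nxt-injective (1≤entry σ₂ c (≤-trans R₁.1≤r′ r₁≤i) (≤-trans (<⇒≤ R₂.r′≤r) R₁.fits)) (1≤entry σ₂ c (s≤s z≤n) (≤-trans R₂.r′≤r R₁.fits)) (begin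
        nxt (entry σ₂ i c)        ≡⟨ cong nxt (R₂.below ≤-refl) ⟨
        nxt (entry ρ i c)         ≡⟨ cong nxt (trans (R₁.ring r₁≤i (<⇒≤ R₂.r′≤r)) (sym (R₁.linked r₁≤i R₂.r′≤r))) ⟩
        nxt (entry σ₁ (suc i) c)  ≡⟨ R₁.ring (<⇒≤ r₁<r₂) R₂.r′≤r ⟨
        entry ρ (suc i) c         ≡⟨ R₂.ring ≤-refl R₂.r′≤r ⟩
        nxt (entry σ₂ (suc i) c)  ∎))
      where
      open ≡-Reasoning
      module R₁ = Ring Rg₁
      module R₂ = Ring Rg₂

    ring-start-unique : ∀ {σ₁ σ₂ ρ c r₁ r₂ r} → Ring σ₁ ρ c r₁ r → Ring σ₂ ρ c r₂ r → r₁ ≡ r₂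
    ring-start-unique Rg₁ Rg₂ = ≤-antisym (≮⇒≥ (ring-start-≮ Rg₂ Rg₁)) (≮⇒≥ (ring-start-≮ Rg₁ Rg₂))

    ring-source-unique : ∀ {σ₁ σ₂ ρ c r′ r} → Ring σ₁ ρ c r′ r → Ring σ₂ ρ c r′ r → σ₁ ≡ σ₂
    ring-source-unique {σ₁} {σ₂} {ρ} {c} {r′} {r} Rg₁ Rg₂ = ext σ₁ σ₂ agree
      where
      module R₁ = Ring Rg₁
      module R₂ = Ring Rg₂
      agree : ∀ c′ {i} → 1 ≤ i → i ≤ height c′ → entry σ₁ i c′ ≡ entry σ₂ i c′
      agree c′ {i} 1≤i i≤h with c′ Fₚ.≟ c
      ... | no c′≢c = trans (sym (R₁.rest i c′≢c)) (R₂.rest i c′≢c)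
      ... | yes refl with i <? r′
      ...   | yes i<r′ = trans (sym (R₁.below i<r′)) (R₂.below i<r′)
      ...   | no  i≮r′ with r <? i
      ...     | yes r<i = trans (sym (R₁.beyond r<i)) (R₂.beyond r<i)
      ...     | no  r≮i = nxt-injective (1≤entry σ₁ c 1≤i i≤h) (1≤entry σ₂ c 1≤i i≤h)
                (trans (sym (R₁.ring (≮⇒≥ i≮r′) (≮⇒≥ r≮i))) (R₂.ring (≮⇒≥ i≮r′) (≮⇒≥ r≮i)))

  length-filter : ∀ {A : Set} {p} {P : A → Set p} (P? : Decidable P) xs → L.length (filter P? xs) ≡ sum xs (λ x → ⟦ P? x ⟧)
  length-filter P? [] = refl
  length-filter P? (x ∷ xs) with P? x
  ... | yes _ = cong suc (length-filter P? xs)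
  ... | no  _ = length-filter P? xs

  -- Undoing a ringing path; `quinv` and `down` column by column.

  module Counting (Λ : Partition) (n : ℕ) .{{_ : NonZero n}} where
    open Tableaux Λ n
    open Fillings Λ n
    open Next n
    open Columns n

    sum-cells : ∀ {c ℓ} (M : CommutativeMonoid c ℓ) (let open CommutativeMonoid M) (f : Cell → Carrier) →
      Sums.sum M cells f ≈ Sums.sum M (allFin length) (λ c → Sums.sum M (allFin (height c)) (λ r → f (c , r)))
    sum-cells M f = M.trans (Sums.sum-concatMap M _ (allFin length) f)
      (Sums.sum-cong M (allFin length) (λ c → M.reflexive (Sums.sum-map M (c ,_) (allFin (height c)) f)))
      where module M = CommutativeMonoid M

    cyclicPred : ℕ → ℕ
    cyclicPred zero    = pred n
    cyclicPred (suc j) = j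

    cyclicPred<n : ∀ {j} → j < n → cyclicPred j < n
    cyclicPred<n {zero}  _   = ≤-reflexive (suc-pred n)
    cyclicPred<n {suc j} j<n = <⇒≤ j<n

    nxt-cyclicPred : ∀ {j} → j < n → nxt (suc (cyclicPred j)) ≡ suc j
    nxt-cyclicPred {zero}  _   = trans (cong nxt (suc-pred n)) nxt-n
    nxt-cyclicPred {suc j} j<n = nxt-suc (<⇒≢ j<n)

    decrement : Fin n → Fin n
    decrement k = fromℕ< (cyclicPred<n (Fₚ.toℕ<n k))

    nxt-decrement : ∀ k → nxt (suc (toℕ (decrement k))) ≡ suc (toℕ k)
    nxt-decrement k = trans (cong (nxt ∘ suc) (Fₚ.toℕ-fromℕ< _)) (nxt-cyclicPred (Fₚ.toℕ<n k))

    OnSegment : Column → ℕ → ℕ → Cell → Set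
    OnSegment c r′ r v = col v ≡ c × r′ ≤ row v × row v ≤ r

    onSegment? : ∀ c r′ r → Decidable (OnSegment c r′ r)
    onSegment? c r′ r v = col v Fₚ.≟ c ×-dec r′ ≤? row v ×-dec row v ≤? r

    module _ (ρ : Tab) (c : Column) (r′ r : ℕ) where

      lowerAt : (v : Cell) → Dec (OnSegment c r′ r v) → Fin n
      lowerAt v (yes _) = decrement (ρ ! v)
      lowerAt v (no _)  = ρ ! v

      lower : Tab
      lower = tabulate (λ v → lowerAt v (onSegment? c r′ r v))

      lower-on : ∀ v → OnSegment c r′ r v → lower ! v ≡ decrement (ρ ! v)
      lower-on v p = trans (tabulate-! _ v) (go (onSegment? c r′ r v))
        where
        go : (d : Dec (OnSegment c r′ r v)) → lowerAt v d ≡ decrement (ρ ! v)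
        go (yes _) = refl
        go (no ¬p) = contradiction p ¬p

      lower-off : ∀ v → ¬ OnSegment c r′ r v → lower ! v ≡ ρ ! v
      lower-off v ¬p = trans (tabulate-! _ v) (go (onSegment? c r′ r v))
        where
        go : (d : Dec (OnSegment c r′ r v)) → lowerAt v d ≡ ρ ! v
        go (yes p) = contradiction p ¬p
        go (no _)  = refl

    module _ (ρ : Tab) (c : Column) where

      -- Finds the lower end of the run of consecutive entries that ends in row `suc k`: the run
      -- ending one row lower is prolonged, or a new one begins. The last component says that it
      -- cannot be continued downwards.
      runStart : ∀ k (let r = suc k) → ∃ λ r′ → 1 ≤ r′ × r′ ≤ r
        × (∀ {i} → r′ ≤ i → i < r → entry ρ (suc i) c ≡ nxt (entry ρ i c))
        × (r′ ≡ 1 ⊎ entry ρ r′ c ≢ nxt (entry ρ (pred r′) c))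
      runStart zero = 1 , ≤-refl , ≤-refl , (λ 1≤i i<1 → contradiction 1≤i (<⇒≱ i<1)) , inj₁ refl
      runStart (suc k) with entry ρ (2 + k) c ≟ nxt (entry ρ (1 + k) c) | runStart k
      ... | no ne  | _ = 2 + k , s≤s z≤n , ≤-refl , (λ r<i i<r → contradiction r<i (<⇒≱ i<r)) , inj₂ ne
      ... | yes eq | r′ , 1≤r′ , r′≤r , linked , stop = r′ , 1≤r′ , m≤n⇒m≤1+n r′≤r , linked′ , stop
        where
        linked′ : ∀ {i} → r′ ≤ i → i < 2 + k → entry ρ (suc i) c ≡ nxt (entry ρ i c)
        linked′ r′≤i (s≤s i≤r) with m≤n⇒m<n∨m≡n i≤r
        ... | inj₁ i<r  = linked r′≤i i<r
        ... | inj₂ refl = eq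

      -- The run of `ρ` that ends in row `r` is lowered by one. Its maximality downwards gives
      -- `bottom`, and the hypothesis on the entry above gives `top`.
      ring-exists : ∀ {r} → 1 ≤ r → r ≤ height c → entry ρ (suc r) c ≢ entry ρ r c →
        ∃₂ λ σ r′ → Ring σ ρ c r′ r
      ring-exists {r@(suc k)} 1≤r r≤h ne with r′ , 1≤r′ , r′≤r , linkedρ , stop ← runStart k =
        lower ρ c r′ r , r′ , record
          { fits = r≤h
          ; rest = λ {c′} i c′≢c → entry-≡ ρ σ c′ i (λ v colv _ → sym (lower-off ρ c r′ r v (λ (eq , _) → c′≢c (trans (sym colv) eq))))
          ; rings = record
            { 1≤r′ = 1≤r′ ; r′≤r = r′≤r ; ring = ring ; below = below ; beyond = beyond
            ; linked = λ r′≤i i<r → nxt-injective (1≤entry σ c (s≤s z≤n) (≤-trans i<r r≤h)) (1≤nxt _)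
                (trans (sym (ring (m≤n⇒m≤1+n r′≤i) i<r)) (trans (linkedρ r′≤i i<r) (cong nxt (ring r′≤i (<⇒≤ i<r)))))
            ; top = λ eq → ne (trans (beyond ≤-refl) (trans eq (sym (ring r′≤r ≤-refl))))
            ; bottom = bottom stop
            }
          }
        where
        σ : Tab
        σ = lower ρ c r′ r
        ring : ∀ {i} → r′ ≤ i → i ≤ r → entry ρ i c ≡ nxt (entry σ i c)
        ring {i} r′≤i i≤r with v , colv , rowv , at ← entry-cell c (≤-trans 1≤r′ r′≤i) (≤-trans i≤r r≤h) = begin
          entry ρ i c                          ≡⟨ at ρ ⟩
          suc (toℕ (ρ ! v))                    ≡⟨ nxt-decrement (ρ ! v) ⟨
          nxt (suc (toℕ (decrement (ρ ! v))))  ≡⟨ cong (nxt ∘ suc ∘ toℕ) (lower-on ρ c r′ r v (colv , subst (r′ ≤_) (sym rowv) r′≤i , subst (_≤ r) (sym rowv) i≤r)) ⟨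
          nxt (suc (toℕ (σ ! v)))              ≡⟨ cong nxt (at σ) ⟨
          nxt (entry σ i c)                    ∎
          where open ≡-Reasoning
        below : ∀ {i} → i < r′ → entry ρ i c ≡ entry σ i c
        below {i} i<r′ = entry-≡ ρ σ c i (λ v _ rowv → sym (lower-off ρ c r′ r v (λ (_ , le , _) → <⇒≱ i<r′ (subst (r′ ≤_) rowv le))))
        beyond : ∀ {i} → r < i → entry ρ i c ≡ entry σ i c
        beyond {i} r<i = entry-≡ ρ σ c i (λ v _ rowv → sym (lower-off ρ c r′ r v (λ (_ , _ , le) → <⇒≱ r<i (subst (_≤ r) rowv le))))
        bottom : r′ ≡ 1 ⊎ entry ρ r′ c ≢ nxt (entry ρ (pred r′) c) → entry σ (pred r′) c ≢ entry σ r′ c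
        bottom (inj₁ r′≡1) eq = <⇒≢ (1≤entry σ c 1≤r′ (≤-trans r′≤r r≤h)) (trans (sym (cong (λ k → entry σ (pred k) c) r′≡1)) eq)
        bottom (inj₂ stop) eq = stop (trans (ring ≤-refl r′≤r) (cong nxt (trans (sym eq) (sym (below (pred< 1≤r′))))))
          where
          pred< : ∀ {k} → 1 ≤ k → pred k < k
          pred< (s≤s _) = ≤-refl

    -- quinv and down, column by column

    -- Heights decrease to the right, so the right column alone determines the rows in which both
    -- are present.
    columnPair : Tab → Column → Column → ℕ
    columnPair σ c c′ = pairs (column σ c) (column σ c′) (height c′) when (c Fₚ.<? c′)

    quinv-columns : ∀ σ → quinv σ ≡ Σᶜ (λ c → Σᶜ (columnPair σ c))
    quinv-columns σ = begin
      quinv σ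
        ≡⟨ length-filter (quinvPair? σ) (cartesianProduct cells cells) ⟩
      sum (cartesianProduct cells cells) (λ p → ⟦ quinvPair? σ p ⟧)
        ≡⟨ sum-cartesianProduct cells cells (λ p → ⟦ quinvPair? σ p ⟧) ⟩
      sum cells (λ u → sum cells (λ v → ind u v))
        ≡⟨ sum-cong cells (λ u → sum-cells +-0-commutativeMonoid (ind u)) ⟩
      sum cells (λ u → Σᶜ (λ c′ → sum (allFin (height c′)) (λ r′ → ind u (c′ , r′))))
        ≡⟨ sum-cells +-0-commutativeMonoid _ ⟩
      Σᶜ (λ c → sum (allFin (height c)) (λ r → Σᶜ (λ c′ → sum (allFin (height c′)) (λ r′ → ind (c , r) (c′ , r′)))))
        ≡⟨ sum-cong (allFin length) (λ c → trans (sum-comm (allFin (height c)) (allFin length) _) (sum-cong (allFin length) (perPair c))) ⟩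
      Σᶜ (λ c → Σᶜ (columnPair σ c)) ∎
      where
      open ≡-Reasoning
      ind : Cell → Cell → ℕ
      ind u v = ⟦ quinvPair? σ (u , v) ⟧
      perPair : ∀ c c′ → sum (allFin (height c)) (λ r → sum (allFin (height c′)) (λ r′ → ind (c , r) (c′ , r′))) ≡ columnPair σ c c′
      -- The rows of the shorter column `c′` become the outer index: each of them has exactly one
      -- partner in `c`.
      perPair c c′ = trans (sum-comm (allFin (height c)) (allFin (height c′)) _) (go (c Fₚ.<? c′))
        where
        go : (d : Dec (c F.< c′)) → sum (allFin (height c′)) (λ r′ → sum (allFin (height c)) (λ r → ind (c , r) (c′ , r′)))
          ≡ (pairs (column σ c) (column σ c′) (height c′) when d)
        go (no c≮c′) = sum-ε (allFin (height c′)) (λ {r′} _ → sum-ε (allFin (height c)) (λ {r} _ →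
          ⟦⟧-no (quinvPair? σ ((c , r) , (c′ , r′))) (λ (_ , c<c′ , _) → c≮c′ c<c′)))
        go (yes c<c′) = sum-cong (allFin (height c′)) row-sum
          where
          row-sum : ∀ r′ → sum (allFin (height c)) (λ r → ind (c , r) (c′ , r′)) ≡ pair (column σ c) (column σ c′) (toℕ r′)
          row-sum r′ = trans (sum-delta Fₚ._≟_ {v = r} (λ r → ind (c , r) (c′ , r′)) (allFin⁺ (height c)) (∈-allFin r)
              (λ r₁ r₁≢r → ⟦⟧-no (quinvPair? σ ((c , r₁) , (c′ , r′))) (λ (eq , _) → r₁≢r (Fₚ.toℕ-injective (trans (suc-injective eq) (sym r≡r′))))))
            (trans (⟦⟧-cong (quinvPair? σ ((c , r) , (c′ , r′)))
                (𝒬? (column σ c (2 + toℕ r′)) (column σ c (1 + toℕ r′)) (column σ c′ (1 + toℕ r′)))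
                (λ (_ , _ , Q) → subst (λ k → 𝒬 (column σ c (2 + k)) (column σ c (1 + k)) (column σ c′ (1 + toℕ r′))) r≡r′ Q)
                (λ Q → cong suc r≡r′ , c<c′ , subst (λ k → 𝒬 (column σ c (2 + k)) (column σ c (1 + k)) (column σ c′ (1 + toℕ r′))) (sym r≡r′) Q))
              (sym (q-def (column σ c (2 + toℕ r′)) (column σ c (1 + toℕ r′)) (column σ c′ (1 + toℕ r′)))))
            where
            r<h : toℕ r′ < height c
            r<h = <-≤-trans (Fₚ.toℕ<n r′) (decreasing (<⇒≤ c<c′))
            r : Fin (height c)
            r = fromℕ< r<h
            r≡r′ : toℕ r ≡ toℕ r′
            r≡r′ = Fₚ.toℕ-fromℕ< r<h

    -- For a cell in row r, `down` is the case p = r, p′ = r - 1 and `up` the case p = r + 1, p′ =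
    -- r.
    arm : Tab → Column → ℕ → ℕ → ℕ → Column → ℕ
    arm σ c p p′ a j = (⟦ entry σ p j ≟ a ⟧ when (j Fₚ.<? c)) + (⟦ entry σ p′ j ≟ a ⟧ when (c Fₚ.<? j))

    -- The analogue of down for the inverse of the ringing path map.
    up : Tab → Column → ℕ → ℕ
    up σ c r = Σᶜ (arm σ c (suc r) r (entry σ r c))

    -- `k` may be 0 or exceed the height: then no cell matches, and `entry` is 0 and so differs from
    -- `a`. This absorbs the boundary cases of the arm.
    count-row : ∀ σ j k {a p} {P : Fin (height j) → Set p} (P? : Decidable P) → 1 ≤ a →
      (∀ {r} → P r → suc (toℕ r) ≡ k × entry σ k j ≡ a) →
      (∀ {r} → suc (toℕ r) ≡ k → entry σ k j ≡ a → P r) →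
      sum (allFin (height j)) (λ r → ⟦ P? r ⟧) ≡ ⟦ entry σ k j ≟ a ⟧
    count-row σ j zero P? 1≤a to from = trans (sum-ε (allFin (height j)) (λ {r} _ → ⟦⟧-no (P? r) (λ Pr → contradiction (proj₁ (to Pr)) λ ())))
      (sym (⟦⟧-no (0 ≟ _) (<⇒≢ 1≤a)))
    count-row σ j k@(suc i) {a} P? 1≤a to from = go (i <? height j)
      where
      go : Dec (i < height j) → sum (allFin (height j)) (λ r → ⟦ P? r ⟧) ≡ ⟦ entry σ k j ≟ a ⟧
      go (no i≮h) = trans (sum-ε (allFin (height j)) (λ {r} _ → ⟦⟧-no (P? r) (λ Pr → i≮h (subst (_≤ height j) (proj₁ (to Pr)) (Fₚ.toℕ<n r)))))
        (sym (⟦⟧-no (entry σ k j ≟ a) (λ eq → <⇒≢ 1≤a (trans (sym (entry-above σ j (s≤s (≮⇒≥ i≮h)))) eq))))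
      go (yes i<h) = trans (sum-delta Fₚ._≟_ {v = r₀} (λ r → ⟦ P? r ⟧) (allFin⁺ (height j)) (∈-allFin r₀)
          (λ r r≢ → ⟦⟧-no (P? r) (λ Pr → r≢ (Fₚ.toℕ-injective (trans (suc-injective (proj₁ (to Pr))) (sym (Fₚ.toℕ-fromℕ< i<h)))))))
        (⟦⟧-cong (P? r₀) (entry σ k j ≟ a) (proj₂ ∘ to) (from (cong suc (Fₚ.toℕ-fromℕ< i<h))))
        where
        r₀ : Fin (height j)
        r₀ = fromℕ< i<h

    down-columns : ∀ σ u → down σ u ≡ Σᶜ (arm σ (col u) (row u) (pred (row u)) (value σ u))
    down-columns σ u@(c , _) = trans (length-filter _ cells) (trans (sum-cells +-0-commutativeMonoid _)
      (sum-cong (allFin length) perColumn))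
      where
      a : ℕ
      a = value σ u
      1≤a : 1 ≤ a
      1≤a = 1≤entry σ c (1≤row u) (row≤height u)
      InArm∧≡? : ∀ y → Dec (InArm u y × value σ y ≡ a)
      InArm∧≡? y = inArm? u y ×-dec (value σ y ≟ a)
      perColumn : ∀ j → sum (allFin (height j)) (λ r → ⟦ InArm∧≡? (j , r) ⟧) ≡ arm σ c (row u) (pred (row u)) a j
      perColumn j with Fₚ.<-cmp j c
      ... | tri≈ j≮c _ c≮j = trans
              (sum-ε (allFin (height j)) (λ {r} _ → ⟦⟧-no (InArm∧≡? (j , r)) λ { (inj₁ (_ , j<c) , _) → j≮c j<c ; (inj₂ (_ , c<j) , _) → c≮j c<j }))
              (sym (cong₂ _+_ (when-no (j Fₚ.<? c) j≮c) (when-no (c Fₚ.<? j) c≮j)))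
      ... | tri< j<c _ c≮j = trans
              (count-row σ j (row u) (λ r → InArm∧≡? (j , r)) 1≤a
                (λ { (inj₁ (eq , _) , v≡a) → eq , trans (cong (λ k → entry σ k j) (sym eq)) v≡a ; (inj₂ (_ , c<j) , _) → contradiction c<j c≮j })
                (λ eq v≡a → inj₁ (eq , j<c) , trans (cong (λ k → entry σ k j) eq) v≡a))
              (sym (trans (cong₂ _+_ (when-yes (j Fₚ.<? c) j<c) (when-no (c Fₚ.<? j) c≮j)) (+-identityʳ _)))
      ... | tri> j≮c _ c<j = trans
              (count-row σ j (pred (row u)) (λ r → InArm∧≡? (j , r)) 1≤a
                (λ { (inj₁ (_ , j<c) , _) → contradiction j<c j≮c ; (inj₂ (eq , _) , v≡a) → suc-injective eq , trans (cong (λ k → entry σ k j) (sym (suc-injective eq))) v≡a })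
                (λ eq v≡a → inj₂ (cong suc eq , c<j) , trans (cong (λ k → entry σ k j) eq) v≡a))
              (sym (cong₂ _+_ (when-no (j Fₚ.<? c) j≮c) (when-yes (c Fₚ.<? j) c<j)))

    sameHeightRight sameHeightLeft : Column → ℕ
    sameHeightRight c = Σᶜ (λ j → ⟦ height j ≟ height c ⟧ when (c Fₚ.<? j))
    sameHeightLeft  c = Σᶜ (λ j → ⟦ height j ≟ height c ⟧ when (j Fₚ.<? c))

    Wraps : Tab → Column → ℕ → Set
    Wraps σ c r = r ≡ height c × entry σ r c ≡ n

    module _ {σ ρ c r′ r} (Rg : Ring σ ρ c r′ r) where
      open Ring Rg

      private
        Kʳ Kˡ α β : Column → ℕ
        -- The defects left over by `ring-right` and `ring-left`, one for each column.
        Kʳ j = (κ (entry σ (suc r) c) (entry σ r c) when (r ≤? height j)) when (c Fₚ.<? j)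
        Kˡ j = κ (entry σ (suc r) j) (entry σ r c) when (j Fₚ.<? c)
        α j = arm σ c r′ (pred r′) (entry σ r′ c) j + Kʳ j
        β j = arm ρ c (suc r) r (entry ρ r c) j + Kˡ j

        diagonal : ∀ τ ρ → columnPair τ c c ≡ columnPair ρ c c
        diagonal τ ρ = trans (when-no (c Fₚ.<? c) (Fₚ.<-irrefl refl)) (sym (when-no (c Fₚ.<? c) (Fₚ.<-irrefl refl)))

        off : ∀ {j k} → j ≢ c → k ≢ c → columnPair σ j k ≡ columnPair ρ j k
        off {j} {k} j≢c k≢c = cong (_when (j Fₚ.<? k))
          (pairs-cong (column σ j) (column ρ j) (column σ k) (column ρ k) (height k) (λ i → sym (rest i j≢c)) (λ i → sym (rest i k≢c)))

        cross : ∀ {j} → j ≢ c → columnPair σ j c + columnPair σ c j + α j ≡ columnPair ρ j c + columnPair ρ c j + β j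
        cross {j} j≢c with Fₚ.<-cmp j c
        ... | tri≈ _ j≡c _ = contradiction j≡c j≢c
        ... | tri< j<c _ c≮j = begin
          columnPair σ j c + columnPair σ c j + α j
            ≡⟨ cong₂ _+_ (cong₂ _+_ (when-yes (j Fₚ.<? c) j<c) (when-no (c Fₚ.<? j) c≮j))
                 (cong₂ _+_ (cong₂ _+_ (when-yes (j Fₚ.<? c) j<c) (when-no (c Fₚ.<? j) c≮j)) (when-no (c Fₚ.<? j) c≮j)) ⟩
          P + 0 + (⟦ entry σ r′ j ≟ entry σ r′ c ⟧ + 0 + 0)
            ≡⟨ tidy P _ ⟩
          P + ⟦ entry σ r′ j ≟ entry σ r′ c ⟧
            ≡⟨ ring-left rings (filled σ j) (filled σ c) fits (decreasing (<⇒≤ j<c)) ⟩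
          pairs (column σ j) (column ρ c) (height c) + (⟦ entry σ (suc r) j ≟ entry ρ r c ⟧ + κ (entry σ (suc r) j) (entry σ r c))
            ≡⟨ cong₂ _+_ (pairs-cong (column σ j) (column ρ j) (column ρ c) (column ρ c) (height c) (λ i → sym (rest i j≢c)) (λ _ → refl))
                 (cong (_+ κ (entry σ (suc r) j) (entry σ r c)) (cong (λ x → ⟦ x ≟ entry ρ r c ⟧) (sym (rest (suc r) j≢c)))) ⟩
          P′ + (⟦ entry ρ (suc r) j ≟ entry ρ r c ⟧ + κ (entry σ (suc r) j) (entry σ r c))
            ≡⟨ tidy′ P′ ⟦ entry ρ (suc r) j ≟ entry ρ r c ⟧ (κ (entry σ (suc r) j) (entry σ r c)) ⟨
          P′ + 0 + (⟦ entry ρ (suc r) j ≟ entry ρ r c ⟧ + 0 + κ (entry σ (suc r) j) (entry σ r c))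
            ≡⟨ cong₂ _+_ (cong₂ _+_ (when-yes (j Fₚ.<? c) j<c) (when-no (c Fₚ.<? j) c≮j))
                 (cong₂ _+_ (cong₂ _+_ (when-yes (j Fₚ.<? c) j<c) (when-no (c Fₚ.<? j) c≮j)) (when-yes (j Fₚ.<? c) j<c)) ⟨
          columnPair ρ j c + columnPair ρ c j + β j ∎
          where
          open ≡-Reasoning
          P P′ : ℕ
          P  = pairs (column σ j) (column σ c) (height c)
          P′ = pairs (column ρ j) (column ρ c) (height c)
          tidy : ∀ p a → p + 0 + (a + 0 + 0) ≡ p + a
          tidy = solve-∀
          tidy′ : ∀ p a k → p + 0 + (a + 0 + k) ≡ p + (a + k)
          tidy′ = solve-∀
        ... | tri> j≮c _ c<j = begin
          columnPair σ j c + columnPair σ c j + α j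
            ≡⟨ cong₂ _+_ (cong₂ _+_ (when-no (j Fₚ.<? c) j≮c) (when-yes (c Fₚ.<? j) c<j))
                 (cong₂ _+_ (cong₂ _+_ (when-no (j Fₚ.<? c) j≮c) (when-yes (c Fₚ.<? j) c<j)) (when-yes (c Fₚ.<? j) c<j)) ⟩
          P + (⟦ entry σ (pred r′) j ≟ entry σ r′ c ⟧ + (κ (entry σ (suc r) c) (entry σ r c) when (r ≤? height j)))
            ≡⟨ ring-right rings (filled σ j) (filled σ c) fits (decreasing (<⇒≤ c<j)) ⟩
          pairs (column ρ c) (column σ j) (height j) + ⟦ entry σ r j ≟ entry ρ r c ⟧
            ≡⟨ cong₂ _+_ (pairs-cong (column ρ c) (column ρ c) (column σ j) (column ρ j) (height j) (λ _ → refl) (λ i → sym (rest i j≢c))) (cong (λ x → ⟦ x ≟ entry ρ r c ⟧) (sym (rest r j≢c))) ⟩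
          P′ + ⟦ entry ρ r j ≟ entry ρ r c ⟧
            ≡⟨ cong (P′ +_) (+-identityʳ _) ⟨
          P′ + (⟦ entry ρ r j ≟ entry ρ r c ⟧ + 0)
            ≡⟨ cong₂ _+_ (cong₂ _+_ (when-no (j Fₚ.<? c) j≮c) (when-yes (c Fₚ.<? j) c<j))
                 (cong₂ _+_ (cong₂ _+_ (when-no (j Fₚ.<? c) j≮c) (when-yes (c Fₚ.<? j) c<j)) (when-no (j Fₚ.<? c) j≮c)) ⟨
          columnPair ρ j c + columnPair ρ c j + β j ∎
          where
          open ≡-Reasoning
          P P′ : ℕ
          P  = pairs (column σ c) (column σ j) (height j)
          P′ = pairs (column ρ c) (column ρ j) (height j)

        α≡β : α c ≡ β c
        α≡β = trans (cong₂ _+_ (cong₂ _+_ (when-no (c Fₚ.<? c) c≮c) (when-no (c Fₚ.<? c) c≮c)) (when-no (c Fₚ.<? c) c≮c))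
          (sym (cong₂ _+_ (cong₂ _+_ (when-no (c Fₚ.<? c) c≮c) (when-no (c Fₚ.<? c) c≮c)) (when-no (c Fₚ.<? c) c≮c)))
          where
          c≮c : ¬ (c F.< c)
          c≮c = Fₚ.<-irrefl refl

        armσ armρ : ℕ
        armσ = Σᶜ (arm σ c r′ (pred r′) (entry σ r′ c))
        armρ = up ρ c r

      -- Columns to the left contribute by `ring-left`, those to the right by `ring-right`. Their
      -- end terms add up to the two arms.
      ring-quinv : quinv σ + (armσ + Σᶜ Kʳ) ≡ quinv ρ + (armρ + Σᶜ Kˡ)
      ring-quinv = begin
        quinv σ + (armσ + Σᶜ Kʳ)                  ≡⟨ cong₂ _+_ (quinv-columns σ) (sym (sum-∙ (allFin length) _ Kʳ)) ⟩
        Σᶜ (λ j → Σᶜ (columnPair σ j)) + Σᶜ α     ≡⟨ sum-cross c (columnPair σ) (columnPair ρ) α β off cross (cong₂ _+_ (diagonal σ ρ) α≡β) ⟩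
        Σᶜ (λ j → Σᶜ (columnPair ρ j)) + Σᶜ β     ≡⟨ cong₂ _+_ (quinv-columns ρ) (sym (sum-∙ (allFin length) _ Kˡ)) ⟨
        quinv ρ + (armρ + Σᶜ Kˡ)                  ∎
        where open ≡-Reasoning

      private
        Kʳ-plain : ¬ Wraps σ c r → Σᶜ Kʳ ≡ 0
        Kʳ-plain ¬w = sum-ε (allFin length) (λ {j} _ → go (c Fₚ.<? j) (r ≤? height j) )
          where
          κ≡0 : κ (entry σ (suc r) c) (entry σ r c) ≡ 0
          κ≡0 with m≤n⇒m<n∨m≡n fits
          ... | inj₁ r<h = κ-positive (1≤entry σ c (s≤s z≤n) r<h)
          ... | inj₂ refl rewrite entry-above σ c {suc (height c)} ≤-refl = ⟦⟧-no (entry σ r c ≟ n) (λ eq → ¬w (refl , eq))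
          go : ∀ {p q} {P : Set p} {Q : Set q} (d : Dec P) (e : Dec Q) → ((κ (entry σ (suc r) c) (entry σ r c) when e) when d) ≡ 0
          go (yes _) (yes _) = κ≡0
          go (yes _) (no _)  = refl
          go (no _)  _       = refl

        Kˡ-plain : ¬ Wraps σ c r → Σᶜ Kˡ ≡ 0
        Kˡ-plain ¬w = sum-ε (allFin length) (λ {j} _ → go j (j Fₚ.<? c))
          where
          κ≡0 : ∀ j → height c ≤ height j → κ (entry σ (suc r) j) (entry σ r c) ≡ 0
          κ≡0 j h≤ = by-height (r <? height j)
            where
            by-height : Dec (r < height j) → κ (entry σ (suc r) j) (entry σ r c) ≡ 0
            by-height (yes r<h) = κ-positive (1≤entry σ j (s≤s z≤n) r<h)
            by-height (no r≮h) = trans (cong (λ x → κ x (entry σ r c)) (entry-above σ j (s≤s (≮⇒≥ r≮h))))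
              (⟦⟧-no (entry σ r c ≟ n) (λ eq → ¬w (≤-antisym fits (≤-trans h≤ (≮⇒≥ r≮h)) , eq)))
          go : ∀ j (d : Dec (j F.< c)) → (κ (entry σ (suc r) j) (entry σ r c) when d) ≡ 0
          go j (yes j<c) = κ≡0 j (decreasing (<⇒≤ j<c))
          go j (no _)    = refl

      ring-quinv-plain : ¬ Wraps σ c r → quinv σ + armσ ≡ quinv ρ + armρ
      ring-quinv-plain ¬w = begin
        quinv σ + armσ               ≡⟨ cong (quinv σ +_) (trans (cong (armσ +_) (Kʳ-plain ¬w)) (+-identityʳ armσ)) ⟨
        quinv σ + (armσ + Σᶜ Kʳ)     ≡⟨ ring-quinv ⟩
        quinv ρ + (armρ + Σᶜ Kˡ)     ≡⟨ cong (quinv ρ +_) (trans (cong (armρ +_) (Kˡ-plain ¬w)) (+-identityʳ armρ)) ⟩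
        quinv ρ + armρ               ∎
        where open ≡-Reasoning

      -- When a top entry n turns, the defect is 1 against a right column that still reaches row
      -- `r`, and against a left column that already ends there. By the ordering of the heights,
      -- both mean equal height.
      ring-quinv-wraps : Wraps σ c r → quinv σ + (armσ + sameHeightRight c) ≡ quinv ρ + (armρ + sameHeightLeft c)
      ring-quinv-wraps (refl , eqn) = begin
        quinv σ + (armσ + sameHeightRight c)  ≡⟨ cong (λ k → quinv σ + (armσ + k)) (sum-cong (allFin length) (λ j → goʳ j (c Fₚ.<? j))) ⟨
        quinv σ + (armσ + Σᶜ Kʳ)              ≡⟨ ring-quinv ⟩
        quinv ρ + (armρ + Σᶜ Kˡ)              ≡⟨ cong (λ k → quinv ρ + (armρ + k)) (sum-cong (allFin length) (λ j → goˡ j (j Fₚ.<? c))) ⟩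
        quinv ρ + (armρ + sameHeightLeft c)   ∎
        where
        open ≡-Reasoning
        κ≡1 : κ 0 (entry σ r c) ≡ 1
        κ≡1 = ⟦⟧-yes (entry σ r c ≟ n) eqn
        goʳ : ∀ j (d : Dec (c F.< j)) → ((κ (entry σ (suc r) c) (entry σ r c) when (r ≤? height j)) when d) ≡ (⟦ height j ≟ height c ⟧ when d)
        goʳ j (no _) = refl
        goʳ j (yes c<j) = when-cong (r ≤? height j) (height j ≟ height c)
          (λ h≤ → ≤-antisym (decreasing (<⇒≤ c<j)) h≤) (λ eq → ≤-reflexive (sym eq))
          (λ _ → trans (cong (λ x → κ x (entry σ r c)) (entry-above σ c ≤-refl)) κ≡1)
        goˡ : ∀ j (d : Dec (j F.< c)) → (κ (entry σ (suc r) j) (entry σ r c) when d) ≡ (⟦ height j ≟ height c ⟧ when d)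
        goˡ j (no _) = refl
        goˡ j (yes j<c) with height j ≟ height c
        ... | yes eq = trans (cong (λ x → κ x (entry σ r c)) (entry-above σ j (s≤s (≤-reflexive eq))))
                         (trans κ≡1 (sym (⟦⟧-yes (height j ≟ height c) eq)))
        ... | no  ne = trans (κ-positive (1≤entry σ j (s≤s z≤n) (≤∧≢⇒< (decreasing (<⇒≤ j<c)) (ne ∘ sym)))) (sym (⟦⟧-no (height j ≟ height c) ne))

  ⟦⟧≡1⇒ : ∀ {p} {P : Set p} (d : Dec P) → ⟦ d ⟧ ≡ 1 → P
  ⟦⟧≡1⇒ (yes p) _ = p

  count-interval : ∀ ℓ {lo hi} → lo ≤ hi → hi ≤ ℓ →
    sumFin ℓ (λ i → ⟦ lo ≤? i ×-dec i <? hi ⟧) + lo ≡ hi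
  count-interval ℓ {lo} {hi} lo≤hi hi≤ℓ = begin
    sumFin ℓ F + lo            ≡⟨ cong (sumFin ℓ F +_) (m≥n⇒m⊔n≡m {lo} {0 ⊓ hi} z≤n) ⟨
    sumFin ℓ F + ψ 0           ≡⟨ telescopeFin ℓ F (λ _ → 0) ψ (λ {i} _ → step i) ⟩
    sumFin ℓ (λ _ → 0) + ψ ℓ   ≡⟨ cong₂ _+_ (sum-ε (allFin ℓ) (λ _ → refl)) (trans (cong (lo ⊔_) (m≥n⇒m⊓n≡n hi≤ℓ)) (m≤n⇒m⊔n≡n lo≤hi)) ⟩
    hi                         ∎
    where
    open ≡-Reasoning
    F ψ : ℕ → ℕ
    F i = ⟦ lo ≤? i ×-dec i <? hi ⟧
    -- The point `i` clamped to the segment from `lo` to `hi`; it advances exactly at the points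
    -- counted.
    ψ i = lo ⊔ (i ⊓ hi)
    step : ∀ i → F i + ψ i ≡ ψ (suc i)
    step i = by (lo ≤? i) (i <? hi)
      where
      outside : ¬ (lo ≤ i × i < hi) → F i + ψ i ≡ ψ i
      outside ¬p = cong (_+ ψ i) (⟦⟧-no (lo ≤? i ×-dec i <? hi) ¬p)
      by : Dec (lo ≤ i) → Dec (i < hi) → F i + ψ i ≡ ψ (suc i)
      by (no lo≰i) _ = trans (outside (lo≰i ∘ proj₁))
        (trans (m≥n⇒m⊔n≡m (≤-trans (m⊓n≤m i hi) (<⇒≤ (≰⇒> lo≰i)))) (sym (m≥n⇒m⊔n≡m (≤-trans (m⊓n≤m (suc i) hi) (≰⇒> lo≰i)))))
      by (yes lo≤i) (no i≮hi) = trans (outside (i≮hi ∘ proj₂))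
        (trans (cong (lo ⊔_) (m≥n⇒m⊓n≡n (≮⇒≥ i≮hi))) (sym (cong (lo ⊔_) (m≥n⇒m⊓n≡n (m≤n⇒m≤1+n (≮⇒≥ i≮hi))))))
      by (yes lo≤i) (yes i<hi) = trans (cong (_+ ψ i) (⟦⟧-yes (lo ≤? i ×-dec i <? hi) (lo≤i , i<hi)))
        (trans (cong suc (trans (cong (lo ⊔_) (m≤n⇒m⊓n≡m (<⇒≤ i<hi))) (m≤n⇒m⊔n≡n lo≤i)))
              (sym (trans (cong (lo ⊔_) (m≤n⇒m⊓n≡m i<hi)) (m≤n⇒m⊔n≡n (m≤n⇒m≤1+n lo≤i)))))

  EquallyOrdered : (x y a b : ℕ) → Set
  EquallyOrdered x y a b = (𝒬 x a b → 𝒬 y a b) × (𝒬 y a b → 𝒬 x a b)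

  module _ (x y a b : ℕ) where

    private
      fromDec : ∀ {P Q : Set} (d : Dec P) (e : Dec Q) → ¬ ((P → Q) × (Q → P)) → ⟦ d ⟧ + ⟦ e ⟧ ≡ 1
      fromDec (yes p) (yes q) ¬b = contradiction ((λ _ → q) , (λ _ → p)) ¬b
      fromDec (yes p) (no ¬q) ¬b = refl
      fromDec (no ¬p) (yes q) ¬b = refl
      fromDec (no ¬p) (no ¬q) ¬b = contradiction ((λ p → contradiction p ¬p) , (λ q → contradiction q ¬q)) ¬b

      odd : ∀ k → k + k ≢ 1
      odd (suc (suc k)) ()
      odd (suc zero)    ()

    equal⇒ : EquallyOrdered x y a b → q x a b ≡ q y a b
    equal⇒ (to , from) = trans (q-def x a b) (trans (⟦⟧-cong (𝒬? x a b) (𝒬? y a b) to from) (sym (q-def y a b)))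

    ⇒equal : q x a b ≡ q y a b → EquallyOrdered x y a b
    ⇒equal eq = (λ p → ⟦⟧≡1⇒ (𝒬? y a b) (trans (sym eq′) (⟦⟧-yes (𝒬? x a b) p)))
              , (λ p → ⟦⟧≡1⇒ (𝒬? x a b) (trans eq′ (⟦⟧-yes (𝒬? y a b) p)))
      where
      eq′ : ⟦ 𝒬? x a b ⟧ ≡ ⟦ 𝒬? y a b ⟧
      eq′ = trans (sym (q-def x a b)) (trans eq (q-def y a b))

    unequal⇒ : ¬ EquallyOrdered x y a b → q x a b + q y a b ≡ 1
    unequal⇒ ¬b = trans (cong₂ _+_ (q-def x a b) (q-def y a b)) (fromDec (𝒬? x a b) (𝒬? y a b) ¬b)

    ⇒unequal : q x a b + q y a b ≡ 1 → ¬ EquallyOrdered x y a b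
    ⇒unequal one same = odd (q y a b) (trans (cong (_+ q y a b) (sym (equal⇒ same))) one)

  module Threshold {P : ℕ → Set} (P? : Decidable P) {h : ℕ} (1≤h : 1 ≤ h) where

    threshold : ℕ
    threshold = maxFiltered P? 1 2 (suc h)

    1≤threshold : 1 ≤ threshold
    1≤threshold = default≤maxFiltered P? 1 2 (suc h)

    threshold≤h : threshold ≤ h
    threshold≤h with maxFiltered-sel P? 1 2 (suc h)
    ... | inj₁ eq           = subst (_≤ h) (sym eq) 1≤h
    ... | inj₂ (_ , ≤h , _) = ≤-pred ≤h

    at-threshold : ∀ {k} → threshold ≡ 2 + k → P (2 + k)
    at-threshold eq with maxFiltered-sel P? 1 2 (suc h)
    ... | inj₁ eq₁         = contradiction (trans (sym eq₁) eq) λ ()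
    ... | inj₂ (_ , _ , p) = subst P eq p

    above-threshold : ∀ {k} → threshold ≤ k → k < h → ¬ P (suc k)
    above-threshold m≤k k<h p = n≮n _ (≤-trans (s≤s m≤k)
      (≤maxFiltered P? 1 2 (suc h) (s≤s (≤-trans 1≤threshold m≤k)) (s≤s k<h) p))

    -- Characterises the threshold without reference to the list behind it; this shows that τ does
    -- not change r_max.
    threshold-unique : ∀ {m} → 1 ≤ m → m ≤ h → (∀ {k} → m ≡ 2 + k → P (2 + k)) →
      (∀ {k} → m ≤ k → k < h → ¬ P (suc k)) → threshold ≡ m
    threshold-unique {m} 1≤m m≤h at above = ≤-antisym (≮⇒≥ m≮t) (≮⇒≥ t≮m)
      where
      above-one : ∀ {a b} → 1 ≤ a → a < b → ∃ λ l → b ≡ 2 + l × a ≤ suc l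
      above-one {b = suc zero}    1≤a (s≤s a≤0) = contradiction 1≤a (<⇒≱ (s≤s a≤0))
      above-one {b = suc (suc l)} 1≤a (s≤s a≤l) = l , refl , a≤l
      m≮t : ¬ (m < threshold)
      m≮t m<t with l , eq , m≤l ← above-one 1≤m m<t =
        above m≤l (subst (_≤ h) eq threshold≤h) (at-threshold eq)
      t≮m : ¬ (threshold < m)
      t≮m t<m with l , eq , t≤l ← above-one 1≤threshold t<m =
        above-threshold t≤l (subst (_≤ h) eq m≤h) (at eq)

  -- The operators τ as exchanges above r_max.

  module Swapping (Λ : Partition) (n : ℕ) .{{_ : NonZero n}} where
    open Tableaux Λ n
    open Fillings Λ n
    open Counting Λ n
    open Next n
    open Columns n

    module Content {a ℓ} (M : CommutativeMonoid a ℓ) (X : Fin n → CommutativeMonoid.Carrier M) where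
      private
        module M = CommutativeMonoid M
        module S = Sums M

      content : Tab → M.Carrier
      content σ = S.sum cells (λ u → X (σ ! u))

      -- Extends `X` by the neutral element to the value 0, so that contents can be computed from
      -- the numerical columns.
      atEntry : ℕ → M.Carrier
      atEntry zero    = M.ε
      atEntry (suc k) with k <? n
      ... | yes k<n = X (fromℕ< k<n)
      ... | no  _   = M.ε

      atEntry-value : ∀ σ u → atEntry (value σ u) ≡ X (σ ! u)
      atEntry-value σ u = trans (cong atEntry (value-≡ σ u)) (at (σ ! u))
        where
        at : ∀ k → atEntry (suc (toℕ k)) ≡ X k
        at k with toℕ k <? n
        ... | yes k<n = cong X (Fₚ.fromℕ<-toℕ k k<n)
        ... | no  k≮n = contradiction (Fₚ.toℕ<n k) k≮n

      columnContent : Tab → Column → M.Carrier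
      columnContent σ c = S.sumFin (height c) (atEntry ∘ column σ c ∘ suc)

      content-columns : ∀ σ → content σ M.≈ S.sum (allFin length) (columnContent σ)
      content-columns σ = M.trans (sum-cells M _)
        (S.sum-cong (allFin length) (λ c → S.sum-cong (allFin (height c)) (λ r → M.reflexive (sym (atEntry-value σ (c , r))))))

      ring-content : ∀ {σ ρ c r′ r} → Ring σ ρ c r′ r →
        content ρ M.∙ atEntry (entry σ r′ c) M.≈ content σ M.∙ atEntry (entry ρ r c)
      ring-content {σ} {ρ} {c} Rg = M.trans (M.∙-congʳ (content-columns ρ)) (M.trans
        (S.sum-one {p = c} (columnContent ρ) (columnContent σ)
          (λ {j} j≢c → S.sumFin-cong (height j) (λ i _ → M.reflexive (cong atEntry (rest (suc i) j≢c))))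
          (ring-product rings M fits atEntry))
        (M.∙-congʳ (M.sym (content-columns σ))))
        where open Ring Rg

    -- Exchanging the upper parts of two columns

    record Swap (σ ρ : Tab) (c c′ : Column) (m : ℕ) : Set where
      field
        1≤m     : 1 ≤ m
        swapped : Swapped (height c) (column σ c) (column σ c′) (column ρ c) (column ρ c′) m
        rest    : ∀ {j} i → j ≢ c → j ≢ c′ → entry ρ i j ≡ entry σ i j
      open Swapped swapped public

    module _ (c c′ : Column) (eq : height c ≡ height c′) (m : ℕ) where

      exchange-first : ∀ {r} → m ≤ suc (toℕ r) → exchange c c′ eq m (c , r) ≡ (c′ , F.cast eq r)
      exchange-first {r} m≤ with m ≤? suc (toℕ r) | c Fₚ.≟ c | c Fₚ.≟ c′
      ... | yes _ | yes refl | _ = refl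
      ... | yes _ | no  c≢c  | _ = contradiction refl c≢c
      ... | no m≰ | _        | _ = contradiction m≤ m≰

      exchange-second : c ≢ c′ → ∀ {r} → m ≤ suc (toℕ r) → exchange c c′ eq m (c′ , r) ≡ (c , F.cast (sym eq) r)
      exchange-second c≢c′ {r} m≤ with m ≤? suc (toℕ r) | c′ Fₚ.≟ c | c′ Fₚ.≟ c′
      ... | yes _ | yes c′≡c | _        = contradiction (sym c′≡c) c≢c′
      ... | yes _ | no  _    | yes refl = refl
      ... | yes _ | no  _    | no  ne   = contradiction refl ne
      ... | no m≰ | _        | _        = contradiction m≤ m≰

      exchange-other : ∀ {j r} → j ≢ c → j ≢ c′ → exchange c c′ eq m (j , r) ≡ (j , r)
      exchange-other {j} {r} j≢c j≢c′ with m ≤? suc (toℕ r) | j Fₚ.≟ c | j Fₚ.≟ c′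
      ... | yes _ | yes j≡c | _        = contradiction j≡c j≢c
      ... | yes _ | no  _   | yes j≡c′ = contradiction j≡c′ j≢c′
      ... | yes _ | no  _   | no  _    = refl
      ... | no  _ | _       | _        = refl

      exchange-low : ∀ {j r} → suc (toℕ r) < m → exchange c c′ eq m (j , r) ≡ (j , r)
      exchange-low {j} {r} <m with m ≤? suc (toℕ r) | j Fₚ.≟ c | j Fₚ.≟ c′
      ... | yes m≤ | _ | _ = contradiction m≤ (<⇒≱ <m)
      ... | no  _  | _ | _ = refl

      exchanged : Tab → Tab
      exchanged σ = tabulate (λ u → σ ! exchange c c′ eq m u)

      module _ (c≢c′ : c ≢ c′) (1≤m : 1 ≤ m) (σ : Tab) where

        private
          ρ : Tab
          ρ = exchanged σ

          transported : ∀ {i j j′} → 1 ≤ i → height j ≡ height j′ →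
            (∀ r → suc (toℕ r) ≡ i → ∃ λ r′ → toℕ r′ ≡ toℕ r × exchange c c′ eq m (j , r) ≡ (j′ , r′)) →
            entry ρ i j ≡ entry σ i j′
          transported {suc k} {j} {j′} _ heq ex = go (k <? height j)
            where
            go : Dec (k < height j) → entry ρ (suc k) j ≡ entry σ (suc k) j′
            go (no k≮h)  = trans (entry-above ρ j (s≤s (≮⇒≥ k≮h))) (sym (entry-above σ j′ (s≤s (subst (_≤ k) heq (≮⇒≥ k≮h)))))
            go (yes k<h) with r′ , r′≡ , ex≡ ← ex (fromℕ< k<h) (cong suc (Fₚ.toℕ-fromℕ< k<h)) = begin
              entry ρ (suc k) j                            ≡⟨ entry-inside ρ j k<h ⟩
              suc (toℕ (ρ ! cell j k<h))                   ≡⟨ cong (suc ∘ toℕ) (trans (tabulate-! _ (cell j k<h)) (cong (σ !_) ex≡)) ⟩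
              suc (toℕ (σ ! (j′ , r′)))                    ≡⟨ value-≡ σ (j′ , r′) ⟨
              entry σ (suc (toℕ r′)) j′                    ≡⟨ cong (λ i → entry σ (suc i) j′) (trans r′≡ (Fₚ.toℕ-fromℕ< k<h)) ⟩
              entry σ (suc k) j′                           ∎
              where open ≡-Reasoning

        exchanged-first : ∀ {i} → m ≤ i → entry ρ i c ≡ entry σ i c′
        exchanged-first m≤i = transported (≤-trans 1≤m m≤i) eq
          (λ r eqr → F.cast eq r , Fₚ.toℕ-cast eq r , exchange-first (subst (m ≤_) (sym eqr) m≤i))

        exchanged-second : ∀ {i} → m ≤ i → entry ρ i c′ ≡ entry σ i c
        exchanged-second m≤i = transported (≤-trans 1≤m m≤i) (sym eq)
          (λ r eqr → F.cast (sym eq) r , Fₚ.toℕ-cast (sym eq) r , exchange-second c≢c′ (subst (m ≤_) (sym eqr) m≤i))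

        exchanged-low : ∀ {i} j → i < m → entry ρ i j ≡ entry σ i j
        exchanged-low {zero}  j i<m = refl
        exchanged-low {suc i} j i<m = transported (s≤s z≤n) refl (λ r eqr → r , refl , exchange-low (subst (_< m) (sym eqr) i<m))

        exchanged-other : ∀ {j} i → j ≢ c → j ≢ c′ → entry ρ i j ≡ entry σ i j
        exchanged-other zero    j≢c j≢c′ = refl
        exchanged-other (suc i) j≢c j≢c′ = transported (s≤s z≤n) refl (λ r _ → r , refl , exchange-other j≢c j≢c′)

    module Rmax (σ : Tab) (c c′ : Column) = Threshold (balanced? σ c c′) (positive c)

    mutual
      -- The function by which swapColumns branches, recovered by unification.
      swapIf : ∀ c c′ → Tab → Dec (height c ≡ height c′) → Tab
      swapIf = _

      swapColumns-≡ : ∀ c c′ σ → swapColumns c c′ σ ≡ swapIf c c′ σ (height c ≟ height c′)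
      swapColumns-≡ c c′ σ with height c ≟ height c′
      ... | d = refl {x = swapIf c c′ σ d}

    swapColumns-elim : ∀ {c c′} (eq : height c ≡ height c′) (P : Tab → Set) σ →
      P (exchanged c c′ eq (rmax σ c c′) σ) → P (swapColumns c c′ σ)
    swapColumns-elim {c} {c′} eq P σ p = subst P (sym (swapColumns-≡ c c′ σ)) (go (height c ≟ height c′))
      where
      go : ∀ d → P (swapIf c c′ σ d)
      -- The test inside `swapColumns` yields its own proof of equal heights; equality in ℕ is
      -- proof-irrelevant.
      go (yes eq′) = subst (λ e → P (exchanged c c′ e (rmax σ c c′) σ)) (≡-irrelevant eq eq′) p
      go (no ne)   = contradiction eq ne

    swapColumns-swap : ∀ c c′ → c ≢ c′ → height c ≡ height c′ → ∀ σ → Swap σ (swapColumns c c′ σ) c c′ (rmax σ c c′)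
    swapColumns-swap c c′ c≢c′ eq σ = swapColumns-elim eq (λ ρ → Swap σ ρ c c′ m) σ record
      { 1≤m = T.1≤threshold
      ; rest = exchanged-other c c′ eq m c≢c′ T.1≤threshold σ
      ; swapped = record
        { m≤h = T.threshold≤h
        ; swap-f = exchanged-first c c′ eq m c≢c′ T.1≤threshold σ
        ; swap-g = exchanged-second c c′ eq m c≢c′ T.1≤threshold σ
        ; keep-f = exchanged-low c c′ eq m c≢c′ T.1≤threshold σ c
        ; keep-g = exchanged-low c c′ eq m c≢c′ T.1≤threshold σ c′
        ; balanced = λ {k} m≡ → equal⇒ (entry σ (2 + k) c) (entry σ (2 + k) c′) (entry σ (1 + k) c) (entry σ (1 + k) c′) (T.at-threshold m≡)
        ; unbalanced = λ {k} m≤k k<h → unequal⇒ (entry σ (suc k) c) (entry σ (suc k) c′) (entry σ k c) (entry σ k c′) (T.above-threshold m≤k k<h)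
        }
      }
      where
      module T = Rmax σ c c′
      m : ℕ
      m = rmax σ c c′

    module _ {σ ρ c c′ m} (S : Swap σ ρ c c′ m) (c≢c′ : c ≢ c′) (eq : height c ≡ height c′) where
      private
        module S = Swap S

      -- In row `m` the exchange only interchanges the two sides of the balance. Above it the lower
      -- entries are exchanged as well, and by antisymmetry both indicators are complemented, so
      -- they still differ.
      swap-rmax : rmax ρ c c′ ≡ m
      swap-rmax = Rmax.threshold-unique ρ c c′ S.1≤m S.m≤h bal unb
        where
        bal : ∀ {k} → m ≡ 2 + k → Balanced ρ c c′ (2 + k)
        bal {k} refl = ⇒equal (entry ρ m c) (entry ρ m c′) (entry ρ (suc k) c) (entry ρ (suc k) c′) (begin
          q (entry ρ m c) (entry ρ (suc k) c) (entry ρ (suc k) c′)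
            ≡⟨ q-cong (S.swap-f ≤-refl) (S.keep-f ≤-refl) (S.keep-g ≤-refl) ⟩
          q (entry σ m c′) (entry σ (suc k) c) (entry σ (suc k) c′)
            ≡⟨ S.balanced refl ⟨
          q (entry σ m c) (entry σ (suc k) c) (entry σ (suc k) c′)
            ≡⟨ q-cong (S.swap-g ≤-refl) (S.keep-f ≤-refl) (S.keep-g ≤-refl) ⟨
          q (entry ρ m c′) (entry ρ (suc k) c) (entry ρ (suc k) c′) ∎)
          where
          open ≡-Reasoning
        unb : ∀ {k} → m ≤ k → k < height c → ¬ Balanced ρ c c′ (suc k)
        unb {k} m≤k k<h = ⇒unequal (entry ρ (suc k) c) (entry ρ (suc k) c′) (entry ρ k c) (entry ρ k c′) (trans swapped-q (linear
            (cong₂ _+_ (cong₂ _+_ (q-antisym x ab) (q-antisym y ab)) (sym (S.unbalanced m≤k k<h)))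
            (regroup (q y b a) (q x b a) (q x a b) (q y a b))))
          where
          x y a b : ℕ
          x = entry σ (suc k) c
          y = entry σ (suc k) c′
          a = entry σ k c
          b = entry σ k c′
          ab : a ≢ b
          ab = unbalanced-≢ S.swapped m≤k k<h
          swapped-q : q (entry ρ (suc k) c) (entry ρ k c) (entry ρ k c′) + q (entry ρ (suc k) c′) (entry ρ k c) (entry ρ k c′) ≡ q y b a + q x b a
          swapped-q = cong₂ _+_ (q-cong (S.swap-f (m≤n⇒m≤1+n m≤k)) (S.swap-f m≤k) (S.swap-g m≤k))
            (q-cong (S.swap-g (m≤n⇒m≤1+n m≤k)) (S.swap-f m≤k) (S.swap-g m≤k))
          regroup : ∀ yba xba xab yab → yba + xba + (1 + 1 + (xab + yab)) ≡ 1 + (xab + xba + (yab + yba) + 1)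
          regroup = solve-∀

  -- Involutivity of τ and its effect on `quinv` and on the arm.

  module Moving (Λ : Partition) (n : ℕ) .{{_ : NonZero n}} where
    open Tableaux Λ n
    open Fillings Λ n
    open Counting Λ n
    open Swapping Λ n
    open Next n
    open Columns n

    module _ {σ ρ c c′ m} (S : Swap σ ρ c c′ m) (c≢c′ : c ≢ c′) (eq : height c ≡ height c′) where
      open Swap S

      swapColumns-involutive : swapColumns c c′ ρ ≡ σ
      swapColumns-involutive = ext _ σ (λ j {i} _ _ → agree j i)
        where
        module B = Swap (subst (Swap ρ (swapColumns c c′ ρ) c c′) (swap-rmax S c≢c′ eq) (swapColumns-swap c c′ c≢c′ eq ρ))
        agree : ∀ j i → entry (swapColumns c c′ ρ) i j ≡ entry σ i j
        agree j i with j Fₚ.≟ c | j Fₚ.≟ c′ | m ≤? i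
        ... | yes refl | _        | yes m≤i = trans (B.swap-f m≤i) (swap-g m≤i)
        ... | yes refl | _        | no  m≰i = trans (B.keep-f (≰⇒> m≰i)) (keep-f (≰⇒> m≰i))
        ... | no _     | yes refl | yes m≤i = trans (B.swap-g m≤i) (swap-f m≤i)
        ... | no _     | yes refl | no  m≰i = trans (B.keep-g (≰⇒> m≰i)) (keep-g (≰⇒> m≰i))
        ... | no j≢c   | no j≢c′  | _       = trans (B.rest i j≢c j≢c′) (rest i j≢c j≢c′)

      swap-content : ∀ {a ℓ} (M : CommutativeMonoid a ℓ) X (let open Content M X) →
        CommutativeMonoid._≈_ M (content ρ) (content σ)
      swap-content M X = M.trans (content-columns ρ) (M.trans (M.sym (M.identityʳ _)) (M.trans
        (Sums.sum-two M c≢c′ (columnContent ρ) (columnContent σ)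
          (λ {j} j≢c j≢c′ → Sums.sumFin-cong M (height j) (λ i _ → M.reflexive (cong atEntry (rest (suc i) j≢c j≢c′))))
          (M.∙-congʳ columns))
        (M.trans (M.identityʳ _) (M.sym (content-columns σ)))))
        where
        module M = CommutativeMonoid M
        open Content M X
        h : ℕ
        h = height c
        at : Tab → Column → ℕ → M.Carrier
        at τ j i = atEntry (entry τ (suc i) j)
        rows : ∀ i → at ρ c i M.∙ at ρ c′ i M.≈ at σ c i M.∙ at σ c′ i
        rows i with m ≤? suc i
        ... | yes m≤i = M.trans (M.reflexive (cong₂ (λ x y → atEntry x M.∙ atEntry y) (swap-f m≤i) (swap-g m≤i))) (M.comm _ _)
        ... | no  m≰i = M.reflexive (cong₂ (λ x y → atEntry x M.∙ atEntry y) (keep-f (≰⇒> m≰i)) (keep-g (≰⇒> m≰i)))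
        both : ∀ τ → columnContent τ c M.∙ columnContent τ c′ M.≈ Sums.sumFin M h (λ i → at τ c i M.∙ at τ c′ i)
        both τ = M.trans (M.∙-congˡ (M.reflexive (cong (λ k → Sums.sumFin M k (at τ c′)) (sym eq)))) (M.sym (Sums.sumFin-∙ M h (at τ c) (at τ c′)))
        columns : columnContent ρ c M.∙ columnContent ρ c′ M.≈ columnContent σ c M.∙ columnContent σ c′
        columns = M.trans (both ρ) (M.trans (Sums.sumFin-cong M h (λ i _ → rows i)) (M.sym (both σ)))

      module _ (adjacent : toℕ c′ ≡ suc (toℕ c)) where

        private
          h : ℕ
          h = height c

          c<c′ : c F.< c′
          c<c′ = ≤-reflexive (sym adjacent)

          <c⇒<c′ : ∀ {j : Column} → j F.< c → j F.< c′
          <c⇒<c′ j<c = <-trans j<c c<c′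

          <c′⇒<c : ∀ {j} → j ≢ c → j F.< c′ → j F.< c
          <c′⇒<c {j} j≢c j<c′ = ≤∧≢⇒< (≤-pred (subst (toℕ j <_) adjacent j<c′)) (j≢c ∘ Fₚ.toℕ-injective)

          c′<⇒c< : ∀ {j : Column} → c′ F.< j → c F.< j
          c′<⇒c< c′<j = <-trans c<c′ c′<j

          c<⇒c′< : ∀ {j} → j ≢ c′ → c F.< j → c′ F.< j
          c<⇒c′< {j} j≢c′ c<j = ≤∧≢⇒< (subst (_≤ toℕ j) (sym adjacent) c<j) (j≢c′ ∘ sym ∘ Fₚ.toℕ-injective)

          P : Tab → Column → Column → ℕ → ℕ
          P τ j k = pairs (column τ j) (column τ k)

          off : ∀ {j k} → j ≢ c → j ≢ c′ → k ≢ c → k ≢ c′ → columnPair σ j k ≡ columnPair ρ j k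
          off {j} {k} j≢c j≢c′ k≢c k≢c′ = cong (_when (j Fₚ.<? k)) (pairs-cong (column σ j) (column ρ j) (column σ k) (column ρ k) (height k)
            (λ i → sym (rest i j≢c j≢c′)) (λ i → sym (rest i k≢c k≢c′)))

          col-sum : ∀ {j} → j ≢ c → j ≢ c′ → columnPair σ j c + columnPair σ j c′ ≡ columnPair ρ j c + columnPair ρ j c′
          col-sum {j} j≢c j≢c′ = by (j Fₚ.<? c)
            where
            open ≡-Reasoning
            by : Dec (j F.< c) → columnPair σ j c + columnPair σ j c′ ≡ columnPair ρ j c + columnPair ρ j c′
            by (no j≮c) = trans (absent σ) (sym (absent ρ))
              where
              absent : ∀ τ → columnPair τ j c + columnPair τ j c′ ≡ 0
              absent τ = cong₂ _+_ (when-no (j Fₚ.<? c) j≮c) (when-no (j Fₚ.<? c′) (j≮c ∘ <c′⇒<c j≢c))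
            by (yes j<c) = begin
              columnPair σ j c + columnPair σ j c′
                ≡⟨ present σ ⟩
              P σ j c h + P σ j c′ h
                ≡⟨ swap-left swapped (column σ j) h ⟩
              pairs (column σ j) (column ρ c) h + pairs (column σ j) (column ρ c′) h
                ≡⟨ cong₂ _+_ (pairs-cong (column σ j) (column ρ j) (column ρ c) (column ρ c) h (λ i → sym (rest i j≢c j≢c′)) (λ _ → refl))
                             (pairs-cong (column σ j) (column ρ j) (column ρ c′) (column ρ c′) h (λ i → sym (rest i j≢c j≢c′)) (λ _ → refl)) ⟩
              P ρ j c h + P ρ j c′ h
                ≡⟨ present ρ ⟨
              columnPair ρ j c + columnPair ρ j c′ ∎
              where
              present : ∀ τ → columnPair τ j c + columnPair τ j c′ ≡ P τ j c h + P τ j c′ h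
              present τ = cong₂ _+_ (when-yes (j Fₚ.<? c) j<c) (trans (when-yes (j Fₚ.<? c′) (<c⇒<c′ j<c)) (cong (P τ j c′) (sym eq)))

          row-sum : ∀ {j} → j ≢ c → j ≢ c′ → columnPair σ c j + columnPair σ c′ j ≡ columnPair ρ c j + columnPair ρ c′ j
          row-sum {j} j≢c j≢c′ = by (c Fₚ.<? j)
            where
            open ≡-Reasoning
            by : Dec (c F.< j) → columnPair σ c j + columnPair σ c′ j ≡ columnPair ρ c j + columnPair ρ c′ j
            by (no c≮j) = trans (absent σ) (sym (absent ρ))
              where
              absent : ∀ τ → columnPair τ c j + columnPair τ c′ j ≡ 0
              absent τ = cong₂ _+_ (when-no (c Fₚ.<? j) c≮j) (when-no (c′ Fₚ.<? j) (c≮j ∘ c′<⇒c<))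
            by (yes c<j) = begin
              columnPair σ c j + columnPair σ c′ j
                ≡⟨ present σ ⟩
              P σ c j (height j) + P σ c′ j (height j)
                ≡⟨ swap-right swapped (column σ j) (height j) ⟩
              pairs (column ρ c) (column σ j) (height j) + pairs (column ρ c′) (column σ j) (height j)
                ≡⟨ cong₂ _+_ (pairs-cong (column ρ c) (column ρ c) (column σ j) (column ρ j) (height j) (λ _ → refl) (λ i → sym (rest i j≢c j≢c′)))
                             (pairs-cong (column ρ c′) (column ρ c′) (column σ j) (column ρ j) (height j) (λ _ → refl) (λ i → sym (rest i j≢c j≢c′))) ⟩
              P ρ c j (height j) + P ρ c′ j (height j)
                ≡⟨ present ρ ⟨
              columnPair ρ c j + columnPair ρ c′ j ∎
              where
              present : ∀ τ → columnPair τ c j + columnPair τ c′ j ≡ P τ c j (height j) + P τ c′ j (height j)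
              present τ = cong₂ _+_ (when-yes (c Fₚ.<? j) c<j) (when-yes (c′ Fₚ.<? j) (c<⇒c′< j≢c′ c<j))

          diag : ∀ τ → (columnPair τ c c + columnPair τ c′ c) + (columnPair τ c c′ + columnPair τ c′ c′) ≡ P τ c c′ h
          diag τ = trans (cong₂ _+_
            (cong₂ _+_ (when-no (c Fₚ.<? c) (Fₚ.<-irrefl refl)) (when-no (c′ Fₚ.<? c) (<⇒≯ c<c′)))
            (cong₂ _+_ (trans (when-yes (c Fₚ.<? c′) c<c′) (cong (P τ c c′) (sym eq))) (when-no (c′ Fₚ.<? c′) (Fₚ.<-irrefl refl))))
            (+-identityʳ _)

        -- As the columns are adjacent, every other column lies on the same side of both and sees no
        -- change in total. What remains is the top row of the pair itself.
        swap-quinv : quinv σ + ⟦ entry σ h c′ <? entry σ h c ⟧ ≡ quinv ρ + ⟦ entry σ h c <? entry σ h c′ ⟧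
        swap-quinv = trans (cong (_+ ⟦ entry σ h c′ <? entry σ h c ⟧) (quinv-columns σ))
          (trans (sum-two-cross c≢c′ (columnPair σ) (columnPair ρ) off col-sum row-sum
            (trans (cong (_+ ⟦ entry σ h c′ <? entry σ h c ⟧) (diag σ))
              (trans (swap-within swapped (entry-above σ c ≤-refl) (entry-above σ c′ (s≤s (≤-reflexive (sym eq)))) (positive c))
                (cong (_+ ⟦ entry σ h c <? entry σ h c′ ⟧) (sym (diag ρ))))))
            (cong (_+ ⟦ entry σ h c <? entry σ h c′ ⟧) (sym (quinv-columns ρ))))

        private
          b : ℕ
          b = entry σ h c′
          1≤b : 1 ≤ b
          1≤b = 1≤entry σ c′ (positive c) (≤-reflexive eq)
          A B : Column → ℕ
          A = arm σ c (suc h) h 1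
          B = arm ρ c′ (suc h) h 1

        -- From the top of `c`, the right neighbour is read in the same row and shows `b`. From the
        -- top of `c′`, the left neighbour is read one row higher, above its column. All other
        -- columns are read as before.
        swap-arm : Σᶜ A ≡ Σᶜ B + ⟦ b ≟ 1 ⟧
        swap-arm = trans (sym (+-identityʳ _)) (sum-two c≢c′ A B same (trans (cong (_+ 0) (cong₂ _+_ Ac Ac′)) (trans (tidy ⟦ b ≟ 1 ⟧) (cong (_+ ⟦ b ≟ 1 ⟧) (sym (cong₂ _+_ Bc Bc′))))))
          where
          tidy : ∀ e → 0 + e + 0 ≡ 0 + 0 + e
          tidy = solve-∀
          same : ∀ {j} → j ≢ c → j ≢ c′ → A j ≡ B j
          same {j} j≢c j≢c′ = cong₂ _+_
            (when-cong (j Fₚ.<? c) (j Fₚ.<? c′) <c⇒<c′ (<c′⇒<c j≢c) (λ _ → cong (λ x → ⟦ x ≟ 1 ⟧) (sym (rest (suc h) j≢c j≢c′))))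
            (when-cong (c Fₚ.<? j) (c′ Fₚ.<? j) (c<⇒c′< j≢c′) c′<⇒c< (λ _ → cong (λ x → ⟦ x ≟ 1 ⟧) (sym (rest h j≢c j≢c′))))
          Ac : A c ≡ 0
          Ac = cong₂ _+_ (when-no (c Fₚ.<? c) (Fₚ.<-irrefl refl)) (when-no (c Fₚ.<? c) (Fₚ.<-irrefl refl))
          Ac′ : A c′ ≡ ⟦ b ≟ 1 ⟧
          Ac′ = cong₂ _+_ (when-no (c′ Fₚ.<? c) (<⇒≯ c<c′)) (when-yes (c Fₚ.<? c′) c<c′)
          Bc : B c ≡ 0
          Bc = cong₂ _+_ (trans (when-yes (c Fₚ.<? c′) c<c′) (cong (λ x → ⟦ x ≟ 1 ⟧) (entry-above ρ c ≤-refl))) (when-no (c′ Fₚ.<? c) (<⇒≯ c<c′))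
          Bc′ : B c′ ≡ 0
          Bc′ = cong₂ _+_ (when-no (c′ Fₚ.<? c′) (Fₚ.<-irrefl refl)) (when-no (c′ Fₚ.<? c′) (Fₚ.<-irrefl refl))

        -- A top entry 1 exceeds no other entry of the row, so moving it one
        -- column to the right removes a quinv pair or a cell counted by up.
        swap-step : entry σ h c ≡ 1 → quinv ρ + Σᶜ B + 1 ≡ quinv σ + Σᶜ A
        swap-step a≡1 = linear
          (cong₂ _+_ (cong₂ _+_ (sym quinv≡) (sym swap-arm)) (sym b≥1))
          (regroup (quinv ρ) (Σᶜ B) (quinv σ) (Σᶜ A) ⟦ 1 <? b ⟧ ⟦ b ≟ 1 ⟧)
          where
          quinv≡ : quinv σ + 0 ≡ quinv ρ + ⟦ 1 <? b ⟧
          quinv≡ = trans (cong (quinv σ +_) (sym (⟦⟧-no (b <? entry σ h c) (λ b<a → <⇒≱ (subst (b <_) a≡1 b<a) 1≤b))))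
            (trans swap-quinv (cong (λ a → quinv ρ + ⟦ a <? b ⟧) a≡1))
          b≥1 : ⟦ b ≟ 1 ⟧ + ⟦ 1 <? b ⟧ ≡ 1
          b≥1 with m≤n⇒m<n∨m≡n 1≤b
          ... | inj₁ 1<b = cong₂ _+_ (⟦⟧-no (b ≟ 1) (≢-sym (<⇒≢ 1<b))) (⟦⟧-yes (1 <? b) 1<b)
          ... | inj₂ 1≡b = cong₂ _+_ (⟦⟧-yes (b ≟ 1) (sym 1≡b)) (⟦⟧-no (1 <? b) (λ 1<b → <⇒≢ 1<b 1≡b))
          regroup : ∀ qρ B qσ A lt e → qρ + B + 1 + (qσ + 0 + A + (e + lt)) ≡ qσ + A + (qρ + lt + (B + e) + 1)
          regroup = solve-∀

  -- Carrying a top entry 1 across a block of columns of equal height.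

  module Repositioning (Λ : Partition) (n : ℕ) .{{_ : NonZero n}} where
    open Tableaux Λ n
    open Fillings Λ n
    open Counting Λ n
    open Swapping Λ n
    open Moving Λ n
    open Next n
    open Columns n

    topEntry : Tab → Column → ℕ
    topEntry σ c = entry σ (height c) c

    -- The sum of `quinv` and `up`, which is the exponent of t after a transition, for a target at
    -- the top of `c` with entry 1.
    potential : Tab → Column → ℕ
    potential σ c = quinv σ + Σᶜ (arm σ c (suc (height c)) (height c) 1)

    swapColumns-unequal : ∀ {c c′} → height c ≢ height c′ → ∀ σ → swapColumns c c′ σ ≡ σ
    swapColumns-unequal {c} {c′} ne σ = trans (swapColumns-≡ c c′ σ) (go (height c ≟ height c′))
      where
      go : ∀ d → swapIf c c′ σ d ≡ σ
      go (yes eq) = contradiction eq ne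
      go (no _)   = refl

    -- Lets involutivity and invariance of contents be proved for every `j`, without recording that
    -- `R′` stays within one block.
    data τ-View (j : ℕ) : Set where
      trivial : (∀ σ → τ j σ ≡ σ) → τ-View j
      swaps   : ∀ c c′ → toℕ c ≡ j → toℕ c′ ≡ suc j → height c ≡ height c′ →
        (∀ σ → τ j σ ≡ swapColumns c c′ σ) → τ-View j

    τ-≡ : ∀ {j} (1+j<ℓ : suc j < length) σ →
      τ j σ ≡ swapColumns (fromℕ< (<-trans (n<1+n j) 1+j<ℓ)) (fromℕ< 1+j<ℓ) σ
    τ-≡ {j} 1+j<ℓ σ with suc j <? length
    ... | yes p = cong₂ (λ c c′ → swapColumns c c′ σ)
      (Fₚ.fromℕ<-cong j j refl (<-trans (n<1+n j) p) (<-trans (n<1+n j) 1+j<ℓ)) (Fₚ.fromℕ<-cong (suc j) (suc j) refl p 1+j<ℓ)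
    ... | no ¬p = contradiction 1+j<ℓ ¬p

    τ-outside : ∀ {j} → ¬ (suc j < length) → ∀ σ → τ j σ ≡ σ
    τ-outside {j} ¬p σ with suc j <? length
    ... | yes p = contradiction p ¬p
    ... | no _  = refl

    τ-view : ∀ j → τ-View j
    τ-view j with suc j <? length
    ... | no ¬p = trivial (τ-outside ¬p)
    ... | yes p = by (height c ≟ height c′)
      where
      c c′ : Column
      c  = fromℕ< (<-trans (n<1+n j) p)
      c′ = fromℕ< p
      by : Dec (height c ≡ height c′) → τ-View j
      by (yes eq) = swaps c c′ (Fₚ.toℕ-fromℕ< _) (Fₚ.toℕ-fromℕ< p) eq (τ-≡ p)
      by (no ne)  = trivial (λ σ → trans (τ-≡ p σ) (swapColumns-unequal ne σ))

    neighbours-≢ : ∀ {c c′ : Column} {j} → toℕ c ≡ j → toℕ c′ ≡ suc j → c ≢ c′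
    neighbours-≢ eq eq′ c≡c′ = 1+n≢n (trans (sym eq′) (trans (cong toℕ (sym c≡c′)) eq))

    τ-involutive : ∀ j σ → τ j (τ j σ) ≡ σ
    τ-involutive j σ with τ-view j
    ... | trivial eq = trans (eq (τ j σ)) (eq σ)
    ... | swaps c c′ c≡j c′≡1+j heq eq = trans (eq (τ j σ)) (trans (cong (swapColumns c c′) (eq σ))
            (swapColumns-involutive (swapColumns-swap c c′ c≢c′ heq σ) c≢c′ heq))
      where
      c≢c′ : c ≢ c′
      c≢c′ = neighbours-≢ c≡j c′≡1+j

    τ-content : ∀ {a ℓ} (M : CommutativeMonoid a ℓ) X (let open Content M X) j σ →
      CommutativeMonoid._≈_ M (content (τ j σ)) (content σ)
    τ-content M X j σ with τ-view j
    ... | trivial eq = CommutativeMonoid.reflexive M (cong (Content.content M X) (eq σ))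
    ... | swaps c c′ c≡j c′≡1+j heq eq = CommutativeMonoid.trans M (CommutativeMonoid.reflexive M (cong (Content.content M X) (eq σ)))
            (swap-content (swapColumns-swap c c′ c≢c′ heq σ) c≢c′ heq M X)
      where
      c≢c′ : c ≢ c′
      c≢c′ = neighbours-≢ c≡j c′≡1+j

    applyτ-reverse : ∀ js σ → applyτ (L.reverse js) (applyτ js σ) ≡ σ
    applyτ-reverse []       σ = refl
    applyτ-reverse (j ∷ js) σ = begin
      applyτ (L.reverse (j ∷ js)) (applyτ js (τ j σ))      ≡⟨ cong (λ ks → applyτ ks (applyτ js (τ j σ))) (unfold-reverse j js) ⟩
      applyτ (L.reverse js L.∷ʳ j) (applyτ js (τ j σ))     ≡⟨ foldl-++ (λ ρ j → τ j ρ) (applyτ js (τ j σ)) (L.reverse js) (j ∷ []) ⟩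
      τ j (applyτ (L.reverse js) (applyτ js (τ j σ)))      ≡⟨ cong (τ j) (applyτ-reverse js (τ j σ)) ⟩
      τ j (τ j σ)                                          ≡⟨ τ-involutive j σ ⟩
      σ                                                    ∎
      where open ≡-Reasoning

    applyτ-reverse′ : ∀ js σ → applyτ js (applyτ (L.reverse js) σ) ≡ σ
    applyτ-reverse′ js σ = trans (cong (λ ks → applyτ ks (applyτ (L.reverse js) σ)) (sym (reverse-involutive js)))
      (applyτ-reverse (L.reverse js) σ)

    applyτ-content : ∀ {a ℓ} (M : CommutativeMonoid a ℓ) X (let open Content M X) js σ →
      CommutativeMonoid._≈_ M (content (applyτ js σ)) (content σ)
    applyτ-content M X []       σ = CommutativeMonoid.refl M
    applyτ-content M X (j ∷ js) σ = CommutativeMonoid.trans M (applyτ-content M X js (τ j σ)) (τ-content M X j σ)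

    -- An iteration of `swap-step`. The index function `f` is general because unfolding `applyUpTo`
    -- replaces it by `f ∘ suc`. All columns in between have the common height since heights
    -- decrease.
    rightward : ∀ k (v w : Column) (f : ℕ → ℕ) → (∀ i → f i ≡ toℕ v + i) → toℕ w ≡ toℕ v + k → height v ≡ height w →
      ∀ σ (let ρ = applyτ (applyUpTo f k) σ) →
      topEntry ρ w ≡ topEntry σ v × (topEntry σ v ≡ 1 → potential ρ w + k ≡ potential σ v)
    rightward zero v w f f≡ w≡ heq σ with refl ← Fₚ.toℕ-injective {i = w} {j = v} (trans w≡ (+-identityʳ (toℕ v))) =
      refl , λ _ → +-identityʳ _
    rightward (suc k) v w f f≡ w≡ heq σ = trans ih-top top-step , λ top≡1 → begin
        potential ρ w + suc k         ≡⟨ +-suc _ k ⟩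
        suc (potential ρ w + k)       ≡⟨ cong suc (ih-potential (trans top-step top≡1)) ⟩
        suc (potential σ₁ v₁)         ≡⟨ +-comm (potential σ₁ v₁) 1 ⟨
        potential σ₁ v₁ + 1           ≡⟨ cong (λ k → quinv σ₁ + Σᶜ (arm σ₁ v₁ (suc k) k 1) + 1) (sym heq₁) ⟩
        quinv σ₁ + Σᶜ (arm σ₁ v₁ (suc (height v)) (height v) 1) + 1
                                      ≡⟨ swap-step S v≢v₁ heq₁ v₁≡ top≡1 ⟩
        potential σ v                 ∎
      where
      open ≡-Reasoning
      v+1<ℓ : suc (toℕ v) < length
      v+1<ℓ = ≤-<-trans (≤-trans (≤-reflexive (+-comm 1 (toℕ v))) (≤-trans (+-monoʳ-≤ (toℕ v) (s≤s z≤n)) (≤-reflexive (sym w≡)))) (Fₚ.toℕ<n w)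
      v₁ : Column
      v₁ = fromℕ< v+1<ℓ
      v₁≡ : toℕ v₁ ≡ suc (toℕ v)
      v₁≡ = Fₚ.toℕ-fromℕ< v+1<ℓ
      v≢v₁ : v ≢ v₁
      v≢v₁ = neighbours-≢ refl v₁≡
      w≡₁ : toℕ w ≡ toℕ v₁ + k
      w≡₁ = trans w≡ (trans (+-suc (toℕ v) k) (cong (_+ k) (sym v₁≡)))
      heq₁ : height v ≡ height v₁
      heq₁ = ≤-antisym (≤-trans (≤-reflexive heq) (decreasing (≤-trans (m≤m+n (toℕ v₁) k) (≤-reflexive (sym w≡₁)))))
        (decreasing (≤-trans (n≤1+n (toℕ v)) (≤-reflexive (sym v₁≡))))
      σ₁ : Tab
      σ₁ = τ (f 0) σ
      σ₁≡ : σ₁ ≡ swapColumns v v₁ σ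
      σ₁≡ = trans (cong (λ j → τ j σ) (trans (f≡ 0) (+-identityʳ (toℕ v))))
        (trans (τ-≡ v+1<ℓ σ) (cong (λ c → swapColumns c v₁ σ) (Fₚ.fromℕ<-toℕ v (<-trans (n<1+n (toℕ v)) v+1<ℓ))))
      S : Swap σ σ₁ v v₁ (rmax σ v v₁)
      S = subst (λ ρ → Swap σ ρ v v₁ (rmax σ v v₁)) (sym σ₁≡) (swapColumns-swap v v₁ v≢v₁ heq₁ σ)
      top-step : topEntry σ₁ v₁ ≡ topEntry σ v
      top-step = trans (cong (λ k → entry σ₁ k v₁) (sym heq₁)) (Swap.swap-g S (Swap.m≤h S))
      ρ : Tab
      ρ = applyτ (applyUpTo (f ∘ suc) k) σ₁
      ih : topEntry ρ w ≡ topEntry σ₁ v₁ × (topEntry σ₁ v₁ ≡ 1 → potential ρ w + k ≡ potential σ₁ v₁)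
      ih = rightward k v₁ w (f ∘ suc) (λ i → trans (f≡ (suc i)) (trans (+-suc (toℕ v) i) (cong (_+ i) (sym v₁≡)))) w≡₁
        (trans (sym heq₁) heq) σ₁
      ih-top = proj₁ ih
      ih-potential = proj₂ ih

    -- Potential plus column index is conserved: a form that no longer depends on the direction of
    -- the move.
    rightward-interval : ∀ {v w : Column} → toℕ v ≤ toℕ w → height v ≡ height w →
      ∀ σ (let ρ = applyτ (interval (toℕ v) (toℕ w)) σ) →
      topEntry ρ w ≡ topEntry σ v × (topEntry σ v ≡ 1 → potential ρ w + toℕ w ≡ potential σ v + toℕ v)
    rightward-interval {v} {w} v≤w heq σ = proj₁ moved , λ top≡1 → begin
        potential ρ w + toℕ w                      ≡⟨ cong (potential ρ w +_) w≡ ⟩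
        potential ρ w + (toℕ v + k)                ≡⟨ regroup (potential ρ w) (toℕ v) k ⟩
        potential ρ w + k + toℕ v                  ≡⟨ cong (_+ toℕ v) (proj₂ moved top≡1) ⟩
        potential σ v + toℕ v                      ∎
      where
      open ≡-Reasoning
      k : ℕ
      k = toℕ w ∸ toℕ v
      w≡ : toℕ w ≡ toℕ v + k
      w≡ = sym (m+[n∸m]≡n v≤w)
      ρ : Tab
      ρ = applyτ (interval (toℕ v) (toℕ w)) σ
      moved = rightward k v w (toℕ v +_) (λ _ → refl) w≡ heq σ
      regroup : ∀ a b c → a + (b + c) ≡ a + c + b
      regroup = solve-∀

    -- The τ's are involutions, so the reversed word undoes a move to the right, whose conservation
    -- law is read backwards.
    leftward-interval : ∀ {v w : Column} → toℕ w ≤ toℕ v → height v ≡ height w →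
      ∀ σ (let ρ = applyτ (L.reverse (interval (toℕ w) (toℕ v))) σ) →
      topEntry ρ w ≡ topEntry σ v × (topEntry σ v ≡ 1 → potential ρ w + toℕ w ≡ potential σ v + toℕ v)
    leftward-interval {v} {w} w≤v heq σ = sym moved-top , λ top≡1 →
        trans (sym (proj₂ moved (trans (sym moved-top) top≡1))) (cong (λ τ → potential τ v + toℕ v) back)
      where
      js = interval (toℕ w) (toℕ v)
      ρ : Tab
      ρ = applyτ (L.reverse js) σ
      back : applyτ js ρ ≡ σ
      back = applyτ-reverse′ js σ
      moved = rightward-interval w≤v (sym heq) ρ
      moved-top : topEntry σ v ≡ topEntry ρ w
      moved-top = trans (cong (λ τ → topEntry τ v) (sym back)) (proj₁ moved)

    -- The last three branches of `R′` with free end points, so that the way back is an instance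
    -- too.
    moveTo : ℕ → ℕ → Tab → Tab
    moveTo v w σ with <-cmp v w
    ... | tri< _ _ _ = applyτ (interval v w) σ
    ... | tri≈ _ _ _ = σ
    ... | tri> _ _ _ = applyτ (L.reverse (interval w v)) σ

    moveTo-content : ∀ {a ℓ} (M : CommutativeMonoid a ℓ) X (let open Content M X) v w σ →
      CommutativeMonoid._≈_ M (content (moveTo v w σ)) (content σ)
    moveTo-content M X v w σ with <-cmp v w
    ... | tri< _ _ _ = applyτ-content M X (interval v w) σ
    ... | tri≈ _ _ _ = CommutativeMonoid.refl M
    ... | tri> _ _ _ = applyτ-content M X (L.reverse (interval w v)) σ

    moveTo-moves : ∀ (v w : Column) → height v ≡ height w → ∀ σ (let ρ = moveTo (toℕ v) (toℕ w) σ) →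
      topEntry ρ w ≡ topEntry σ v × (topEntry σ v ≡ 1 → potential ρ w + toℕ w ≡ potential σ v + toℕ v)
    moveTo-moves v w heq σ with <-cmp (toℕ v) (toℕ w)
    ... | tri< v<w _ _ = rightward-interval (<⇒≤ v<w) heq σ
    ... | tri≈ _ v≡w _ with refl ← Fₚ.toℕ-injective {i = v} {j = w} v≡w = refl , λ _ → refl
    ... | tri> _ _ w<v = leftward-interval (<⇒≤ w<v) heq σ

    moveTo-inverse : ∀ v w σ → moveTo w v (moveTo v w σ) ≡ σ
    moveTo-inverse v w σ with <-cmp v w | <-cmp w v
    ... | tri< _ _ _   | tri> _ _ _   = applyτ-reverse (interval v w) σ
    ... | tri> _ _ _   | tri< _ _ _   = applyτ-reverse′ (interval w v) σ
    ... | tri≈ _ _ _   | tri≈ _ _ _   = refl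
    ... | tri< v<w _ _ | tri< w<v _ _ = contradiction v<w (<⇒≯ w<v)
    ... | tri< v<w _ _ | tri≈ _ w≡v _ = contradiction (sym w≡v) (<⇒≢ v<w)
    ... | tri≈ _ v≡w _ | tri< w<v _ _ = contradiction (sym v≡w) (<⇒≢ w<v)
    ... | tri≈ _ v≡w _ | tri> _ _ v<w = contradiction v≡w (<⇒≢ v<w)
    ... | tri> _ _ w<v | tri≈ _ w≡v _ = contradiction w≡v (<⇒≢ w<v)
    ... | tri> _ _ w<v | tri> _ _ v<w = contradiction v<w (<⇒≯ w<v)

    R′-plain : ∀ ξ u → ¬ Wraps ξ (col u) (ringTop ξ u) → R′ ξ u ≡ R ξ u
    R′-plain ξ u ¬w with ¬? (entry ξ (ringTop ξ u) (col u) ≟ n) ⊎-dec ringTop ξ u <? height (col u)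
    ... | yes _ = refl
    ... | no ¬p = contradiction (≤-antisym (ringTop≤height ξ u) (≮⇒≥ (¬p ∘ inj₂)) , decEq) ¬w
      where
      decEq : entry ξ (ringTop ξ u) (col u) ≡ n
      decEq with entry ξ (ringTop ξ u) (col u) ≟ n
      ... | yes eq = eq
      ... | no ne  = contradiction (inj₁ ne) ¬p

    R′-wraps : ∀ ξ u → Wraps ξ (col u) (ringTop ξ u) → R′ ξ u ≡ moveTo (toℕ (col u)) (reflect (col u)) (R ξ u)
    R′-wraps ξ u (top≡ , eqn) with ¬? (entry ξ (ringTop ξ u) (col u) ≟ n) ⊎-dec ringTop ξ u <? height (col u)
    ... | yes (inj₁ ne) = contradiction eqn ne
    ... | yes (inj₂ lt) = contradiction top≡ (<⇒≢ lt)
    ... | no _ with <-cmp (toℕ (col u)) (reflect (col u))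
    ...   | tri< _ _ _ = refl
    ...   | tri≈ _ _ _ = refl
    ...   | tri> _ _ _ = refl

    record Extent (v : Column) : Set where
      field
        first last    : Column
        first-height  : height first ≡ height v
        last-height   : height last ≡ height v
        within        : ∀ {j} → height j ≡ height v → toℕ first ≤ toℕ j × toℕ j ≤ toℕ last
        reflect≡      : reflect v ≡ toℕ first + toℕ last ∸ toℕ v

    extent : ∀ v → Extent v
    extent v = record
      { first = proj₁ lo ; last = proj₁ hi
      ; first-height = proj₁ (proj₂ lo) ; last-height = proj₁ (proj₂ hi)
      ; within = λ {j} eq → subst (_≤ toℕ j) (proj₂ (proj₂ lo)) (ListAll.lookup (min≤xs (toℕ v) (block v)) (in-block eq))
                          , subst (toℕ j ≤_) (proj₂ (proj₂ hi)) (ListAll.lookup (xs≤max (toℕ v) (block v)) (in-block eq))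
      ; reflect≡ = cong₂ (λ s e → s + e ∸ toℕ v) (proj₂ (proj₂ lo)) (proj₂ (proj₂ hi))
      }
      where
      same? = λ (j : Column) → height j ≟ height v
      in-block : ∀ {j} → height j ≡ height v → toℕ j ∈ block v
      in-block {j} eq = ∈-map⁺ toℕ (∈-filter⁺ same? (∈-allFin j) eq)
      from-block : ∀ {k} → k ∈ block v → ∃ λ j → height j ≡ height v × k ≡ toℕ j
      from-block k∈ with j , j∈ , k≡ ← ∈-map⁻ toℕ k∈ = j , proj₂ (∈-filter⁻ same? {xs = allFin length} j∈) , k≡
      lo : ∃ λ j → height j ≡ height v × min (toℕ v) (block v) ≡ toℕ j
      lo with argmin-sel id (toℕ v) (block v)
      ... | inj₁ eq = v , refl , eq
      ... | inj₂ m∈ = from-block m∈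
      hi : ∃ λ j → height j ≡ height v × max (toℕ v) (block v) ≡ toℕ j
      hi with argmax-sel id (toℕ v) (block v)
      ... | inj₁ eq = v , refl , eq
      ... | inj₂ m∈ = from-block m∈

    -- `right≡left` is what singles out the reflected column: moving from `v` to `w` raises the
    -- potential by `toℕ v` minus `toℕ w`, and this has to cancel the surplus in `ring-quinv-wraps`.
    record Reflection (v : Column) : Set where
      field
        w            : Column
        w≡           : toℕ w ≡ reflect v
        v≡           : toℕ v ≡ reflect w
        height≡      : height v ≡ height w
        right≡left   : toℕ v + sameHeightRight v ≡ toℕ w + sameHeightLeft v

    reflection : ∀ v → Reflection v
    reflection v = record
      { w = w ; w≡ = trans w≡s+e∸v (sym reflect≡)
      -- `w` lies in the block of `v`, so both have the same block and the reflection is an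
      -- involution.
      ; v≡ = sym (trans E′.reflect≡ (trans (cong₂ (λ a b → a + b ∸ toℕ w) first≡ last≡)
               (trans (cong (s + e ∸_) w≡s+e∸v) (m∸[m∸n]≡n v≤s+e))))
      ; height≡ = sym hw≡
      ; right≡left = +-cancelʳ-≡ s _ _ (begin
          toℕ v + sameHeightRight v + s      ≡⟨ cong (_+ s) right≡ ⟩
          e + s                              ≡⟨ +-comm e s ⟩
          s + e                              ≡⟨ m∸n+n≡m v≤s+e ⟨
          s + e ∸ toℕ v + toℕ v              ≡⟨ cong₂ _+_ (sym w≡s+e∸v) (sym left≡) ⟩
          toℕ w + (sameHeightLeft v + s)     ≡⟨ +-assoc (toℕ w) _ s ⟨
          toℕ w + sameHeightLeft v + s       ∎)
      }
      where
      open ≡-Reasoning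
      open Extent (extent v)
      s e : ℕ
      s = toℕ first
      e = toℕ last
      s≤v : s ≤ toℕ v
      s≤v = proj₁ (within {v} refl)
      v≤e : toℕ v ≤ e
      v≤e = proj₂ (within {v} refl)
      v≤s+e : toℕ v ≤ s + e
      v≤s+e = ≤-trans v≤e (m≤n+m e s)
      k≤e : s + e ∸ toℕ v ≤ e
      k≤e = ≤-trans (∸-monoʳ-≤ (s + e) s≤v) (≤-reflexive (m+n∸m≡n s e))
      s≤k : s ≤ s + e ∸ toℕ v
      s≤k = ≤-trans (≤-reflexive (sym (m+n∸n≡m s e))) (∸-monoʳ-≤ (s + e) v≤e)
      w : Column
      w = fromℕ< (≤-<-trans k≤e (Fₚ.toℕ<n last))
      w≡s+e∸v : toℕ w ≡ s + e ∸ toℕ v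
      w≡s+e∸v = Fₚ.toℕ-fromℕ< (≤-<-trans k≤e (Fₚ.toℕ<n last))
      in-between : ∀ {j} → s ≤ toℕ j → toℕ j ≤ e → height j ≡ height v
      in-between s≤j j≤e = ≤-antisym (≤-trans (decreasing s≤j) (≤-reflexive first-height))
        (≤-trans (≤-reflexive (sym last-height)) (decreasing j≤e))
      hw≡ : height w ≡ height v
      hw≡ = in-between (subst (s ≤_) (sym w≡s+e∸v) s≤k) (subst (_≤ e) (sym w≡s+e∸v) k≤e)
      module E′ = Extent (extent w)
      first≡ : toℕ E′.first ≡ s
      first≡ = ≤-antisym (proj₁ (E′.within (trans first-height (sym hw≡)))) (proj₁ (within (trans E′.first-height hw≡)))
      last≡ : toℕ E′.last ≡ e
      last≡ = ≤-antisym (proj₂ (within (trans E′.last-height hw≡))) (proj₂ (E′.within (trans last-height (sym hw≡))))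
      counts : ∀ {lo hi} → lo ≤ hi → hi ≤ length → (f : Column → ℕ) →
        (∀ j → f j ≡ ⟦ lo ≤? toℕ j ×-dec toℕ j <? hi ⟧) → Σᶜ f + lo ≡ hi
      counts {lo} lo≤hi hi≤ℓ f eq = trans (cong (_+ lo) (sum-cong (allFin length) eq)) (count-interval length lo≤hi hi≤ℓ)
      right≡ : toℕ v + sameHeightRight v ≡ e
      -- `count-interval` counts half-open intervals; the columns from `suc v` to `e` inclusive
      -- shift both ends by one.
      right≡ = suc-injective (trans (cong suc (+-comm (toℕ v) _)) (trans (sym (+-suc _ (toℕ v)))
        (counts (s≤s v≤e) (Fₚ.toℕ<n last) _ (λ j → by j (v Fₚ.<? j)))))
        where
        by : ∀ j (d : Dec (v F.< j)) → (⟦ height j ≟ height v ⟧ when d) ≡ ⟦ suc (toℕ v) ≤? toℕ j ×-dec toℕ j <? suc e ⟧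
        by j (no v≮j)  = sym (⟦⟧-no (suc (toℕ v) ≤? toℕ j ×-dec toℕ j <? suc e) (v≮j ∘ proj₁))
        by j (yes v<j) = ⟦⟧-cong (height j ≟ height v) (suc (toℕ v) ≤? toℕ j ×-dec toℕ j <? suc e)
          (λ eq → v<j , s≤s (proj₂ (within eq))) (λ (_ , j≤e) → in-between (≤-trans s≤v (<⇒≤ v<j)) (≤-pred j≤e))
      left≡ : sameHeightLeft v + s ≡ toℕ v
      left≡ = counts s≤v (<⇒≤ (Fₚ.toℕ<n v)) _ (λ j → by j (j Fₚ.<? v))
        where
        by : ∀ j (d : Dec (j F.< v)) → (⟦ height j ≟ height v ⟧ when d) ≡ ⟦ s ≤? toℕ j ×-dec toℕ j <? toℕ v ⟧
        by j (no j≮v)  = sym (⟦⟧-no (s ≤? toℕ j ×-dec toℕ j <? toℕ v) (j≮v ∘ proj₂))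
        by j (yes j<v) = ⟦⟧-cong (height j ≟ height v) (s ≤? toℕ j ×-dec toℕ j <? toℕ v)
          (λ eq → proj₁ (within eq) , j<v) (λ (s≤j , _) → in-between s≤j (≤-trans (<⇒≤ j<v) v≤e))

  -- Transitions into a filling and their targets.

  module Correspondence (Λ : Partition) (n : ℕ) .{{_ : NonZero n}} where
    open Tableaux Λ n
    open Fillings Λ n
    open Counting Λ n
    open Swapping Λ n
    open Repositioning Λ n
    open Next n

    -- The counterpart of `Enabled` for reversed transitions. At the top of a column it always
    -- holds, as the entry above is 0.
    Covered : Tab → Cell → Set
    Covered ρ y = entry ρ (suc (row y)) (col y) ≢ value ρ y

    covered? : ∀ ρ y → Dec (Covered ρ y)
    covered? ρ y = ¬? (entry ρ (suc (row y)) (col y) ≟ value ρ y)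

    cell-≡ : ∀ {u v : Cell} → col u ≡ col v → row u ≡ row v → u ≡ v
    cell-≡ {c , r} {.c , s} refl eq = cong (c ,_) (Fₚ.toℕ-injective (suc-injective eq))

    cellAt : ∀ c i → 1 ≤ i → i ≤ height c → Cell
    cellAt c i 1≤i i≤h = proj₁ (entry-cell c 1≤i i≤h)

    col-cellAt : ∀ c i 1≤i i≤h → col (cellAt c i 1≤i i≤h) ≡ c
    col-cellAt c i 1≤i i≤h = proj₁ (proj₂ (entry-cell c 1≤i i≤h))

    row-cellAt : ∀ c i 1≤i i≤h → row (cellAt c i 1≤i i≤h) ≡ i
    row-cellAt c i 1≤i i≤h = proj₁ (proj₂ (proj₂ (entry-cell c 1≤i i≤h)))

    wraps? : ∀ σ c r → Dec (Wraps σ c r)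
    wraps? σ c r = r ≟ height c ×-dec entry σ r c ≟ n

    mirror : Column → Column
    mirror v = Reflection.w (reflection v)

    targetAt : ∀ σ u → Dec (Wraps σ (col u) (ringTop σ u)) → Cell
    targetAt σ u (yes _) = cellAt (mirror (col u)) (height (mirror (col u))) (positive (mirror (col u))) ≤-refl
    targetAt σ u (no _)  = cellAt (col u) (ringTop σ u) (≤-trans (1≤row u) (row≤ringTop σ u)) (ringTop≤height σ u)

    target : Tab → Cell → Cell
    target σ u = targetAt σ u (wraps? σ (col u) (ringTop σ u))

    target-plain : ∀ σ u → ¬ Wraps σ (col u) (ringTop σ u) → col (target σ u) ≡ col u × row (target σ u) ≡ ringTop σ u
    target-plain σ u ¬w = go (wraps? σ (col u) (ringTop σ u))
      where
      go : ∀ d → col (targetAt σ u d) ≡ col u × row (targetAt σ u d) ≡ ringTop σ u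
      go (yes w) = contradiction w ¬w
      go (no _)  = col-cellAt (col u) (ringTop σ u) 1≤t t≤h , row-cellAt (col u) (ringTop σ u) 1≤t t≤h
        where
        1≤t = ≤-trans (1≤row u) (row≤ringTop σ u)
        t≤h = ringTop≤height σ u

    target-wraps : ∀ σ u → Wraps σ (col u) (ringTop σ u) →
      col (target σ u) ≡ mirror (col u) × row (target σ u) ≡ height (mirror (col u))
    target-wraps σ u w = go (wraps? σ (col u) (ringTop σ u))
      where
      go : ∀ d → col (targetAt σ u d) ≡ mirror (col u) × row (targetAt σ u d) ≡ height (mirror (col u))
      go (yes _) = col-cellAt m (height m) (positive m) ≤-refl , row-cellAt m (height m) (positive m) ≤-refl
        where
        m = mirror (col u)
      go (no ¬w) = contradiction w ¬w

    ring-covered : ∀ {σ ρ c r′ r} → Ring σ ρ c r′ r → entry ρ (suc r) c ≢ entry ρ r c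
    ring-covered Rg eq = top (trans (sym (beyond ≤-refl)) (trans eq (ring r′≤r ≤-refl)))
      where open Ring Rg

    -- The trace of `Wraps` in the rung filling. It tells from the result alone whether a transition
    -- moved its column.
    AtTopOne : Tab → Column → ℕ → Set
    AtTopOne ρ c r = r ≡ height c × entry ρ r c ≡ 1

    ring-wraps⇒ : ∀ {σ ρ c r′ r} → Ring σ ρ c r′ r → Wraps σ c r → AtTopOne ρ c r
    ring-wraps⇒ Rg (r≡h , eqn) = r≡h , trans (ring r′≤r ≤-refl) (trans (cong nxt eqn) nxt-n)
      where open Ring Rg

    ring-wraps⇐ : ∀ {σ ρ c r′ r} → Ring σ ρ c r′ r → AtTopOne ρ c r → Wraps σ c r
    ring-wraps⇐ {σ} {ρ} {c} {r = r} Rg (r≡h , eq1) = r≡h , go (entry σ r c ≟ n)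
      where
      open Ring Rg
      go : Dec (entry σ r c ≡ n) → entry σ r c ≡ n
      go (yes eq) = eq
      go (no ne)  = contradiction (suc-injective (trans (sym (nxt-suc ne)) (trans (sym (ring r′≤r ≤-refl)) eq1)))
        (≢-sym (<⇒≢ (1≤entry σ c 1≤r fits)))

    moveTo-moves′ : ∀ (v w : Column) → height v ≡ height w → ∀ σ {ρ} → ρ ≡ moveTo (toℕ v) (toℕ w) σ →
      topEntry ρ w ≡ topEntry σ v × (topEntry σ v ≡ 1 → potential ρ w + toℕ w ≡ potential σ v + toℕ v)
    moveTo-moves′ v w heq σ refl = moveTo-moves v w heq σ

    module Forward (σ : Tab) (u : Cell) (en : Enabled σ u) where

      private
        v : Column
        v = col u
        r : ℕ
        r = ringTop σ u
        Rg : Ring σ (R σ u) v (row u) r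
        Rg = R-ring σ u en
        ρ : Tab
        ρ = R′ σ u
        y : Cell
        y = target σ u
        module M = Reflection (reflection v)

      module Wrapped (wr : Wraps σ v r) where
        σ₁ : Tab
        σ₁ = R σ u
        w : Column
        w = mirror v
        top₁ : topEntry σ₁ v ≡ 1
        top₁ = trans (cong (λ i → entry σ₁ i v) (sym (proj₁ wr))) (proj₂ (ring-wraps⇒ Rg wr))
        R′≡ : ρ ≡ moveTo (toℕ v) (toℕ w) σ₁
        R′≡ = trans (R′-wraps σ u wr) (cong (λ k → moveTo (toℕ v) k σ₁) (sym M.w≡))
        moves : topEntry ρ w ≡ topEntry σ₁ v × (topEntry σ₁ v ≡ 1 → potential ρ w + toℕ w ≡ potential σ₁ v + toℕ v)
        moves = moveTo-moves′ v w M.height≡ σ₁ R′≡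
        topρ : topEntry ρ w ≡ 1
        topρ = trans (proj₁ moves) top₁
        value-y : value ρ y ≡ 1
        value-y = trans (cong₂ (entry ρ) (proj₂ (target-wraps σ u wr)) (proj₁ (target-wraps σ u wr))) topρ

      at-y : ∀ {i c} → col y ≡ c → row y ≡ i → value ρ y ≡ entry ρ i c
      at-y eqc eqr = cong₂ (entry ρ) eqr eqc

      covered : Covered ρ y
      covered = go (wraps? σ v r)
        where
        go : Dec (Wraps σ v r) → Covered ρ y
        go (no ¬w) eq = ring-covered Rg (subst₂ (λ i c → entry (R σ u) (suc i) c ≡ entry (R σ u) i c) eqr eqc
            (subst (λ τ → entry τ (suc (row y)) (col y) ≡ value τ y) (R′-plain σ u ¬w) eq))
          where
          eqc = proj₁ (target-plain σ u ¬w)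
          eqr = proj₂ (target-plain σ u ¬w)
        go (yes wr) eq = contradiction (trans (sym above≡0) (trans eq value-y)) λ ()
          where
          open Wrapped wr
          above≡0 : entry ρ (suc (row y)) (col y) ≡ 0
          above≡0 = trans (cong₂ (λ i c → entry ρ (suc i) c) (proj₂ (target-wraps σ u wr)) (proj₁ (target-wraps σ u wr))) (entry-above ρ w ≤-refl)

      -- If the path wraps, three equations are added: the ringing with its surplus, the
      -- conservation of potential plus column index, and `right≡left`, which balances the first
      -- two.
      statistics : quinv σ + down σ u ≡ quinv ρ + up ρ (col y) (row y)
      statistics = trans (cong (quinv σ +_) (down-columns σ u)) (go (wraps? σ v r))
        where
        d : ℕ
        d = Σᶜ (arm σ v (row u) (pred (row u)) (value σ u))
        go : Dec (Wraps σ v r) → quinv σ + d ≡ quinv ρ + up ρ (col y) (row y)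
        go (no ¬w) = trans (ring-quinv-plain Rg ¬w) (cong₂ _+_ (cong quinv (sym ρ≡))
            (trans (cong (λ τ → up τ v r) (sym ρ≡)) (cong₂ (up ρ) (sym (proj₁ (target-plain σ u ¬w))) (sym (proj₂ (target-plain σ u ¬w))))))
          where
          ρ≡ : ρ ≡ R σ u
          ρ≡ = R′-plain σ u ¬w
        go (yes wr) = trans (linear (cong₂ _+_ (cong₂ _+_ ringing (sym (proj₂ moves top₁))) (sym M.right≡left))
            (regroup (quinv σ) d (sameHeightRight v) (quinv σ₁) (Σᶜ (arm σ₁ v (suc (height v)) (height v) 1)) (sameHeightLeft v) (potential ρ w) (toℕ w) (toℕ v)))
            (cong (quinv ρ +_) (sym up≡))
          where
          open Wrapped wr
          ringing : quinv σ + (d + sameHeightRight v) ≡ quinv σ₁ + (Σᶜ (arm σ₁ v (suc (height v)) (height v) 1) + sameHeightLeft v)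
          ringing = trans (ring-quinv-wraps Rg wr) (cong (λ k → quinv σ₁ + (k + sameHeightLeft v))
            (trans (cong (up σ₁ v) (proj₁ wr)) (cong (λ a → Σᶜ (arm σ₁ v (suc (height v)) (height v) a)) top₁)))
          up≡ : up ρ (col y) (row y) ≡ Σᶜ (arm ρ w (suc (height w)) (height w) 1)
          up≡ = trans (cong₂ (up ρ) (proj₁ (target-wraps σ u wr)) (proj₂ (target-wraps σ u wr)))
            (cong (λ a → Σᶜ (arm ρ w (suc (height w)) (height w) a)) topρ)
          regroup : ∀ qσ d r q₁ a l p w v → qσ + d + (q₁ + (a + l) + (p + w) + (v + r)) ≡ p + (qσ + (d + r) + (q₁ + a + v) + (w + l))
          regroup = solve-∀

      module _ {a ℓ} (M : CommutativeMonoid a ℓ) (X : Fin n → CommutativeMonoid.Carrier M) where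
        open Content M X
        private module Mo = CommutativeMonoid M

        -- Cross-multiplied, so that it makes sense in a monoid without inverses.
        contents : content ρ Mo.∙ X (σ ! u) Mo.≈ content σ Mo.∙ X (ρ ! y)
        contents = Mo.trans (Mo.∙-congˡ (Mo.reflexive (sym (atEntry-value σ u))))
          (Mo.trans (go (wraps? σ v r)) (Mo.∙-congˡ (Mo.reflexive (atEntry-value ρ y))))
          where
          go : Dec (Wraps σ v r) → content ρ Mo.∙ atEntry (value σ u) Mo.≈ content σ Mo.∙ atEntry (value ρ y)
          go (no ¬w) = Mo.trans (Mo.∙-congʳ (Mo.reflexive (cong content (R′-plain σ u ¬w))))
            (Mo.trans (ring-content Rg) (Mo.∙-congˡ (Mo.reflexive (cong atEntry
              (trans (cong (λ τ → entry τ r v) (sym (R′-plain σ u ¬w)))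
                (sym (at-y (proj₁ (target-plain σ u ¬w)) (proj₂ (target-plain σ u ¬w)))))))))
          go (yes wr) = Mo.trans (Mo.∙-congʳ (Mo.trans (Mo.reflexive (cong content R′≡)) (moveTo-content M X (toℕ v) (toℕ w) σ₁)))
            (Mo.trans (ring-content Rg) (Mo.∙-congˡ (Mo.reflexive (cong atEntry
              (trans (proj₂ (ring-wraps⇒ Rg wr)) (sym value-y))))))
            where open Wrapped wr

    mirror-injective : ∀ {v₁ v₂} → mirror v₁ ≡ mirror v₂ → v₁ ≡ v₂
    mirror-injective {v₁} {v₂} eq = Fₚ.toℕ-injective (trans (Reflection.v≡ (reflection v₁))
      (trans (cong reflect eq) (sym (Reflection.v≡ (reflection v₂)))))

    mirror-involutive : ∀ v → mirror (mirror v) ≡ v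
    mirror-involutive v = Fₚ.toℕ-injective (trans (Reflection.w≡ (reflection (mirror v))) (sym (Reflection.v≡ (reflection v))))

    private
      fromRings : ∀ {σ₁ σ₂ ρ c r} u₁ u₂ → col u₁ ≡ c → col u₂ ≡ c →
        Ring σ₁ ρ c (row u₁) r → Ring σ₂ ρ c (row u₂) r → (σ₁ , u₁) ≡ (σ₂ , u₂)
      fromRings {σ₁} {σ₂} {ρ} {c} {r} u₁ u₂ eq₁ eq₂ Rg₁ Rg₂ = cong₂ _,_
        (ring-source-unique Rg₁ (subst (λ k → Ring σ₂ ρ c k r) (sym rows) Rg₂))
        (cell-≡ (trans eq₁ (sym eq₂)) rows)
        where
        rows : row u₁ ≡ row u₂
        rows = ring-start-unique Rg₁ Rg₂

    target-injective : ∀ {σ₁ u₁ σ₂ u₂} → Enabled σ₁ u₁ → Enabled σ₂ u₂ →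
      R′ σ₁ u₁ ≡ R′ σ₂ u₂ → target σ₁ u₁ ≡ target σ₂ u₂ → (σ₁ , u₁) ≡ (σ₂ , u₂)
    target-injective {σ₁} {u₁} {σ₂} {u₂} en₁ en₂ ρ≡ y≡ = go (wraps? σ₁ v₁ r₁) (wraps? σ₂ v₂ r₂)
      where
      v₁ v₂ : Column
      v₁ = col u₁
      v₂ = col u₂
      r₁ r₂ : ℕ
      r₁ = ringTop σ₁ u₁
      r₂ = ringTop σ₂ u₂
      Rg₁ = R-ring σ₁ u₁ en₁
      Rg₂ = R-ring σ₂ u₂ en₂
      -- A transition with a move ends at a top entry 1. A plain one with the same result and target
      -- would then have turned a top entry n, which is the excluded case.
      mixed : ∀ {σ u σ′ u′} → Enabled σ u → Wraps σ (col u) (ringTop σ u) → ¬ Wraps σ′ (col u′) (ringTop σ′ u′) →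
        Ring σ′ (R σ′ u′) (col u′) (row u′) (ringTop σ′ u′) → R′ σ u ≡ R′ σ′ u′ → target σ u ≡ target σ′ u′ → (σ , u) ≡ (σ′ , u′)
      mixed {σ} {u} {σ′} {u′} en wr ¬wr Rg′ ρ≡ y≡ = contradiction (ring-wraps⇐ Rg′ (r≡h , one)) ¬wr
        where
        open Forward σ u en
        open Wrapped wr
        eqc : col u′ ≡ mirror (col u)
        eqc = trans (sym (proj₁ (target-plain σ′ u′ ¬wr))) (trans (cong col (sym y≡)) (proj₁ (target-wraps σ u wr)))
        eqr : ringTop σ′ u′ ≡ height (mirror (col u))
        eqr = trans (sym (proj₂ (target-plain σ′ u′ ¬wr))) (trans (cong row (sym y≡)) (proj₂ (target-wraps σ u wr)))
        r≡h : ringTop σ′ u′ ≡ height (col u′)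
        r≡h = trans eqr (cong height (sym eqc))
        one : entry (R σ′ u′) (ringTop σ′ u′) (col u′) ≡ 1
        one = trans (cong (λ τ → entry τ (ringTop σ′ u′) (col u′)) (trans (sym (R′-plain σ′ u′ ¬wr)) (sym ρ≡)))
          (trans (cong₂ (entry (R′ σ u)) eqr eqc) topρ)
      go : Dec (Wraps σ₁ v₁ r₁) → Dec (Wraps σ₂ v₂ r₂) → (σ₁ , u₁) ≡ (σ₂ , u₂)
      go (yes w₁) (no ¬w₂) = mixed en₁ w₁ ¬w₂ Rg₂ ρ≡ y≡
      go (no ¬w₁) (yes w₂) = sym (mixed en₂ w₂ ¬w₁ Rg₁ (sym ρ≡) (sym y≡))
      go (no ¬w₁) (no ¬w₂) = fromRings u₁ u₂ refl (sym eqc) Rg₁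
          (subst₂ (λ τ c → Ring σ₂ τ c (row u₂) r₁) (sym R≡) (sym eqc) (subst (Ring σ₂ (R σ₂ u₂) v₂ (row u₂)) (sym eqr) Rg₂))
        where
        eqc : v₁ ≡ v₂
        eqc = trans (sym (proj₁ (target-plain σ₁ u₁ ¬w₁))) (trans (cong col y≡) (proj₁ (target-plain σ₂ u₂ ¬w₂)))
        eqr : r₁ ≡ r₂
        eqr = trans (sym (proj₂ (target-plain σ₁ u₁ ¬w₁))) (trans (cong row y≡) (proj₂ (target-plain σ₂ u₂ ¬w₂)))
        R≡ : R σ₁ u₁ ≡ R σ₂ u₂
        R≡ = trans (sym (R′-plain σ₁ u₁ ¬w₁)) (trans ρ≡ (R′-plain σ₂ u₂ ¬w₂))
      -- The mirror image determines the original column; undoing the same move on both sides leaves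
      -- two rung fillings to compare.
      go (yes w₁) (yes w₂) = fromRings u₁ u₂ refl (sym eqc) Rg₁
          (subst₂ (λ τ c → Ring σ₂ τ c (row u₂) r₁) (sym R≡) (sym eqc)
            (subst (Ring σ₂ (R σ₂ u₂) v₂ (row u₂)) (trans (proj₁ w₂) (trans (cong height (sym eqc)) (sym (proj₁ w₁)))) Rg₂))
        where
        eqc : v₁ ≡ v₂
        eqc = mirror-injective (trans (sym (proj₁ (target-wraps σ₁ u₁ w₁))) (trans (cong col y≡) (proj₁ (target-wraps σ₂ u₂ w₂))))
        back : ∀ σ u (en : Enabled σ u) → Wraps σ (col u) (ringTop σ u) →
          moveTo (toℕ (mirror (col u))) (toℕ (col u)) (R′ σ u) ≡ R σ u
        back σ u en wr = trans (cong (moveTo (toℕ (mirror (col u))) (toℕ (col u))) (Forward.Wrapped.R′≡ σ u en wr)) (moveTo-inverse (toℕ (col u)) (toℕ (mirror (col u))) (R σ u))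
        R≡ : R σ₁ u₁ ≡ R σ₂ u₂
        R≡ = trans (sym (back σ₁ u₁ en₁ w₁)) (trans (cong₂ (λ c τ → moveTo (toℕ (mirror c)) (toℕ c) τ) eqc ρ≡) (back σ₂ u₂ en₂ w₂))

    private
      rung : ∀ ρ c r → 1 ≤ r → r ≤ height c → entry ρ (suc r) c ≢ entry ρ r c →
        ∃₂ λ σ u → col u ≡ c × Ring σ ρ c (row u) r
      rung ρ c r 1≤r r≤h ne with σ , r′ , Rg ← ring-exists ρ c 1≤r r≤h ne
        with u , colu , rowu , _ ← entry-cell c (Ring.1≤r′ Rg) (≤-trans (Ring.r′≤r Rg) (Ring.fits Rg)) =
        σ , u , colu , subst (λ k → Ring σ ρ c k r) (sym rowu) Rg

    -- Whether `y` is a top cell with entry 1 decides if a move has to be undone before the path is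
    -- rung backwards.
    target-surjective : ∀ ρ y → Covered ρ y → ∃₂ λ σ u → Enabled σ u × R′ σ u ≡ ρ × target σ u ≡ y
    target-surjective ρ y ne = go (row y ≟ height c ×-dec value ρ y ≟ 1)
      where
      c : Column
      c = col y
      go : Dec (AtTopOne ρ c (row y)) → ∃₂ λ σ u → Enabled σ u × R′ σ u ≡ ρ × target σ u ≡ y
      go (no ¬t) = let σ , u , colu , Rg = rung ρ c (row y) (1≤row y) (row≤height y) ne in
        plain σ u colu (subst (λ k → Ring σ ρ k (row u) (row y)) (sym colu) Rg)
        where
        plain : ∀ σ u → col u ≡ c → Ring σ ρ (col u) (row u) (row y) → ∃₂ λ σ u → Enabled σ u × R′ σ u ≡ ρ × target σ u ≡ y
        plain σ u colu Rg = σ , u , ring⇒enabled Rg , trans (R′-plain σ u ¬w) (ring⇒R Rg)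
          , cell-≡ (trans (proj₁ (target-plain σ u ¬w)) colu) (trans (proj₂ (target-plain σ u ¬w)) (ring⇒ringTop Rg))
          where
          ¬w : ¬ Wraps σ (col u) (ringTop σ u)
          ¬w wr = ¬t (subst (λ k → AtTopOne ρ k (row y)) colu (ring-wraps⇒ Rg (subst (Wraps σ (col u)) (ring⇒ringTop Rg) wr)))
      go (yes (r≡h , eq1)) = let σ , u , colu , Rg = rung ρ₁ v (height v) (positive v) ≤-refl ne₁ in wrapped σ u colu Rg
        where
        v : Column
        v = mirror c
        module M = Reflection (reflection c)
        ρ₁ : Tab
        ρ₁ = moveTo (toℕ c) (toℕ v) ρ
        top₁ : topEntry ρ₁ v ≡ 1
        top₁ = trans (proj₁ (moveTo-moves c v M.height≡ ρ)) (trans (cong (λ i → entry ρ i c) (sym r≡h)) eq1)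
        ne₁ : entry ρ₁ (suc (height v)) v ≢ entry ρ₁ (height v) v
        ne₁ eq = contradiction (trans (sym (entry-above ρ₁ v ≤-refl)) (trans eq top₁)) λ ()
        wrapped : ∀ σ u → col u ≡ v → Ring σ ρ₁ v (row u) (height v) → ∃₂ λ σ u → Enabled σ u × R′ σ u ≡ ρ × target σ u ≡ y
        wrapped σ u colu Rg = σ , u , ring⇒enabled Rg′ , R′≡ρ , cell-≡ (trans (proj₁ tw) w≡c) (trans (proj₂ tw) (trans (cong height w≡c) (sym r≡h)))
          where
          Rg′ : Ring σ ρ₁ (col u) (row u) (height v)
          Rg′ = subst (λ k → Ring σ ρ₁ k (row u) (height v)) (sym colu) Rg
          wr : Wraps σ (col u) (ringTop σ u)
          wr = subst₂ (Wraps σ) (sym colu) (sym (ring⇒ringTop Rg′)) (ring-wraps⇐ Rg (refl , top₁))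
          tw = target-wraps σ u wr
          w≡c : mirror (col u) ≡ c
          w≡c = trans (cong mirror colu) (mirror-involutive c)
          R′≡ρ : R′ σ u ≡ ρ
          R′≡ρ = trans (Forward.Wrapped.R′≡ σ u (ring⇒enabled Rg′) wr)
            (trans (cong₂ (λ k τ → moveTo (toℕ k) (toℕ (mirror k)) τ) colu (ring⇒R Rg′))
              (trans (cong (λ k → moveTo (toℕ v) (toℕ k) ρ₁) (mirror-involutive c)) (moveTo-inverse (toℕ c) (toℕ v) ρ)))

  -- Every filling and every cell is listed exactly once.

  module Enumeration (Λ : Partition) (n : ℕ) .{{_ : NonZero n}} where
    open Tableaux Λ n

    -- The auxiliary enumerations behind allTabs have no names; they are
    -- recovered by unification. In tabs-suc the words of length h occur below
    -- allFin n, on which cartesianProductWith is stuck.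
    mutual
      tabs : ∀ {m} (hs : Vec ℕ m) → List (All (Vec (Fin n)) hs)
      tabs = _

      tabs-parts : tabs parts ≡ allTabs
      tabs-parts with length | parts
      ... | m | hs = refl {x = tabs hs}

    mutual
      words : (h : ℕ) → List (Vec (Fin n) h)
      words = _

      tabs-suc : ∀ {m} h (hs : Vec ℕ m) →
        tabs (suc h ∷ hs) ≡ cartesianProductWith _∷_ (cartesianProductWith _∷_ (allFin n) (words h)) (tabs hs)
      tabs-suc h hs = refl

    words-complete : ∀ {h} (w : Vec (Fin n) h) → w ∈ words h
    words-complete []      = here refl
    words-complete (k ∷ w) = ∈-cartesianProductWith⁺ _∷_ (∈-allFin k) (words-complete w)

    words-unique : ∀ h → Unique (words h)
    words-unique zero    = ListAll.[] AllPairs.∷ AllPairs.[]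
    words-unique (suc h) = cartesianProductWith⁺ _∷_ (λ { refl → refl , refl }) (allFin⁺ n) (words-unique h)

    tabs-complete : ∀ {m} {hs : Vec ℕ m} (σ : All (Vec (Fin n)) hs) → σ ∈ tabs hs
    tabs-complete []      = here refl
    tabs-complete (w ∷ σ) = ∈-cartesianProductWith⁺ _∷_ (words-complete w) (tabs-complete σ)

    tabs-unique : ∀ {m} (hs : Vec ℕ m) → Unique (tabs hs)
    tabs-unique []       = ListAll.[] AllPairs.∷ AllPairs.[]
    tabs-unique (h ∷ hs) = cartesianProductWith⁺ _∷_ (λ { refl → refl , refl }) (words-unique h) (tabs-unique hs)

    allTabs-complete : ∀ σ → σ ∈ allTabs
    allTabs-complete σ = subst (σ ∈_) tabs-parts (tabs-complete σ)

    allTabs-unique : Unique allTabs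
    allTabs-unique = subst Unique tabs-parts (tabs-unique parts)

    cells-complete : ∀ u → u ∈ cells
    cells-complete (c , r) = ∈-concatMap⁺ (λ c → L.map (c ,_) (allFin (height c))) (lose (∈-allFin c) (∈-map⁺ (c ,_) (∈-allFin r)))

    cells-unique : Unique cells
    cells-unique = concat⁺
      (ListAllₚ.map⁺ (ListAll.tabulate (λ {c} _ → map-unique {f = c ,_} (λ { _ _ refl → refl }) (allFin⁺ (height c)))))
      (AllPairsₚ.map⁺ (AllPairs.map disjoint (allFin⁺ length)))
      where
      disjoint : ∀ {c c′} → c ≢ c′ → Disjoint (L.map (c ,_) (allFin (height c))) (L.map (c′ ,_) (allFin (height c′)))
      disjoint c≢c′ (p , p′) with _ , _ , refl ← ∈-map⁻ _ p | _ , _ , refl ← ∈-map⁻ _ p′ = c≢c′ refl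

  module _ {a ℓ} (𝓡 : CommutativeRing a ℓ) where
    open CommutativeRing 𝓡 using (_≈_; Carrier) renaming (_*_ to _⊛_)
    private
      module 𝓡 = CommutativeRing 𝓡
      module S = Sums 𝓡.+-commutativeMonoid

    sum-*ˡ : ∀ {A : Set} (xs : List A) b (f : A → Carrier) → b ⊛ S.sum xs f ≈ S.sum xs (λ x → b ⊛ f x)
    sum-*ˡ []       b f = 𝓡.zeroʳ b
    sum-*ˡ (x ∷ xs) b f = 𝓡.trans (𝓡.distribˡ b (f x) _) (𝓡.+-congˡ (sum-*ˡ xs b f))

  -- Outflow equals inflow, row by row and value by value.

  module Balance {a ℓ} (𝓡 : CommutativeRing a ℓ) (Λ : Partition) (n : ℕ) .{{_ : NonZero n}}
    (X : Fin n → CommutativeRing.Carrier 𝓡) (t : CommutativeRing.Carrier 𝓡) where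
    open Tableaux Λ n
    open Fillings Λ n
    open Counting Λ n
    open Correspondence Λ n
    private
      module 𝓡 = CommutativeRing 𝓡
    open 𝓡 using (Carrier; _≈_; 0#) renaming (_+_ to _⊕_; _*_ to _⊛_)
    open Exp 𝓡.semiring using (_^_)
    module S = Sums 𝓡.+-commutativeMonoid

    when-*ˡ : ∀ {p} {P : Set p} (d : Dec P) b {c} → b ⊛ (c S.when d) ≈ (b ⊛ c) S.when d
    when-*ˡ (yes _) b = 𝓡.refl
    when-*ˡ (no _)  b = 𝓡.zeroʳ b

    -- The t-integer 1 + t + ... + t^(m-1): a potential whose increment at m is t^m.
    geometric : ℕ → Carrier
    geometric zero    = 0#
    geometric (suc m) = geometric m ⊕ t ^ m

    module _ (ρ : Tab) where

      module _ (k : Fin n) where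
        val : ℕ
        val = suc (toℕ k)

        at : ℕ → Column → ℕ
        at s c = ⟦ entry ρ s c ≟ val ⟧

        -- Both `down` of the cell in row `s + 1` and `up` of the cell in row `s` of column `c`, for
        -- cells of value `val`. Rises are the enabled cells of row `s + 1`, falls the covered cells
        -- of row `s`.
        exponent : ℕ → Column → ℕ
        exponent s c = Σᶜ (arm ρ c (suc s) s val)

        Rise? : ∀ s c → Dec (entry ρ (suc s) c ≡ val × entry ρ s c ≢ val)
        Rise? s c = entry ρ (suc s) c ≟ val ×-dec ¬? (entry ρ s c ≟ val)

        Fall? : ∀ s c → Dec (entry ρ s c ≡ val × entry ρ (suc s) c ≢ val)
        Fall? s c = entry ρ s c ≟ val ×-dec ¬? (entry ρ (suc s) c ≟ val)

        rise fall : ℕ → Column → Carrier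
        rise s c = t ^ exponent s c S.when Rise? s c
        fall s c = t ^ exponent s c S.when Fall? s c

        -- The number of cells with value val in row s + 1 left of position i
        -- or in row s from position i on. As i runs through the columns it
        -- goes up at the rises and down at the falls.
        walkAt : ℕ → ℕ → Column → ℕ
        walkAt s i j = (at (suc s) j when (toℕ j <? i)) + (at s j when (i ≤? toℕ j))

        walk : ℕ → ℕ → ℕ
        walk s i = Σᶜ (walkAt s i)

        private
          split-at : ∀ s c s′ i → (∀ {j} → j ≢ c → walkAt s i j ≡ arm ρ c (suc s) s val j) → walkAt s i c ≡ at s′ c →
            walk s i ≡ exponent s c + at s′ c
          split-at s c s′ i off on = trans (sym (+-identityʳ (walk s i))) (sum-one {p = c} (walkAt s i) (arm ρ c (suc s) s val) off
            (trans (+-identityʳ _) (trans on (cong (_+ at s′ c)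
              (sym (cong₂ _+_ (when-no (c Fₚ.<? c) (Fₚ.<-irrefl refl)) (when-no (c Fₚ.<? c) (Fₚ.<-irrefl refl))))))))

        walk-before : ∀ s c → walk s (toℕ c) ≡ exponent s c + at s c
        walk-before s c = split-at s c s (toℕ c)
          (λ {j} j≢c → cong₂ _+_ (when-cong (toℕ j <? toℕ c) (j Fₚ.<? c) id id (λ _ → refl))
            (when-cong (toℕ c ≤? toℕ j) (c Fₚ.<? j) (λ c≤j → ≤∧≢⇒< c≤j (j≢c ∘ sym ∘ Fₚ.toℕ-injective)) <⇒≤ (λ _ → refl)))
          (cong₂ _+_ (when-no (toℕ c <? toℕ c) (n≮n _)) (when-yes (toℕ c ≤? toℕ c) ≤-refl))

        walk-after : ∀ s c → walk s (suc (toℕ c)) ≡ exponent s c + at (suc s) c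
        walk-after s c = split-at s c (suc s) (suc (toℕ c))
          (λ {j} j≢c → cong₂ _+_
            (when-cong (toℕ j <? suc (toℕ c)) (j Fₚ.<? c) (λ j≤c → ≤∧≢⇒< (≤-pred j≤c) (j≢c ∘ Fₚ.toℕ-injective)) m≤n⇒m≤1+n (λ _ → refl))
            (when-cong (suc (toℕ c) ≤? toℕ j) (c Fₚ.<? j) id id (λ _ → refl)))
          (trans (cong₂ _+_ (when-yes (toℕ c <? suc (toℕ c)) ≤-refl) (when-no (suc (toℕ c) ≤? toℕ c) (n≮n _))) (+-identityʳ _))

        -- Apart from column `c` itself the walk counts `exponent s c` cells before and after. At a
        -- rise or a fall it moves between e and e + 1, where `geometric` changes by t^e; otherwise
        -- it stands still.
        step : ∀ s c → rise s c ⊕ geometric (walk s (toℕ c)) ≈ fall s c ⊕ geometric (walk s (suc (toℕ c)))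
        step s c = 𝓡.trans (𝓡.+-congˡ (𝓡.reflexive (cong geometric (walk-before s c))))
          (𝓡.trans (go (entry ρ (suc s) c ≟ val) (entry ρ s c ≟ val)) (𝓡.+-congˡ (𝓡.reflexive (cong geometric (sym (walk-after s c))))))
          where
          e : ℕ
          e = exponent s c
          go : ∀ {P Q : Set} (d : Dec P) (d′ : Dec Q) →
            (t ^ e S.when (d ×-dec ¬? d′)) ⊕ geometric (e + ⟦ d′ ⟧) ≈ (t ^ e S.when (d′ ×-dec ¬? d)) ⊕ geometric (e + ⟦ d ⟧)
          go (yes _) (yes _) = 𝓡.refl
          go (no _)  (no _)  = 𝓡.refl
          go (yes _) (no _)  rewrite +-identityʳ e | +-comm e 1 = 𝓡.trans (𝓡.+-comm _ _) (𝓡.sym (𝓡.+-identityˡ _))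
          go (no _)  (yes _) rewrite +-identityʳ e | +-comm e 1 = 𝓡.trans (𝓡.+-identityˡ _) (𝓡.+-comm _ _)

        count : ℕ → ℕ
        count s = Σᶜ (at s)

        count≡0 : ∀ s → (∀ c → entry ρ s c ≡ 0) → count s ≡ 0
        count≡0 s eq = sum-ε (allFin length) (λ {c} _ → ⟦⟧-no (entry ρ s c ≟ val) (λ p → contradiction (trans (sym (eq c)) p) λ ()))

        row-balance : ∀ s → S.sum (allFin length) (rise s) ⊕ geometric (count s) ≈ S.sum (allFin length) (fall s) ⊕ geometric (count (suc s))
        row-balance s = 𝓡.trans (𝓡.+-congˡ (𝓡.reflexive (cong geometric start)))
          (𝓡.trans (S.telescope length (rise s) (fall s) (geometric ∘ walk s) (step s)) (𝓡.+-congˡ (𝓡.reflexive (cong geometric end))))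
          where
          start : count s ≡ walk s 0
          start = sum-cong (allFin length) (λ _ → refl)
          end : walk s length ≡ count (suc s)
          end = sum-cong (allFin length) (λ j → trans (cong₂ _+_ (when-yes (toℕ j <? length) (Fₚ.toℕ<n j)) (when-no (length ≤? toℕ j) (<⇒≱ (Fₚ.toℕ<n j)))) (+-identityʳ _))

        module _ (H : ℕ) (bound : ∀ c → height c ≤ H) where

          rise-above : ∀ c {s} → height c ≤ s → rise s c ≈ 0#
          rise-above c {s} h≤s = 𝓡.reflexive (S.when-no (Rise? s c) (λ (eq , _) → contradiction (trans (sym (entry-above ρ c (s≤s h≤s))) eq) λ ()))

          fall-above : ∀ c {s} → height c ≤ s → fall (suc s) c ≈ 0#
          fall-above c {s} h≤s = 𝓡.reflexive (S.when-no (Fall? (suc s) c) (λ (eq , _) → contradiction (trans (sym (entry-above ρ c (s≤s h≤s))) eq) λ ()))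

          -- A second telescoping, over the rows: neither row 0 nor the row above all columns
          -- contains the value.
          all-rows : S.sumFin (suc H) (λ s → S.sum (allFin length) (rise s)) ≈ S.sumFin (suc H) (λ s → S.sum (allFin length) (fall s))
          all-rows = 𝓡.trans (𝓡.sym (𝓡.+-identityʳ _)) (𝓡.trans (𝓡.+-congˡ (𝓡.reflexive (cong geometric (sym (count≡0 0 (λ _ → refl))))))
            (𝓡.trans (S.telescopeFin (suc H) _ _ (geometric ∘ count) (λ {s} _ → row-balance s))
              (𝓡.trans (𝓡.+-congˡ (𝓡.reflexive (cong geometric (count≡0 (suc H) (λ c → entry-above ρ c (s≤s (bound c))))))) (𝓡.+-identityʳ _))))

          rises-≈ : S.sum cells (λ u → rise (toℕ (proj₂ u)) (col u)) ≈ S.sumFin (suc H) (λ s → S.sum (allFin length) (rise s))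
          rises-≈ = 𝓡.trans (sum-cells 𝓡.+-commutativeMonoid _) (𝓡.trans
            (S.sum-cong (allFin length) (λ c → S.sumFin-extend {f = λ s → rise s c} (m≤n⇒m≤1+n (bound c)) (rise-above c)))
            (S.sum-comm (allFin length) (allFin (suc H)) (λ c s → rise (toℕ s) c)))

          -- Falls are indexed by the row of their cell, rises by the row below theirs. The extra
          -- index 0 contributes nothing, since row 0 reads 0.
          falls-≈ : S.sum cells (λ u → fall (row u) (col u)) ≈ S.sumFin (suc H) (λ s → S.sum (allFin length) (fall s))
          falls-≈ = 𝓡.trans (sum-cells 𝓡.+-commutativeMonoid _) (𝓡.trans
            (S.sum-cong (allFin length) (λ c → S.sumFin-extend {f = λ s → fall (suc s) c} (bound c) (fall-above c)))
            (𝓡.trans (S.sum-comm (allFin length) (allFin H) (λ c s → fall (suc (toℕ s)) c))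
              (𝓡.trans (𝓡.sym (𝓡.+-identityˡ _)) (𝓡.trans (𝓡.+-congʳ (𝓡.sym bottom)) (𝓡.sym (𝓡.reflexive (S.sum-allFin H (λ s → S.sum (allFin length) (fall (toℕ s))))))))))
            where
            bottom : S.sum (allFin length) (fall 0) ≈ 0#
            bottom = S.sum-ε (allFin length) (λ _ → 𝓡.refl)

      bounded : ∃ λ H → ∀ c → height c ≤ H
      -- The sum of the heights is a crude bound, but it needs no special case for the empty
      -- partition.
      bounded = Σᶜ height , λ c → ≤-trans (m≤m+n (height c) _) (≤-reflexive (sym (sum-remove Fₚ._≟_ height (allFin⁺ length) (∈-allFin c))))

      rises≈falls : ∀ k → S.sum cells (λ u → rise k (toℕ (proj₂ u)) (col u)) ≈ S.sum cells (λ u → fall k (row u) (col u))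
      rises≈falls k with H , bound ← bounded = 𝓡.trans (rises-≈ k H bound) (𝓡.trans (all-rows k H bound) (𝓡.sym (falls-≈ k H bound)))

      private
        by-value : ∀ u (f : Fin n → Carrier) {b} → (∀ {k} → k ≢ ρ ! u → f k ≈ 0#) → b ≈ f (ρ ! u) →
          b ≈ S.sum (allFin n) f
        by-value u f off on = 𝓡.trans on (𝓡.sym (S.sum-delta Fₚ._≟_ f (allFin⁺ n) (∈-allFin (ρ ! u)) (λ k → off)))

        val≡ : ∀ u → value ρ u ≡ val (ρ ! u)
        val≡ u = value-≡ ρ u

      -- On the right, the transitions into ρ are indexed by their targets.
      outflow≈inflow :
        S.sum cells (λ u → (X (ρ ! u) ⊛ t ^ down ρ u) S.when enabled? ρ u) ≈
        S.sum cells (λ y → (X (ρ ! y) ⊛ t ^ up ρ (col y) (row y)) S.when covered? ρ y)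
      outflow≈inflow = 𝓡.trans (S.sum-cong cells out) (𝓡.trans (S.sum-comm cells (allFin n) (λ u k → X k ⊛ rise k (toℕ (proj₂ u)) (col u)))
        (𝓡.trans (S.sum-cong (allFin n) (λ k → 𝓡.trans (𝓡.sym (sum-*ˡ 𝓡 cells (X k) (λ u → rise k (toℕ (proj₂ u)) (col u)))) (𝓡.trans (𝓡.*-congˡ (rises≈falls k)) (sum-*ˡ 𝓡 cells (X k) (λ u → fall k (row u) (col u))))))
          (𝓡.trans (S.sum-comm (allFin n) cells (λ k u → X k ⊛ fall k (row u) (col u))) (S.sum-cong cells (λ y → 𝓡.sym (in′ y))))))
        where
        val-injective : ∀ u {k} → k ≢ ρ ! u → value ρ u ≢ val k
        val-injective u k≢ eq = k≢ (Fₚ.toℕ-injective (suc-injective (trans (sym eq) (val≡ u))))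
        out : ∀ u → (X (ρ ! u) ⊛ t ^ down ρ u) S.when enabled? ρ u ≈ S.sum (allFin n) (λ k → X k ⊛ rise k (toℕ (proj₂ u)) (col u))
        out u@(c , r) = by-value u _
          (λ {k} k≢ → 𝓡.trans (𝓡.*-congˡ (𝓡.reflexive (S.when-no (Rise? k (toℕ r) c) (λ (eq , _) → val-injective u k≢ eq)))) (𝓡.zeroʳ _))
          (𝓡.trans (S.when-cong (enabled? ρ u) (Rise? k₀ (toℕ r) c)
              (λ en → val≡ u , λ eq → enabled⇒ ρ u en (trans eq (sym (val≡ u))))
              (λ (_ , ne) → ⇒enabled ρ u (λ eq → ne (trans eq (val≡ u))))
              (λ _ → 𝓡.*-congˡ (𝓡.reflexive (cong (t ^_) (trans (down-columns ρ u) (cong (λ a → Σᶜ (arm ρ c (suc (toℕ r)) (toℕ r) a)) (val≡ u)))))))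
            (𝓡.sym (when-*ˡ (Rise? k₀ (toℕ r) c) (X k₀))))
          where
          k₀ : Fin n
          k₀ = ρ ! u
        in′ : ∀ y → (X (ρ ! y) ⊛ t ^ up ρ (col y) (row y)) S.when covered? ρ y ≈ S.sum (allFin n) (λ k → X k ⊛ fall k (row y) (col y))
        in′ y@(c , r) = by-value y _
          (λ {k} k≢ → 𝓡.trans (𝓡.*-congˡ (𝓡.reflexive (S.when-no (Fall? k (row y) c) (λ (eq , _) → val-injective y k≢ eq)))) (𝓡.zeroʳ _))
          (𝓡.trans (S.when-cong (covered? ρ y) (Fall? k₀ (row y) c)
              (λ ne → val≡ y , λ eq → ne (trans eq (sym (val≡ y))))
              (λ (_ , ne) eq → ne (trans eq (val≡ y)))
              (λ _ → 𝓡.*-congˡ (𝓡.reflexive (cong (λ a → t ^ Σᶜ (arm ρ c (suc (row y)) (row y) a)) (val≡ y)))))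
            (𝓡.sym (when-*ˡ (Fall? k₀ (row y) c) (X k₀))))
          where
          k₀ : Fin n
          k₀ = ρ ! y

module Chain where
  open Summation
  open Combinatorics
  open import Algebra.Bundles using (CommutativeRing)
  import Algebra.Properties.Ring
  import Algebra.Properties.CommutativeSemigroup
  import Algebra.Properties.Semiring.Exp as Exp
  open import Data.Fin as F using (toℕ; fromℕ<)
  open import Data.List as L using (List; []; _∷_; filter; cartesianProduct)
  open import Data.List.Membership.Propositional using (_∈_)
  open import Data.List.Membership.Propositional.Properties
  open import Data.List.Relation.Binary.Permutation.Propositional using (_↭_)
  open import Data.List.Relation.Unary.Unique.Propositional.Properties
    using (filter⁺; cartesianProduct⁺)
  open import Data.Nat as ℕ using (zero; suc)
  open import Data.Product using (∃; uncurry; proj₁; proj₂; ∃₂)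
  open import Data.Sum using (_⊎_; inj₁; inj₂)
  open import Function using (_∘_)
  open import Relation.Binary.PropositionalEquality as ≡ using (_≡_)
  open import Data.List.Relation.Unary.Unique.Propositional using (Unique)
  open import Relation.Binary.Definitions using (DecidableEquality)
  open import Relation.Binary.Structures using (IsStrictPartialOrder)
  open import Relation.Nullary using (¬_; Dec; yes; no; contradiction)
  open import Relation.Nullary.Decidable using (_×-dec_)

  -- Signs in an ordered field whose order need not be decidable.

  module OrderedFieldProperties {a ℓ₁ ℓ₂} (F : OrderedField a ℓ₁ ℓ₂) where
    open OrderedField F hiding (_^_)
    open CommutativeRing commutativeRing using (ring)
    open Algebra.Properties.Ring ring using (-‿distribʳ-*; -‿involutive)
    open IsStrictPartialOrder isStrictPartialOrder public using ()
      renaming (irrefl to <-irrefl; trans to <-trans; <-respˡ-≈ to <-respˡ; <-respʳ-≈ to <-respʳ)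

    x-0≈x : ∀ x → x -ᶠ 0# ≈ x
    x-0≈x x = trans (+-congˡ (trans (sym (+-identityˡ _)) (-‿inverseʳ 0#))) (+-identityʳ x)

    *-inverse : ∀ {x} (x>0 : 0# <ᶠ x) → x *ᶠ inverse x>0 ≈ 1#
    *-inverse {x} x>0 with #⇒invertible (#-sym (<⇒# x>0))
    ... | y , _ , xy≈1 = trans (*-congʳ (sym (x-0≈x x))) xy≈1

    factor-# : ∀ {x y} → x *ᶠ y ≈ 1# → x # 0#
    factor-# {x} {y} xy≈1 = invertible⇒# (y , trans (*-congˡ (x-0≈x x)) (trans (*-comm y x) xy≈1) , trans (*-congʳ (x-0≈x x)) xy≈1)

    -- The substitute for comparing two elements, inherited from the cotransitivity of apartness.
    <-cotrans : ∀ {x y} → x <ᶠ y → ∀ z → x <ᶠ z ⊎ z <ᶠ y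
    <-cotrans x<y z with #-cotrans (<⇒# x<y) z
    ... | inj₁ x#z with #⇒<⊎> x#z
    ...   | inj₁ x<z = inj₁ x<z
    ...   | inj₂ z<x = inj₂ (<-trans z<x x<y)
    <-cotrans x<y z | inj₂ z#y with #⇒<⊎> z#y
    ...   | inj₁ z<y = inj₂ z<y
    ...   | inj₂ y<z = inj₁ (<-trans x<y y<z)

    +-cancelʳ-< : ∀ z {x y} → x +ᶠ z <ᶠ y +ᶠ z → x <ᶠ y
    +-cancelʳ-< z {x} {y} lt = <-respˡ (cancel x) (<-respʳ (cancel y) (+-monoˡ-< (-ᶠ z) lt))
      where
      cancel : ∀ w → w +ᶠ z +ᶠ -ᶠ z ≈ w
      cancel w = trans (+-assoc w z (-ᶠ z)) (trans (+-congˡ (-‿inverseʳ z)) (+-identityʳ w))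

    negate-negative : ∀ {x} → x <ᶠ 0# → 0# <ᶠ -ᶠ x
    negate-negative {x} x<0 = <-respˡ (-‿inverseʳ x) (<-respʳ (+-identityˡ (-ᶠ x)) (+-monoˡ-< (-ᶠ x) x<0))

    0<1 : 0# <ᶠ 1#
    0<1 with #⇒<⊎> (factor-# (*-identityʳ 1#))
    ... | inj₂ 0<1 = 0<1
    -- If 1 were negative, then 1, as the square of -1, would be positive.
    ... | inj₁ 1<0 = contradiction (<-trans (<-respʳ [-1]²≈1 (*-positive 0<-1 0<-1)) 1<0) (<-irrefl refl)
      where
      0<-1 : 0# <ᶠ -ᶠ 1#
      0<-1 = negate-negative 1<0
      [-1]²≈1 : -ᶠ 1# *ᶠ -ᶠ 1# ≈ 1#
      [-1]²≈1 = trans (sym (-‿distribʳ-* (-ᶠ 1#) 1#)) (trans (-‿cong (*-identityʳ (-ᶠ 1#))) (-‿involutive 1#))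

    >⇒≥ : ∀ {x} → 0# <ᶠ x → 0# ≤ᶠ x
    >⇒≥ 0<x x<0 = <-irrefl refl (<-trans 0<x x<0)

    +-nonneg : ∀ {x y} → 0# ≤ᶠ x → 0# ≤ᶠ y → 0# ≤ᶠ x +ᶠ y
    +-nonneg {x} {y} 0≤x 0≤y x+y<0 with <-cotrans x+y<0 y
    ... | inj₁ x+y<y = 0≤x (+-cancelʳ-< y (<-respʳ (sym (+-identityˡ y)) x+y<y))
    ... | inj₂ y<0   = 0≤y y<0

    positive+nonneg : ∀ {x y} → 0# <ᶠ x → 0# ≤ᶠ y → 0# <ᶠ x +ᶠ y
    positive+nonneg {x} {y} 0<x 0≤y with <-cotrans 0<x (x +ᶠ y)
    ... | inj₁ 0<x+y = 0<x+y
    ... | inj₂ x+y<x = contradiction (+-cancelʳ-< x (<-respˡ (+-comm x y) (<-respʳ (sym (+-identityˡ x)) x+y<x))) 0≤y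

    nonneg#⇒positive : ∀ {x} → 0# ≤ᶠ x → x # 0# → 0# <ᶠ x
    nonneg#⇒positive 0≤x x#0 with #⇒<⊎> x#0
    ... | inj₁ x<0 = contradiction x<0 0≤x
    ... | inj₂ 0<x = 0<x

    -- A negative product would be invertible. Then both factors are apart from 0, hence positive,
    -- and so is the product.
    *-nonneg : ∀ {x y} → 0# ≤ᶠ x → 0# ≤ᶠ y → 0# ≤ᶠ x *ᶠ y
    *-nonneg {x} {y} 0≤x 0≤y xy<0 with #⇒invertible (<⇒# xy<0)
    ... | z , _ , xyz≈1 = >⇒≥ (*-positive (nonneg#⇒positive 0≤x x#0) (nonneg#⇒positive 0≤y y#0)) xy<0
      where
      xy*z≈1 : x *ᶠ y *ᶠ z ≈ 1#
      xy*z≈1 = trans (*-congʳ (sym (x-0≈x (x *ᶠ y)))) xyz≈1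
      x#0 : x # 0#
      x#0 = factor-# (trans (sym (*-assoc x y z)) xy*z≈1)
      y#0 : y # 0#
      y#0 = factor-# (trans (sym (*-assoc y x z)) (trans (*-congʳ (*-comm y x)) xy*z≈1))

    inverse-nonneg : ∀ {x} (x>0 : 0# <ᶠ x) → 0# ≤ᶠ inverse x>0
    inverse-nonneg {x} x>0 i<0 = >⇒≥ (<-respʳ eq (*-positive x>0 (negate-negative i<0))) (<-respʳ (-‿inverseʳ 1#) (<-respˡ (+-identityˡ (-ᶠ 1#)) (+-monoˡ-< (-ᶠ 1#) 0<1)))
      where
      eq : x *ᶠ -ᶠ inverse x>0 ≈ -ᶠ 1#
      eq = trans (sym (-‿distribʳ-* x (inverse x>0))) (-‿cong (*-inverse x>0))

    ^-nonneg : ∀ {x} → 0# ≤ᶠ x → ∀ k → 0# ≤ᶠ OrderedField._^_ F x k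
    ^-nonneg 0≤x zero    = >⇒≥ 0<1
    ^-nonneg 0≤x (suc k) = *-nonneg 0≤x (^-nonneg 0≤x k)

    ∏-positive : ∀ {A : Set} (xs : List A) {f : A → Carrier} → (∀ x → 0# <ᶠ f x) → 0# <ᶠ ∏ xs f
    ∏-positive []       f>0 = 0<1
    ∏-positive (x ∷ xs) f>0 = *-positive (f>0 x) (∏-positive xs f>0)

    ∑-nonneg : ∀ {A : Set} (xs : List A) {f : A → Carrier} → (∀ x → 0# ≤ᶠ f x) → 0# ≤ᶠ ∑ xs f
    ∑-nonneg []       f≥0 = <-irrefl refl
    ∑-nonneg (x ∷ xs) f≥0 = +-nonneg (f≥0 x) (∑-nonneg xs f≥0)

  -- From global balance to stationarity.

  module _ {a ℓ₁ ℓ₂} (F : OrderedField a ℓ₁ ℓ₂) {State : Set} (_≟ˢ_ : DecidableEquality State) {states : List State}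
    (unique : Unique states) (complete : ∀ σ → σ ∈ states) (rate : State → State → OrderedField.Carrier F) where

    open OrderedField F
    open MarkovChain F _≟ˢ_ states rate
    open CommutativeRing commutativeRing using (ring; +-commutativeMonoid; *-commutativeSemigroup)
    open Algebra.Properties.Ring ring using (-‿distribʳ-*)
    open Algebra.Properties.CommutativeSemigroup *-commutativeSemigroup using (xy∙z≈xz∙y)
    open import Relation.Binary.Reasoning.Setoid setoid
    private module S = Sums +-commutativeMonoid

    generator-split : ∀ σ τ → generator σ τ ≈ rate σ τ +ᶠ (-ᶠ ∑ states (rate σ) S.when (σ ≟ˢ τ))
    generator-split σ τ with σ ≟ˢ τ
    ... | yes _ = refl
    ... | no  _ = sym (+-identityʳ _)

    -- By `generator-split` the generator is the rate minus the exit rate on the diagonal, so that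
    -- self-transitions enter inflow and outflow alike and cancel.
    balanced⇒stationary : ∀ (π : State → Carrier) c →
      (∀ τ → ∑ states (λ σ → π σ *ᶠ rate σ τ) ≈ π τ *ᶠ ∑ states (rate τ)) → IsStationary (λ σ → π σ *ᶠ c)
    balanced⇒stationary π c balance τ = begin
      ∑ states (λ σ → π σ *ᶠ c *ᶠ generator σ τ)
        ≈⟨ S.sum-cong states (λ σ → trans (*-congˡ (generator-split σ τ)) (distribˡ (π σ *ᶠ c) (rate σ τ) _)) ⟩
      ∑ states (λ σ → π σ *ᶠ c *ᶠ rate σ τ +ᶠ π σ *ᶠ c *ᶠ (loss σ S.when (σ ≟ˢ τ)))
        ≈⟨ S.sum-∙ states (λ σ → π σ *ᶠ c *ᶠ rate σ τ) (λ σ → π σ *ᶠ c *ᶠ (loss σ S.when (σ ≟ˢ τ))) ⟩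
      ∑ states (λ σ → π σ *ᶠ c *ᶠ rate σ τ) +ᶠ ∑ states (λ σ → π σ *ᶠ c *ᶠ (loss σ S.when (σ ≟ˢ τ)))
        ≈⟨ +-cong gain-part loss-part ⟩
      π τ *ᶠ c *ᶠ out +ᶠ π τ *ᶠ c *ᶠ loss τ
        ≈⟨ +-congˡ (sym (-‿distribʳ-* (π τ *ᶠ c) out)) ⟩
      π τ *ᶠ c *ᶠ out +ᶠ -ᶠ (π τ *ᶠ c *ᶠ out)
        ≈⟨ -‿inverseʳ _ ⟩
      0# ∎
      where
      loss : State → Carrier
      loss σ = -ᶠ ∑ states (rate σ)
      out : Carrier
      out = ∑ states (rate τ)
      gain-part : ∑ states (λ σ → π σ *ᶠ c *ᶠ rate σ τ) ≈ π τ *ᶠ c *ᶠ out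
      gain-part = begin
        ∑ states (λ σ → π σ *ᶠ c *ᶠ rate σ τ)      ≈⟨ S.sum-cong states (λ σ → trans (xy∙z≈xz∙y (π σ) c (rate σ τ)) (*-comm _ c)) ⟩
        ∑ states (λ σ → c *ᶠ (π σ *ᶠ rate σ τ))    ≈⟨ sum-*ˡ commutativeRing states c (λ σ → π σ *ᶠ rate σ τ) ⟨
        c *ᶠ ∑ states (λ σ → π σ *ᶠ rate σ τ)      ≈⟨ *-congˡ (balance τ) ⟩
        c *ᶠ (π τ *ᶠ out)                          ≈⟨ *-comm c _ ⟩
        π τ *ᶠ out *ᶠ c                            ≈⟨ xy∙z≈xz∙y (π τ) out c ⟩
        π τ *ᶠ c *ᶠ out                            ∎
      loss-part : ∑ states (λ σ → π σ *ᶠ c *ᶠ (loss σ S.when (σ ≟ˢ τ))) ≈ π τ *ᶠ c *ᶠ loss τ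
      loss-part = trans (S.sum-delta _≟ˢ_ (λ σ → π σ *ᶠ c *ᶠ (loss σ S.when (σ ≟ˢ τ))) unique (complete τ)
          (λ σ σ≢τ → trans (*-congˡ (reflexive (S.when-no (σ ≟ˢ τ) σ≢τ))) (zeroʳ _)))
        (*-congˡ (reflexive (S.when-yes (τ ≟ˢ τ) ≡.refl)))

  -- Global balance for the tableau chain.

  module Stationarity {a ℓ₁ ℓ₂} (F : OrderedField a ℓ₁ ℓ₂) (Λ : Partition) (n : ℕ) .{{_ : NonZero n}}
    (x : Fin n → OrderedField.Carrier F)
    (x>0 : ∀ i → OrderedField._<ᶠ_ F (OrderedField.0# F) (x i))
    (t : OrderedField.Carrier F) where

    open OrderedField F
    open TableauChain F Λ n x x>0 t
    open OrderedFieldProperties F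
    open Fillings Λ n using (value-≡)
    open Correspondence Λ n
    open Enumeration Λ n
    open Counting Λ n using (up)
    open CommutativeRing commutativeRing using (+-commutativeMonoid; *-commutativeMonoid; *-commutativeSemigroup; semiring)
    open Exp semiring using (^-homo-*)
    module S = Sums +-commutativeMonoid
    module B = Balance commutativeRing Λ n (λ k → inverse (x>0 k)) t
    open import Relation.Binary.Reasoning.Setoid (CommutativeRing.setoid commutativeRing)

    w w′ : Tab → Cell → Carrier
    w  σ u = inverse (x>0 (σ ! u)) *ᶠ t ^ down σ u
    w′ ρ y = inverse (x>0 (ρ ! y)) *ᶠ t ^ up ρ (col y) (row y)

    monomial : Tab → Carrier
    monomial σ = ∏ cells (λ u → x (σ ! u))

    flux : ∀ σ u → Enabled σ u → wt σ *ᶠ w σ u ≈ wt (R′ σ u) *ᶠ w′ (R′ σ u) (target σ u)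
    flux σ u en = begin
      t ^ quinv σ *ᶠ monomial σ *ᶠ (iᵤ *ᶠ t ^ down σ u)   ≈⟨ regroup (t ^ quinv σ) (monomial σ) iᵤ (t ^ down σ u) ⟩
      t ^ quinv σ *ᶠ t ^ down σ u *ᶠ (monomial σ *ᶠ iᵤ)   ≈⟨ *-cong powers monomials ⟩
      t ^ quinv ρ *ᶠ t ^ d′ *ᶠ (monomial ρ *ᶠ iᵧ)         ≈⟨ regroup (t ^ quinv ρ) (monomial ρ) iᵧ (t ^ d′) ⟨
      t ^ quinv ρ *ᶠ monomial ρ *ᶠ (iᵧ *ᶠ t ^ d′)         ∎
      where
      open Forward σ u en using (statistics; contents)
      open Algebra.Properties.CommutativeSemigroup *-commutativeSemigroup using (interchange)
      ρ : Tab
      ρ = R′ σ u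
      y : Cell
      y = target σ u
      d′ : ℕ
      d′ = up ρ (col y) (row y)
      iᵤ iᵧ xᵤ xᵧ : Carrier
      iᵤ = inverse (x>0 (σ ! u))
      iᵧ = inverse (x>0 (ρ ! y))
      xᵤ = x (σ ! u)
      xᵧ = x (ρ ! y)
      regroup : ∀ p m i q → p *ᶠ m *ᶠ (i *ᶠ q) ≈ p *ᶠ q *ᶠ (m *ᶠ i)
      regroup p m i q = trans (*-congˡ (*-comm i q)) (interchange p m q i)
      powers : t ^ quinv σ *ᶠ t ^ down σ u ≈ t ^ quinv ρ *ᶠ t ^ d′
      powers = trans (sym (^-homo-* t (quinv σ) (down σ u))) (trans (reflexive (≡.cong (t ^_) statistics)) (^-homo-* t (quinv ρ) d′))
      monomials : monomial σ *ᶠ iᵤ ≈ monomial ρ *ᶠ iᵧ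
      monomials = begin
        -- Inserting `xᵧ *ᶠ iᵧ`, which is 1, makes `contents` applicable; afterwards `iᵤ *ᶠ xᵤ`
        -- cancels.
        monomial σ *ᶠ iᵤ                    ≈⟨ *-congʳ (trans (sym (*-identityʳ _)) (*-congˡ (sym (*-inverse (x>0 (ρ ! y)))))) ⟩
        monomial σ *ᶠ (xᵧ *ᶠ iᵧ) *ᶠ iᵤ      ≈⟨ *-congʳ (sym (*-assoc (monomial σ) xᵧ iᵧ)) ⟩
        monomial σ *ᶠ xᵧ *ᶠ iᵧ *ᶠ iᵤ        ≈⟨ *-congʳ (*-congʳ (sym (contents *-commutativeMonoid x))) ⟩
        monomial ρ *ᶠ xᵤ *ᶠ iᵧ *ᶠ iᵤ        ≈⟨ *-assoc (monomial ρ *ᶠ xᵤ) iᵧ iᵤ ⟩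
        monomial ρ *ᶠ xᵤ *ᶠ (iᵧ *ᶠ iᵤ)      ≈⟨ *-congˡ (*-comm iᵧ iᵤ) ⟩
        monomial ρ *ᶠ xᵤ *ᶠ (iᵤ *ᶠ iᵧ)      ≈⟨ interchange (monomial ρ) xᵤ iᵤ iᵧ ⟩
        monomial ρ *ᶠ iᵤ *ᶠ (xᵤ *ᶠ iᵧ)      ≈⟨ *-congʳ (*-comm (monomial ρ) iᵤ) ⟩
        iᵤ *ᶠ monomial ρ *ᶠ (xᵤ *ᶠ iᵧ)      ≈⟨ interchange iᵤ (monomial ρ) xᵤ iᵧ ⟩
        iᵤ *ᶠ xᵤ *ᶠ (monomial ρ *ᶠ iᵧ)      ≈⟨ *-congʳ (trans (*-comm iᵤ xᵤ) (*-inverse (x>0 (σ ! u)))) ⟩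
        1# *ᶠ (monomial ρ *ᶠ iᵧ)            ≈⟨ *-identityˡ _ ⟩
        monomial ρ *ᶠ iᵧ                    ∎

    module _ (ρ : Tab) where

      Into? : ∀ σ u → Dec (Enabled σ u × R′ σ u ≡ ρ)
      Into? σ u = enabled? σ u ×-dec (R′ σ u ≟ᵀ ρ)

      arrivals : List (Tab × Cell)
      arrivals = filter (uncurry Into?) (cartesianProduct allTabs cells)

      -- The bijection between transitions into `ρ` and covered cells, in the form in which it
      -- reindexes a sum: both lists are duplicate-free and have the same members.
      targets-↭ : L.map (uncurry target) arrivals ↭ filter (covered? ρ) cells
      targets-↭ = unique⇒↭
        (map-unique inj (filter⁺ (uncurry Into?) (cartesianProduct⁺ allTabs-unique cells-unique)))
        (filter⁺ (covered? ρ) cells-unique) to from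
        where
        into : ∀ {p} → p ∈ arrivals → Enabled (proj₁ p) (proj₂ p) × R′ (proj₁ p) (proj₂ p) ≡ ρ
        into p∈ = proj₂ (∈-filter⁻ (uncurry Into?) {xs = cartesianProduct allTabs cells} p∈)
        inj : ∀ {p p′} → p ∈ arrivals → p′ ∈ arrivals → uncurry target p ≡ uncurry target p′ → p ≡ p′
        inj p∈ p′∈ eq = target-injective (proj₁ (into p∈)) (proj₁ (into p′∈)) (≡.trans (proj₂ (into p∈)) (≡.sym (proj₂ (into p′∈)))) eq
        to : ∀ {y} → y ∈ L.map (uncurry target) arrivals → y ∈ filter (covered? ρ) cells
        to y∈ = go (∈-map⁻ (uncurry target) y∈)
          where
          go : ∀ {y} → (∃ λ p → p ∈ arrivals × y ≡ uncurry target p) → y ∈ filter (covered? ρ) cells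
          go ((σ , u) , p∈ , ≡.refl) = ∈-filter⁺ (covered? ρ) (cells-complete (target σ u))
            (≡.subst (λ τ → Covered τ (target σ u)) (proj₂ (into p∈)) (Forward.covered σ u (proj₁ (into p∈))))
        from : ∀ {y} → y ∈ filter (covered? ρ) cells → y ∈ L.map (uncurry target) arrivals
        from {y} y∈ = go (target-surjective ρ y (proj₂ (∈-filter⁻ (covered? ρ) {xs = cells} y∈)))
          where
          go : ∀ {y} → (∃₂ λ σ u → Enabled σ u × R′ σ u ≡ ρ × target σ u ≡ y) → y ∈ L.map (uncurry target) arrivals
          go (σ , u , en , eq , ≡.refl) = ∈-map⁺ (uncurry target)
            (∈-filter⁺ (uncurry Into?) (∈-cartesianProduct⁺ (allTabs-complete σ) (cells-complete u)) (en , eq))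

      inflow : ∑ allTabs (λ σ → wt σ *ᶠ rate σ ρ) ≈ wt ρ *ᶠ ∑ (filter (covered? ρ) cells) (w′ ρ)
      inflow = begin
        ∑ allTabs (λ σ → wt σ *ᶠ rate σ ρ)
          ≈⟨ S.sum-cong allTabs (λ σ → trans (sum-*ˡ commutativeRing (filter (Into? σ) cells) (wt σ) (w σ)) (S.sum-filter (Into? σ) cells (λ u → wt σ *ᶠ w σ u))) ⟩
        ∑ allTabs (λ σ → ∑ cells (λ u → (wt σ *ᶠ w σ u) S.when Into? σ u))
          ≈⟨ S.sum-cartesianProduct allTabs cells (λ (σ , u) → (wt σ *ᶠ w σ u) S.when Into? σ u) ⟨
        ∑ (cartesianProduct allTabs cells) (λ (σ , u) → (wt σ *ᶠ w σ u) S.when Into? σ u)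
          ≈⟨ S.sum-filter (uncurry Into?) (cartesianProduct allTabs cells) (λ (σ , u) → wt σ *ᶠ w σ u) ⟨
        ∑ arrivals (λ (σ , u) → wt σ *ᶠ w σ u)
          ≈⟨ S.sum-cong-∈ arrivals (λ {p} p∈ → through (proj₁ p) (proj₂ p) (proj₂ (∈-filter⁻ (uncurry Into?) {xs = cartesianProduct allTabs cells} p∈))) ⟩
        ∑ arrivals (λ (σ , u) → wt ρ *ᶠ w′ ρ (target σ u))
          ≡⟨ S.sum-map (uncurry target) arrivals (λ y → wt ρ *ᶠ w′ ρ y) ⟨
        ∑ (L.map (uncurry target) arrivals) (λ y → wt ρ *ᶠ w′ ρ y)
          ≈⟨ S.sum-↭ (λ y → wt ρ *ᶠ w′ ρ y) targets-↭ ⟩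
        ∑ (filter (covered? ρ) cells) (λ y → wt ρ *ᶠ w′ ρ y)
          ≈⟨ sum-*ˡ commutativeRing (filter (covered? ρ) cells) (wt ρ) (w′ ρ) ⟨
        wt ρ *ᶠ ∑ (filter (covered? ρ) cells) (w′ ρ) ∎
        where
        through : ∀ σ u → Enabled σ u × R′ σ u ≡ ρ → wt σ *ᶠ w σ u ≈ wt ρ *ᶠ w′ ρ (target σ u)
        through σ u (en , eq) = trans (flux σ u en) (reflexive (≡.cong (λ τ → wt τ *ᶠ w′ τ (target σ u)) eq))

      outflow : ∑ allTabs (rate ρ) ≈ ∑ cells (λ u → w ρ u S.when enabled? ρ u)
      outflow = begin
        ∑ allTabs (rate ρ)
          ≈⟨ S.sum-cong allTabs (λ σ → S.sum-filter (λ u → enabled? ρ u ×-dec (R′ ρ u ≟ᵀ σ)) cells (w ρ)) ⟩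
        ∑ allTabs (λ σ → ∑ cells (λ u → w ρ u S.when (enabled? ρ u ×-dec (R′ ρ u ≟ᵀ σ))))
          ≈⟨ S.sum-comm allTabs cells (λ σ u → w ρ u S.when (enabled? ρ u ×-dec (R′ ρ u ≟ᵀ σ))) ⟩
        ∑ cells (λ u → ∑ allTabs (λ σ → w ρ u S.when (enabled? ρ u ×-dec (R′ ρ u ≟ᵀ σ))))
          ≈⟨ S.sum-cong cells (λ u → trans
               (S.sum-delta _≟ᵀ_ (λ σ → w ρ u S.when (enabled? ρ u ×-dec (R′ ρ u ≟ᵀ σ))) allTabs-unique (allTabs-complete (R′ ρ u))
                 (λ σ σ≢ → reflexive (S.when-no (enabled? ρ u ×-dec (R′ ρ u ≟ᵀ σ)) (λ (_ , eq) → σ≢ (≡.sym eq)))))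
               (S.when-cong (enabled? ρ u ×-dec (R′ ρ u ≟ᵀ R′ ρ u)) (enabled? ρ u) proj₁ (_, ≡.refl) (λ _ → refl))) ⟩
        ∑ cells (λ u → w ρ u S.when enabled? ρ u) ∎

      global-balance : ∑ allTabs (λ σ → wt σ *ᶠ rate σ ρ) ≈ wt ρ *ᶠ ∑ allTabs (rate ρ)
      global-balance = trans inflow (*-congˡ (trans (S.sum-filter (covered? ρ) cells (w′ ρ))
        (trans (sym (B.outflow≈inflow ρ)) (sym outflow))))

    module _ (Z>0 : 0# <ᶠ totalWeight) where

      private
        i : Carrier
        i = inverse Z>0

      stationary : IsStationary (normalisedWt Z>0)
      stationary = balanced⇒stationary F _≟ᵀ_ allTabs-unique allTabs-complete rate wt i global-balance

      normalised : ∑ allTabs (normalisedWt Z>0) ≈ 1#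
      normalised = begin
        ∑ allTabs (λ σ → wt σ *ᶠ i)   ≈⟨ S.sum-cong allTabs (λ σ → *-comm (wt σ) i) ⟩
        ∑ allTabs (λ σ → i *ᶠ wt σ)   ≈⟨ sum-*ˡ commutativeRing allTabs i wt ⟨
        i *ᶠ totalWeight              ≈⟨ *-comm i totalWeight ⟩
        totalWeight *ᶠ i              ≈⟨ *-inverse Z>0 ⟩
        1#                            ∎

    module _ (t≥0 : 0# ≤ᶠ t) where

      wt-nonneg : ∀ σ → 0# ≤ᶠ wt σ
      wt-nonneg σ = *-nonneg (^-nonneg t≥0 (quinv σ)) (>⇒≥ (∏-positive cells (λ u → x>0 (σ ! u))))

      constant : Tab
      constant = tabulate (λ _ → fromℕ< {0} (ℕ.>-nonZero⁻¹ n))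

      private
        value-constant : ∀ u → value constant u ≡ suc (toℕ (fromℕ< {0} (ℕ.>-nonZero⁻¹ n)))
        value-constant u = ≡.trans (value-≡ constant u) (≡.cong (suc ∘ toℕ) (Fillings.tabulate-! Λ n _ u))

        ¬𝒬-refl : ∀ b c → ¬ 𝒬 b c c
        ¬𝒬-refl b c p = contradiction (≡.trans (≡.sym (⟦⟧-yes (𝒬? b c c) p)) (≡.trans (≡.sym (q-def b c c)) (q-refl b c))) λ ()

      -- The constant filling has positive weight even if t = 0.
      quinv-constant : quinv constant ≡ 0
      quinv-constant = ≡.trans (length-filter (quinvPair? constant) (cartesianProduct cells cells))
        (ℕΣ.sum-ε (cartesianProduct cells cells) (λ {p} _ → ⟦⟧-no (quinvPair? constant p)
          (λ (_ , _ , Q) → ¬𝒬-refl (north constant (proj₁ p)) (value constant (proj₁ p))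
            (≡.subst (𝒬 (north constant (proj₁ p)) (value constant (proj₁ p)))
              (≡.trans (value-constant (proj₂ p)) (≡.sym (value-constant (proj₁ p)))) Q))))

      wt-constant-positive : 0# <ᶠ wt constant
      wt-constant-positive = *-positive (<-respʳ (reflexive (≡.cong (t ^_) (≡.sym quinv-constant))) 0<1)
        (∏-positive cells (λ u → x>0 (constant ! u)))

      totalWeight-positive : 0# <ᶠ totalWeight
      totalWeight-positive = <-respʳ (sym (S.sum-remove _≟ᵀ_ wt allTabs-unique (allTabs-complete constant)))
        (positive+nonneg wt-constant-positive (∑-nonneg (others _≟ᵀ_ constant allTabs) wt-nonneg))

      isProbabilityMeasure : IsProbabilityMeasure (normalisedWt totalWeight-positive)
      isProbabilityMeasure = (λ σ → *-nonneg (wt-nonneg σ) (inverse-nonneg totalWeight-positive)) , normalised totalWeight-positive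

theorem4p6 : ∀ {a ℓ₁ ℓ₂} (F : OrderedField a ℓ₁ ℓ₂) (let open OrderedField F)
    (Λ : Partition) (n : ℕ) .{{_ : NonZero n}}
    (x : Fin n → Carrier) (x>0 : ∀ i → 0# <ᶠ x i)
    (t : Carrier) (t≥0 : 0# ≤ᶠ t) →
    let open TableauChain F Λ n x x>0 t in
    Σ[ Z>0 ∈ 0# <ᶠ totalWeight ]
    (IsProbabilityMeasure (normalisedWt Z>0) × IsStationary (normalisedWt Z>0))
theorem4p6 F Λ n x x>0 t t≥0 = totalWeight-positive t≥0 , isProbabilityMeasure t≥0 , stationary (totalWeight-positive t≥0)
  where open Chain.Stationarity F Λ n x x>0 t
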